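{- Let $\mathcal{G}$ be a dual equivalence graph of type $(n,n)$ with vertex set $V(\mathcal{G})$ and signature function $\sigma$, and let $\alpha:V(\mathcal{G})\to\mathbb{Z}$ be a statistic on the vertices. For a partition $\lambda$ of $n$ let $C(\lambda)$ denote the set of connected components of $\mathcal{G}$ that are isomorphic to $\mathcal{G}_\lambda$. If $\alpha$ is constant on connected components of $\mathcal{G}$ (write $\alpha(\mathcal{C})$ for its value on a component $\mathcal{C}$), then $$\sum_{v\in V(\mathcal{G})}q^{\alpha(v)}Q_{\sigma(v)}(X)=\sum_{\lambda}\sum_{\mathcal{C}\in C(\lambda)}q^{\alpha(\mathcal{C})}s_\lambda(X),$$ where $\lambda$ ranges over partitions of $n$. In particular, the generating function on the left is symmetric and Schur positive.
   Context: **Signed, colored graphs.** A signed, colored graph of type $(n,N)$, written $(V,\sigma,E_2\cup\cdots\cup E_{n-1})$, consists of a finite vertex set $V$, a signature function $\sigma:V\to\{\pm1\}^{N-1}$, and for each $1<i<n$ a collection $E_i$ of (unordered) pairs of distinct vertices, the edges of color $i$. **Dual equivalence graphs.** A signed, colored graph of type $(n,N)$ is a dual equivalence graph of type $(n,N)$ if $n\le N$ and the following hold (conditions on coordinates of $\sigma$ being imposed only for indices in $\{1,\dots,N-1\}$). (ax1) For $w\in V$ and $1<i<n$, $\sigma(w)_{i-1}=-\sigma(w)_i$ iff there exists $x\in V$ with $\{w,x\}\in E_i$; moreover $x$ is unique when it exists. (ax2) For $\{w,x\}\in E_i$, $\sigma(w)_j=-\sigma(x)_j$ for $j=i-1,i$,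 and $\sigma(w)_h=\sigma(x)_h$ for $h<i-2$ and $h>i+1$. (ax3) For $\{w,x\}\in E_i$: if $\sigma(w)_{i-2}=-\sigma(x)_{i-2}$ then $\sigma(w)_{i-2}=-\sigma(w)_{i-1}$; and if $\sigma(w)_{i+1}=-\sigma(x)_{i+1}$ then $\sigma(w)_{i+1}=-\sigma(w)_i$. (ax4) For $2<i<n$, every connected component of $(V,\sigma,E_{i-1}\cup E_i)$ is, as an edge-colored graph, one of: a single vertex; a path on three vertices with one edge of color $i-1$ and one of color $i$; two vertices joined by both an edge of color $i-1$ and an edge of color $i$. For $3<i<n$, every connected component of $(V,\sigma,E_{i-2}\cup E_{i-1}\cup E_i)$ is one of: a single vertex; a path $v_1v_2v_3v_4$ with successive colors $i-2,i-1,i$; a graph on $v_1,\dots,v_5$ with $\{v_1,v_2\}\in E_{i-2}\cap E_{i-1}$, $\{v_2,v_3\}\in E_i$, $\{v_3,v_4\}\in E_{i-2}$, $\{v_4,v_5\}\in E_{i-1}\cap E_i$ and no other edges; a graph on $u,v,w,x,y,z$ with $\{u,v\}\in E_{i-1}$, $\{v,w\}\in E_{i-2}$, $\{v,x\}\in E_i$, $\{w,y\}\in E_i$, $\{x,y\}\in E_{i-2}$, $\{y,z\}\in E_{i-1}$ and no other edges. (ax5) If $\{w,x\}\in E_i$ and $\{x,y\}\in E_j$ with $|i-j|\ge3$, then $\{w,v\}\in E_j$ and $\{v,y\}\in E_i$ for some $v\in V$. (ax6) For each $1<i<n$, any two vertices of a connected component of $(V,\sigma,E_2\cup\cdots\cup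 E_i)$ may be connected by a path crossing at most one $E_i$ edge. **Standard graphs.** The diagram of $\lambda$ is the set of cells $(i,j)$ with $1\le i\le\lambda_j$ ($i$ the column, $j$ the row, rows numbered bottom to top). $\mathrm{SYT}(\lambda)$: bijective fillings by $1,\dots,n$ increasing along rows left to right and up columns. The content of $(i,j)$ is $i-j$; the content reading word $w_T$ lists the entries of $T$ in increasing order of content, reading each diagonal southwest to northeast. $\sigma(T)\in\{\pm1\}^{n-1}$ has $\sigma(T)_i=+1$ if $i$ is left of $i+1$ in $w_T$, and $-1$ otherwise. An elementary dual equivalence for $i-1,i,i+1$ is defined on permutations in which $i$ does not lie between $i-1$ and $i+1$ in position: it switches the two of the letters $i-1,i,i+1$ in the outermost positions. $\mathcal{G}_\lambda$ is the signed, colored graph of type $(n,n)$ on $\mathrm{SYT}(\lambda)$ with signature $\sigma(T)$ and $\{T,U\}\in E_i$ iff $w_T,w_U$ differ by an elementary dual equivalence for $i-1,i,i+1$. **Isomorphism.** An isomorphism of signed, colored graphs of the same type is a signature-preserving bijection on vertices that maps edges of color $i$ to edges of color $i$ for every $i$. **Quasisymmetric functions.** For $\sigma\in\{\pm1\}^{n-1}$, $Q_\sigma(X)=\sum x_{i_1}\cdots x_{i_n}$ over $i_1\le\cdots\le i_n$ such that $i_j=i_{j+1}\Rightarrow\sigma_j=+1$. $s_\lambda$ is the Schur function. Schur positive means that the coefficients in the Schur basis are (Laurent) polynomials in $q$ with nonnegative integer coefficients. -}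

module Defs where

open import Data.Bool.Base using (if_then_else_)
open import Data.Fin.Base as Fin using (Fin; toℕ; fromℕ<; finToFun; funToFin)
open import Data.Fin.Patterns using (0F; 1F; 2F; 3F; 4F; 5F)
import Data.Fin.Properties as Fin
open import Data.Integer.Base as ℤ using (ℤ; 0ℤ; 1ℤ)
import Data.Integer.Properties as ℤ
open import Data.List.Base as List
  using (List; []; _∷_; map; concat; concatMap; cartesianProductWith;
         filter; length; lookup; zip; takeWhile; upTo; applyUpTo; allFin)
import Data.List.Properties as List
open import Data.List.Membership.Propositional using (_∈_)
open import Data.List.Relation.Binary.Permutation.Propositional using (_↭_)
open import Data.List.Relation.Unary.All as All using (All)
open import Data.List.Relation.Unary.Linked using (Linked; linked?)
open import Data.List.Relation.Unary.Unique.Propositional using (Unique)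
open import Data.Maybe.Base using (Maybe; just; nothing)
import Data.Maybe.Properties as Maybe
open import Data.Nat.Base using (ℕ; zero; suc; _+_; _∸_; ∣_-_∣; _≤_; _<_; _≥_)
open import Data.Nat.ListAction using (sum)
open import Data.Nat.Properties
  using (_≟_; _≤?_; _<?_; _≥?_; anyUpTo?; m<1+n⇒m<n∨m≡n; <⇒≤; ≤-refl)
open import Data.Product.Base using (Σ; ∃; ∃-syntax; _×_; _,_; proj₁; proj₂; map₂)
open import Data.Sign.Base as Sign using (Sign; opposite)
import Data.Sign.Properties as Sign
open import Data.Sum.Base using (_⊎_; inj₁; inj₂; swap)
open import Data.Unit.Base using (⊤; tt)
open import Data.Vec.Base as Vec using (Vec)
import Data.Vec.Properties as Vec
open import Function.Base using (_∘_)
open import Function.Bundles using (_⇔_; mk⇔; Equivalence)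
open import Function.Definitions using (Injective; Bijective)
open import Relation.Binary.Construct.Closure.ReflexiveTransitive
  using (Star; ε; _◅_; _◅◅_)
open import Relation.Binary.Core using (Rel)
open import Relation.Binary.Definitions using (Decidable)
open import Relation.Binary.PropositionalEquality
  using (_≡_; _≢_; refl; sym; trans; cong; subst; subst₂)
open import Relation.Nullary.Decidable
  using (Dec; yes; no; does; map′; ¬?; _×-dec_; _⊎-dec_; _→-dec_)
open import Relation.Unary using (Pred; U)
open import Level using (0ℓ)

import Data.List.Membership.DecPropositional _≟_ as DecMembership
import Data.List.Relation.Unary.Unique.DecPropositional _≟_ as DecUnique

-- Signs σ₁, …, σ_m are stored in a vector; `pos` is the 1-based index.
pos : ∀ {m} → Fin m → ℕ
pos h = suc (toℕ h)

-- Colours are natural numbers, and E-colour says that only 1 < i < n occur.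
-- Decidability of E is what makes each E i a set of pairs in the finite set
-- of all pairs.
record SignedColoredGraph (n N : ℕ) : Set₁ where
  field
    size       : ℕ
    signature  : Fin size → Vec Sign (N ∸ 1)
    E          : ℕ → Rel (Fin size) 0ℓ
    E-colour   : ∀ {i v w} → E i v w → 1 < i × i < n
    E-sym      : ∀ {i v w} → E i v w → E i w v
    E-distinct : ∀ {i v w} → E i v w → v ≢ w
    E?         : ∀ i → Decidable (E i)

  Vertex : Set
  Vertex = Fin size

  σ : Vertex → Fin (N ∸ 1) → Sign
  σ v = Vec.lookup (signature v)

  Step : Pred ℕ 0ℓ → Rel Vertex 0ℓ
  Step K v w = ∃[ i ] (K i × E i v w)

  Path : Pred ℕ 0ℓ → Rel Vertex 0ℓ
  Path K = Star (Step K)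

  -- A pair lying in several E i can be crossed as an edge of any one of
  -- these colours, so a path records the colour used at each step.
  colours : ∀ {K v w} → Path K v w → List ℕ
  colours ε             = []
  colours ((i , _) ◅ p) = i ∷ colours p

  crossings : ∀ {K v w} → ℕ → Path K v w → ℕ
  crossings i p = length (filter (i ≟_) (colours p))

  Connected : Rel Vertex 0ℓ
  Connected = Path U

open SignedColoredGraph

Pattern : ℕ → Set
Pattern m = List (ℕ × Fin m × Fin m)

HasEdge : ∀ {m} → Pattern m → ℕ → Rel (Fin m) 0ℓ
HasEdge P i a b = (i , a , b) ∈ P ⊎ (i , b , a) ∈ P

-- The component of v in the graph whose edges are those with colours in K
-- is isomorphic, as an edge-coloured graph, to P.
ComponentIs : ∀ {n N} (G : SignedColoredGraph n N) (K : Pred ℕ 0ℓ) (v : Vertex G)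
              {m : ℕ} (P : Pattern m) → Set
ComponentIs G K v {m} P =
  Σ (Fin m → Vertex G) λ f →
    Injective _≡_ _≡_ f ×
    (∀ w → Path G K v w ⇔ (∃[ a ] f a ≡ w)) ×
    (∀ i → K i → ∀ a b → E G i (f a) (f b) ⇔ HasEdge P i a b)

point : Pattern 1
point = []

path₃ : ℕ → ℕ → Pattern 3
path₃ i j = (i , 0F , 1F) ∷ (j , 1F , 2F) ∷ []

doubleEdge : ℕ → ℕ → Pattern 2
doubleEdge i j = (i , 0F , 1F) ∷ (j , 0F , 1F) ∷ []

path₄ : ℕ → ℕ → ℕ → Pattern 4
path₄ i j k = (i , 0F , 1F) ∷ (j , 1F , 2F) ∷ (k , 2F , 3F) ∷ []

fiveVertices : ℕ → ℕ → ℕ → Pattern 5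
fiveVertices i j k =
  (i , 0F , 1F) ∷ (j , 0F , 1F) ∷ (k , 1F , 2F) ∷
  (i , 2F , 3F) ∷ (j , 3F , 4F) ∷ (k , 3F , 4F) ∷ []

-- The vertices 0F, …, 5F are u, v, w, x, y, z.
sixVertices : ℕ → ℕ → ℕ → Pattern 6
sixVertices i j k =
  (j , 0F , 1F) ∷ (i , 1F , 2F) ∷ (k , 1F , 3F) ∷
  (k , 2F , 4F) ∷ (i , 3F , 4F) ∷ (j , 4F , 5F) ∷ []

-- In these axioms the 1-based position of a Fin index is tied to the colour
-- by an equation, so a coordinate that does not exist imposes no condition.
record IsDualEquivalenceGraph {n N : ℕ} (G : SignedColoredGraph n N) : Set where
  field
    n≤N : n ≤ N

    ax1 : ∀ i → 1 < i → i < n → ∀ w (g h : Fin (N ∸ 1)) →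
          pos g + 1 ≡ i → pos h ≡ i →
          (σ G w g ≡ opposite (σ G w h)) ⇔ (∃[ x ] E G i w x)

    ax1-unique : ∀ i w {x y} → E G i w x → E G i w y → x ≡ y

    ax2-flip : ∀ i {w x} → E G i w x → ∀ h →
               pos h + 1 ≡ i ⊎ pos h ≡ i →
               σ G w h ≡ opposite (σ G x h)

    ax2-fix : ∀ i {w x} → E G i w x → ∀ h →
              pos h + 2 < i ⊎ i + 1 < pos h →
              σ G w h ≡ σ G x h

    ax3-left : ∀ i {w x} → E G i w x → ∀ g h →
               pos g + 2 ≡ i → pos h + 1 ≡ i →
               σ G w g ≡ opposite (σ G x g) →
               σ G w g ≡ opposite (σ G w h)

    ax3-right : ∀ i {w x} → E G i w x → ∀ g h →
                pos g ≡ i + 1 → pos h ≡ i →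
                σ G w g ≡ opposite (σ G x g) →
                σ G w g ≡ opposite (σ G w h)

    ax4-two : ∀ i → 2 < i → i < n → ∀ v →
              let component-is : ∀ {m} → Pattern m → Set
                  component-is = ComponentIs G (_∈ (i ∸ 1 ∷ i ∷ [])) v
              in component-is point
               ⊎ component-is (path₃ (i ∸ 1) i)
               ⊎ component-is (doubleEdge (i ∸ 1) i)

    ax4-three : ∀ i → 3 < i → i < n → ∀ v →
                let component-is : ∀ {m} → Pattern m → Set
                    component-is = ComponentIs G (_∈ (i ∸ 2 ∷ i ∸ 1 ∷ i ∷ [])) v
                in component-is point
                 ⊎ component-is (path₄ (i ∸ 2) (i ∸ 1) i)
                 ⊎ component-is (fiveVertices (i ∸ 2) (i ∸ 1) i)
                 ⊎ component-is (sixVertices (i ∸ 2) (i ∸ 1) i)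

    ax5 : ∀ i j {w x y} → E G i w x → E G j x y → 3 ≤ ∣ i - j ∣ →
          ∃[ v ] (E G j w v × E G i v y)

    ax6 : ∀ i → 1 < i → i < n → ∀ w x → Path G (_≤ i) w x →
          Σ (Path G (_≤ i) w x) λ p → crossings G i p ≤ 1

record IsIsomorphism {n N} (G H : SignedColoredGraph n N)
                     (f : Vertex G → Vertex H) : Set where
  field
    bijective            : Bijective _≡_ _≡_ f
    signature-preserving : ∀ v → signature H (f v) ≡ signature G v
    edge-preserving      : ∀ i v w → E G i v w ⇔ E H i (f v) (f w)

infix 4 _≅_ _≅?_

_≅_ : ∀ {n N} → SignedColoredGraph n N → SignedColoredGraph n N → Set
G ≅ H = ∃[ f ] IsIsomorphism G H f

_⇔?_ : ∀ {A B : Set} → Dec A → Dec B → Dec (A ⇔ B)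
a? ⇔? b? = map′ (λ (f , g) → mk⇔ f g)
                (λ e → Equivalence.to e , Equivalence.from e)
                ((a? →-dec b?) ×-dec (b? →-dec a?))

isIsomorphism? : ∀ {n N} (G H : SignedColoredGraph n N) f → Dec (IsIsomorphism G H f)
isIsomorphism? {n} G H f =
  map′ (λ (inj , surj , s , e) → record
          { bijective = (λ {x} {y} → inj x y) , λ y → map₂ (λ { eq refl → eq }) (surj y)
          ; signature-preserving = s
          ; edge-preserving = extend e })
       (λ iso → let open IsIsomorphism iso in
          (λ x y → proj₁ bijective) ,
          (λ y → map₂ (λ g → g refl) (proj₂ bijective y)) ,
          signature-preserving ,
          (λ i → edge-preserving (toℕ i)))
       (Fin.all? (λ x → Fin.all? λ y → (f x Fin.≟ f y) →-dec (x Fin.≟ y))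
        ×-dec Fin.all? (λ y → Fin.any? λ x → f x Fin.≟ y)
        ×-dec Fin.all? (λ v → Vec.≡-dec Sign._≟_ (signature H (f v)) (signature G v))
        ×-dec Fin.all? (λ i → Fin.all? λ v → Fin.all? λ w →
                 E? G (toℕ i) v w ⇔? E? H (toℕ i) (f v) (f w)))
  where
  extend : (∀ (i : Fin n) v w → E G (toℕ i) v w ⇔ E H (toℕ i) (f v) (f w)) →
           ∀ i v w → E G i v w ⇔ E H i (f v) (f w)
  extend e i v w = mk⇔
    (λ x → Equivalence.to (at (proj₂ (E-colour G x))) x)
    (λ x → Equivalence.from (at (proj₂ (E-colour H x))) x)
    where
    at : i < n → E G i v w ⇔ E H i (f v) (f w)
    at i<n = subst (λ j → E G j v w ⇔ E H j (f v) (f w))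
                   (Fin.toℕ-fromℕ< i<n) (e (fromℕ< i<n) v w)

isIsomorphism-resp : ∀ {n N} (G H : SignedColoredGraph n N) {f g} →
                     (∀ v → f v ≡ g v) → IsIsomorphism G H f → IsIsomorphism G H g
isIsomorphism-resp G H f≗g iso = record
  { bijective =
      (λ eq → proj₁ bijective (trans (f≗g _) (trans eq (sym (f≗g _))))) ,
      λ y → map₂ (λ k z≡x → trans (sym (f≗g _)) (k z≡x)) (proj₂ bijective y)
  ; signature-preserving =
      λ v → trans (cong (signature H) (sym (f≗g v))) (signature-preserving v)
  ; edge-preserving = λ i v w →
      subst₂ (λ a b → E G i v w ⇔ E H i a b) (f≗g v) (f≗g w) (edge-preserving i v w)
  }
  where open IsIsomorphism iso

_≅?_ : ∀ {n N} → Decidable (_≅_ {n} {N})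
G ≅? H =
  map′ (λ (k , iso) → finToFun k , iso)
       (λ (f , iso) → funToFin f ,
          isIsomorphism-resp G H (λ v → sym (Fin.finToFun-funToFin f v)) iso)
       (Fin.any? (λ k → isIsomorphism? G H (finToFun k)))

-- Decidability of the reflexive transitive closure of a decidable relation on
-- a finite set: `Via j` is reachability through intermediate points below j.
module Reachability {m : ℕ} {R : Rel (Fin m) 0ℓ} (R? : Decidable R) where

  Via : ∀ j → j ≤ m → Rel (Fin m) 0ℓ
  Via zero    _   v w = v ≡ w ⊎ R v w
  Via (suc j) j<m v w =
    Via j (<⇒≤ j<m) v w ⊎
    (Via j (<⇒≤ j<m) v (fromℕ< j<m) × Via j (<⇒≤ j<m) (fromℕ< j<m) w)

  via? : ∀ j j≤m → Decidable (Via j j≤m)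
  via? zero    _   v w = (v Fin.≟ w) ⊎-dec R? v w
  via? (suc j) j<m v w =
    via? j _ v w ⊎-dec (via? j _ v (fromℕ< j<m) ×-dec via? j _ (fromℕ< j<m) w)

  sound : ∀ j j≤m {v w} → Via j j≤m v w → Star R v w
  sound zero    _   (inj₁ refl)    = ε
  sound zero    _   (inj₂ r)       = r ◅ ε
  sound (suc j) j<m (inj₁ p)       = sound j _ p
  sound (suc j) j<m (inj₂ (p , q)) = sound j _ p ◅◅ sound j _ q

  base : ∀ j j≤m {v w} → v ≡ w ⊎ R v w → Via j j≤m v w
  base zero    _ p = p
  base (suc j) _ p = inj₁ (base j _ p)

  through : ∀ j j≤m {v w} x → toℕ x < j →
            Via j j≤m v x → Via j j≤m x w → Via j j≤m v w
  through (suc j) j<m {v} {w} x x<1+j p q with m<1+n⇒m<n∨m≡n x<1+j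
  ... | inj₁ x<j = step p q
    where
    step : Via (suc j) j<m v x → Via (suc j) j<m x w → Via (suc j) j<m v w
    step (inj₁ p)       (inj₁ q)       = inj₁ (through j _ x x<j p q)
    step (inj₁ p)       (inj₂ (q , s)) = inj₂ (through j _ x x<j p q , s)
    step (inj₂ (p , r)) (inj₁ q)       = inj₂ (p , through j _ x x<j r q)
    step (inj₂ (p , _)) (inj₂ (_ , s)) = inj₂ (p , s)
  ... | inj₂ x≡j = inj₂ (first p , second q)
    where
    eq : x ≡ fromℕ< j<m
    eq = Fin.toℕ-injective (trans x≡j (sym (Fin.toℕ-fromℕ< j<m)))
    first : Via (suc j) j<m v x → Via j _ v (fromℕ< j<m)
    first (inj₁ p)       = subst (Via j _ v) eq p
    first (inj₂ (p , _)) = p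
    second : Via (suc j) j<m x w → Via j _ (fromℕ< j<m) w
    second (inj₁ q)       = subst (λ y → Via j _ y w) eq q
    second (inj₂ (_ , q)) = q

  complete : ∀ {v w} → Star R v w → Via m ≤-refl v w
  complete ε       = base m _ (inj₁ refl)
  complete (r ◅ p) = through m _ _ (Fin.toℕ<n _) (base m _ (inj₂ r)) (complete p)

  star? : Decidable (Star R)
  star? v w = map′ (sound m ≤-refl) complete (via? m ≤-refl v w)

connected? : ∀ {n N} (G : SignedColoredGraph n N) → Decidable (Connected G)
connected? {n} G = Reachability.star? λ v w →
  map′ (λ (i , _ , e) → i , tt , e)
       (λ (i , _ , e) → i , proj₂ (E-colour G e) , e)
       (anyUpTo? (λ i → E? G i v w) n)

-- A connected component is represented by its least vertex.
IsLeast : ∀ {n N} (G : SignedColoredGraph n N) → Pred (Vertex G) 0ℓ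
IsLeast G v = ∀ w → Connected G v w → v Fin.≤ w

isLeast? : ∀ {n N} (G : SignedColoredGraph n N) v → Dec (IsLeast G v)
isLeast? G v = Fin.all? λ w → connected? G v w →-dec (v Fin.≤? w)

components : ∀ {n N} (G : SignedColoredGraph n N) → List (Vertex G)
components G = filter (isLeast? G) (allFin (size G))

induced : ∀ {n N} (G : SignedColoredGraph n N) → List (Vertex G) → SignedColoredGraph n N
induced G vs = record
  { size       = length vs
  ; signature  = signature G ∘ lookup vs
  ; E          = λ i a b → E G i (lookup vs a) (lookup vs b)
  ; E-colour   = E-colour G
  ; E-sym      = E-sym G
  ; E-distinct = λ e a≡b → E-distinct G e (cong (lookup vs) a≡b)
  ; E?         = λ i a b → E? G i (lookup vs a) (lookup vs b)
  }

componentOf : ∀ {n N} (G : SignedColoredGraph n N) → Vertex G → SignedColoredGraph n N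
componentOf G v = induced G (filter (connected? G v) (allFin (size G)))

ConstantOnComponents : ∀ {n N} (G : SignedColoredGraph n N) {A : Set} →
                       (Vertex G → A) → Set
ConstantOnComponents G α = ∀ v w → Connected G v w → α v ≡ α w

[1‥_] : ℕ → List ℕ
[1‥ m ] = applyUpTo suc m

words : ∀ {A : Set} → List A → ℕ → List (List A)
words A zero    = [] ∷ []
words A (suc k) = cartesianProductWith _∷_ A (words A k)

IsPartition : ℕ → Pred (List ℕ) 0ℓ
IsPartition n μ = Linked _≥_ μ × All (1 ≤_) μ × sum μ ≡ n

isPartition? : ∀ n μ → Dec (IsPartition n μ)
isPartition? n μ = linked? _≥?_ μ ×-dec All.all? (1 ≤?_) μ ×-dec (sum μ ≟ n)

-- A partition of n has at most n parts, each at most n.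
partitions : ℕ → List (List ℕ)
partitions n = filter (isPartition? n) (concatMap (words [1‥ n ]) (upTo (suc n)))

-- The list of rows of a filling of a diagram, from bottom to top, each row
-- read from left to right.
Filling : Set
Filling = List (List ℕ)

fillings : List ℕ → List ℕ → List Filling
fillings alphabet []      = [] ∷ []
fillings alphabet (r ∷ μ) =
  cartesianProductWith _∷_ (words alphabet r) (fillings alphabet μ)

Cell : Set
Cell = ℕ × ℕ

column row : Cell → ℕ
column = proj₁
row    = proj₂

number : ∀ {A : Set} → List A → List (ℕ × A)
number xs = zip [1‥ length xs ] xs

-- Cells with their entries, rows from bottom to top.
entries : Filling → List (Cell × ℕ)
entries T = concatMap (λ (j , r) → map (λ (i , a) → (i , j) , a) (number r)) (number T)

-- R is imposed along rows from left to right, C along columns upwards.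
Increasing : (R C : Rel ℕ 0ℓ) → Pred Filling 0ℓ
Increasing R C T =
  All (λ (c , a) → All (λ (d , b) →
      (row c ≡ row d → column c < column d → R a b) ×
      (column c ≡ column d → row c < row d → C a b))
    (entries T)) (entries T)

increasing? : ∀ {R C : Rel ℕ 0ℓ} → Decidable R → Decidable C →
              ∀ T → Dec (Increasing R C T)
increasing? R? C? T =
  All.all? (λ (c , a) → All.all? (λ (d , b) →
      ((row c ≟ row d) →-dec ((column c <? column d) →-dec R? a b)) ×-dec
      ((column c ≟ column d) →-dec ((row c <? row d) →-dec C? a b)))
    (entries T)) (entries T)

IsStandard : ℕ → Pred Filling 0ℓ
IsStandard n T =
  Unique (concat T) × All (_∈ concat T) [1‥ n ] × Increasing _<_ _<_ T

isStandard? : ∀ n T → Dec (IsStandard n T)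
isStandard? n T =
  DecUnique.unique? (concat T) ×-dec
  All.all? (λ k → k DecMembership.∈? concat T) [1‥ n ] ×-dec
  increasing? _<?_ _<?_ T

-- SYT n μ is meant for a partition μ of n.
SYT : ℕ → List ℕ → List Filling
SYT n μ = filter (isStandard? n) (fillings [1‥ n ] μ)

-- Semistandard tableaux with entries in {1, …, m}.
SSYT : ℕ → List ℕ → List Filling
SSYT m μ = filter (increasing? _≤?_ _<?_) (fillings [1‥ m ] μ)

content : Cell → ℤ
content c = ℤ.+ column c ℤ.- ℤ.+ row c

-- For a diagram with n cells the contents lie between -n and n, and `entries`
-- meets the cells of each diagonal from southwest to northeast.
contentWord : ℕ → Filling → List ℕ
contentWord n T = concatMap diagonal (map (λ d → ℤ.+ d ℤ.- ℤ.+ n) (upTo (suc (n + n))))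
  where
  diagonal : ℤ → List ℕ
  diagonal k = map proj₂ (filter (λ (c , _) → content c ℤ.≟ k) (entries T))

position : List ℕ → ℕ → ℕ
position w a = length (takeWhile (λ b → ¬? (b ≟ a)) w)

wordSignature : ∀ n → List ℕ → Vec Sign (n ∸ 1)
wordSignature n w = Vec.tabulate λ h →
  if does (position w (pos h) <? position w (suc (pos h))) then Sign.+ else Sign.-

switch : ℕ → ℕ → ℕ → ℕ
switch a b x = if does (x ≟ a) then b else if does (x ≟ b) then a else x

-- The letters i-1, i, i+1 of w are listed from left to right; the outermost
-- two are switched provided that the middle one is not i.
elementary : ℕ → List ℕ → Maybe (List ℕ)
elementary i w with filter (λ a → a DecMembership.∈? (i ∸ 1 ∷ i ∷ suc i ∷ [])) w
... | a ∷ b ∷ c ∷ [] = if does (b ≟ i) then nothing else just (map (switch a c) w)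
... | _              = nothing

DifferBy : ℕ → Rel (List ℕ) 0ℓ
DifferBy i w u = elementary i w ≡ just u ⊎ elementary i u ≡ just w

differBy? : ∀ i → Decidable (DifferBy i)
differBy? i w u = Maybe.≡-dec (List.≡-dec _≟_) _ _ ⊎-dec Maybe.≡-dec (List.≡-dec _≟_) _ _

standardGraph : ∀ n → List ℕ → SignedColoredGraph n n
standardGraph n μ = record
  { size       = length (SYT n μ)
  ; signature  = wordSignature n ∘ word
  ; E          = λ i T S → 1 < i × i < n × T ≢ S × DifferBy i (word T) (word S)
  ; E-colour   = λ (l , u , _) → l , u
  ; E-sym      = λ (l , u , T≢S , d) → l , u , T≢S ∘ sym , swap d
  ; E-distinct = λ (_ , _ , T≢S , _) → T≢S
  ; E?         = λ i T S → (1 <? i) ×-dec (i <? n) ×-dec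
                           ¬? (T Fin.≟ S) ×-dec differBy? i (word T) (word S)
  }
  where
  word : Fin (length (SYT n μ)) → List ℕ
  word T = contentWord n (lookup (SYT n μ) T)

componentsIsoTo : ∀ {n} (G : SignedColoredGraph n n) → List ℕ → List (Vertex G)
componentsIsoTo {n} G μ =
  filter (λ v → componentOf G v ≅? standardGraph n μ) (components G)

-- A list of terms (k , c), standing for the sum of the c q^k.
Laurent : Set
Laurent = List (ℤ × ℤ)

coefficient : Laurent → ℤ → ℤ
coefficient []            k = 0ℤ
coefficient ((j , c) ∷ p) k =
  (if does (j ℤ.≟ k) then c else 0ℤ) ℤ.+ coefficient p k

infix 4 _≈ᴸ_ _≈_

_≈ᴸ_ : Rel Laurent 0ℓ
p ≈ᴸ r = ∀ k → coefficient p k ≡ coefficient r k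

NonNegative : Pred Laurent 0ℓ
NonNegative p = ∀ k → 0ℤ ℤ.≤ coefficient p k

q^_ : ℤ → Laurent
q^ k = (k , 1ℤ) ∷ []

-- The list a₁, …, a_m is the monomial x₁^a₁ ⋯ x_m^a_m, with m arbitrary;
-- trailing zeros do not change the monomial.
Monomial : Set
Monomial = List ℕ

Series : Set
Series = Monomial → Laurent

_≈_ : Rel Series 0ℓ
F ≈ H = ∀ a → F a ≈ᴸ H a

infixr 7 _·_

_·_ : Laurent → (Monomial → ℕ) → Series
(p · f) a = map (map₂ (ℤ._* ℤ.+ f a)) p

∑ : ∀ {A : Set} → List A → (A → Series) → Series
∑ xs F a = concatMap (λ x → F x a) xs

infix 5 ∑
syntax ∑ xs (λ x → F) = ∑[ x ∈ xs ] F

-- The exponents of x₁, …, x_m in the product of the variables indexed by w.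
exponents : ℕ → List ℕ → Monomial
exponents m w = map (λ k → length (filter (k ≟_) w)) [1‥ m ]

-- i₁ ≤ ⋯ ≤ i_n, where i_j = i_{j+1} requires σ_j = +1.
Compatible : List Sign → List ℕ → Set
Compatible (s ∷ σ) (x ∷ y ∷ w) = x ≤ y × (x ≡ y → s ≡ Sign.+) × Compatible σ (y ∷ w)
Compatible (_ ∷ _) (_ ∷ [])    = ⊤
Compatible (_ ∷ _) []          = ⊤
Compatible []      _           = ⊤

compatible? : ∀ σ w → Dec (Compatible σ w)
compatible? (s ∷ σ) (x ∷ y ∷ w) =
  (x ≤? y) ×-dec ((x ≟ y) →-dec (s Sign.≟ Sign.+)) ×-dec compatible? σ (y ∷ w)
compatible? (_ ∷ _) (_ ∷ [])    = yes tt
compatible? (_ ∷ _) []          = yes tt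
compatible? []      _           = yes tt

-- The coefficient of a = x₁^a₁ ⋯ x_m^a_m only involves indices in {1, …, m}.
Q : ∀ {n} → Vec Sign (n ∸ 1) → Monomial → ℕ
Q {n} σ a = length
  (filter (λ w → List.≡-dec _≟_ (exponents m w) a)
    (filter (compatible? (Vec.toList σ)) (words [1‥ m ] n)))
  where m = length a

schur : List ℕ → Monomial → ℕ
schur μ a = length (filter (λ T → List.≡-dec _≟_ (exponents m (concat T)) a) (SSYT m μ))
  where m = length a

Symmetric : Pred Series 0ℓ
Symmetric F = ∀ {a b} → a ↭ b → F a ≈ᴸ F b

-- For F homogeneous of degree n.
SchurPositive : ℕ → Pred Series 0ℓ
SchurPositive n F =
  Σ (List ℕ → Laurent) λ c →
    (∀ μ → NonNegative (c μ)) × F ≈ (∑[ μ ∈ partitions n ] c μ · schur μ)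

generatingFunction : ∀ {n} (G : SignedColoredGraph n n) → (Vertex G → ℤ) → Series
generatingFunction {n} G α =
  ∑[ v ∈ allFin (size G) ] (q^ α v) · Q {n} (signature G v)

{-# OPTIONS --safe #-}

-- The vertices of a dual equivalence graph are labelled by standard tableaux,
-- one letter at a time. On a component of E_2 ∪ ⋯ ∪ E_{k-1} the sign σ_k only
-- depends on the row of the letter k, monotonically so by ax3; hence exactly one
-- row for the letter k + 1 is compatible with these signs. Edges of colour k then
-- act on labels as elementary dual equivalences. If k + 1 lies between k - 1 and
-- k, the smaller letters can be rearranged, which commutes with E_k by ax5, until
-- ax4 yields a double edge. If k - 1 lies between k and k + 1, the square in the
-- six vertex graph of ax4 shows that the same removable rows lie between the rows
-- of k and k + 1 at both ends of the edge, so these rows are exchanged. By ax6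
-- the label is injective on components, and a component is therefore isomorphic
-- to G_λ for exactly one λ, the shape of its labels.
--
-- Standardisation turns the sum of the Q_σ(T) over SYT(λ) into s_λ. For the
-- symmetry of s_λ, remove the last two letters of a semistandard tableau: the
-- intermediate shapes form a box, and reflecting it exchanges the exponents.

module Submission where

open import Defs
open import Data.Bool.Base using (true; false; if_then_else_)
open import Data.Fin.Base as Fin using (Fin; toℕ; fromℕ<)
open import Data.Fin.Patterns using (0F; 1F; 2F; 3F; 4F; 5F)
import Data.Fin.Properties as Fin
open import Data.Integer.Base as ℤ using (ℤ; 0ℤ; 1ℤ)
import Data.Integer.Properties as ℤ
open import Data.List.Base
  using (List; []; _∷_; _++_; _∷ʳ_; _∷ʳ′_; initLast; length; filter; map; concat; concatMap;
         replicate; lookup; zip; upTo; applyUpTo; allFin; reverse)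
open import Data.List.Properties as List
  using (length-++; ++-assoc; ++-identityʳ; ∷-injective; ∷-injectiveˡ; ∷-injectiveʳ; ∷ʳ-injective;
         filter-accept; filter-reject; filter-++; filter-all; filter-none; map-++; map-∘; map-cong;
         length-map; length-replicate; map-concatMap; unfold-reverse; reverse-injective;
         reverse-involutive; length-reverse; applyUpTo-∷ʳ)
import Data.List.Membership.DecPropositional as DecMembership
open import Data.List.Membership.Propositional using (_∈_; _∉_)
open import Data.List.Membership.Propositional.Properties
  using (∈-map⁺; ∈-map⁻; ∈-++⁺ˡ; ∈-++⁺ʳ; ∈-++⁻; ∈-filter⁺; ∈-filter⁻; ∈-concat⁺′; ∈-concat⁻′;
         ∈-lookup; ∈-allFin; ∈-upTo⁺; ∈-applyUpTo⁺; ∈-applyUpTo⁻; ∈-cartesianProductWith⁺;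
         ∈-cartesianProductWith⁻; ∈-∃++)
open import Data.List.Relation.Binary.Permutation.Propositional as Perm
  using (_↭_; ↭-sym; ↭-trans; ↭-refl)
import Data.List.Relation.Binary.Permutation.Propositional.Properties as Perm
open import Data.List.Relation.Unary.All as All using (All; []; _∷_)
import Data.List.Relation.Unary.All.Properties as All
open import Data.List.Relation.Unary.AllPairs as AllPairs using (AllPairs; []; _∷_)
import Data.List.Relation.Unary.AllPairs.Properties as AllPairs
open import Data.List.Relation.Unary.Any using (here; there; index)
import Data.List.Relation.Unary.Any.Properties as Any
open import Data.List.Relation.Unary.Linked using (Linked; []; [-]; _∷_)
open import Data.List.Relation.Unary.Linked.Properties using (Linked⇒AllPairs; AllPairs⇒Linked)
open import Data.List.Relation.Unary.Unique.Propositional using (Unique)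
import Data.List.Relation.Unary.Unique.Propositional.Properties as Unique
open import Data.Maybe.Base using (just; nothing)
open import Data.Maybe.Properties using (just-injective)
open import Data.Nat.Base
open import Data.Nat.ListAction using (sum)
open import Data.Nat.ListAction.Properties using (sum-↭)
open import Data.Nat.Properties
open import Data.Nat.Solver using (module +-*-Solver)
open import Data.Product.Base using (Σ; ∃; ∃-syntax; _×_; _,_; proj₁; proj₂; map₁; map₂)
open import Data.Product.Properties using (≡-dec)
open import Data.Sign.Base as Sign using (Sign; opposite)
import Data.Sign.Properties as Sign
open import Data.Sum.Base as Sum using (_⊎_; inj₁; inj₂)
open import Data.Unit.Base using (tt)
import Data.Vec.Base as Vec
import Data.Vec.Properties as Vec
open import Function.Base using (_∘_; id; case_of_)
open import Function.Bundles using (Equivalence; mk⇔)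
open import Relation.Binary.Construct.Closure.ReflexiveTransitive as Star
  using (Star; ε; _◅_; _◅◅_; gmap)
open import Relation.Binary.Core using (Rel)
open import Relation.Binary.Definitions using (tri<; tri≈; tri>)
open import Relation.Binary.PropositionalEquality
open import Relation.Nullary.Decidable as Decidable
  using (Dec; yes; no; does; dec-true; dec-false; _⊎-dec_; _→-dec_; _×-dec_; ¬?; from-yes)
open import Relation.Nullary.Negation using (¬_; contradiction)
open import Relation.Unary using (Pred)
open import Level using (0ℓ)

open SignedColoredGraph

-- Row words of standard tableaux

-- Injectivity of labels is carried through the induction because the next letter depends on it: two
-- vertices with the letter `k` in the same row are shown to have the same sign σ_k by rearranging
-- smaller letters and then identifying vertices through their labels. The signs at a vertex tell
-- which move an edge of the new colour ought to make, but not where it leads. If k + 1 lies in the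
-- middle, this letter stays put and colour k - 1 can make the same switch. If k - 1 lies in the
-- middle at both ends, the letter k + 1 itself changes rows, which no smaller colour can achieve,
-- so the rows at the far end must be recovered from the corners lying between them. Labels are
-- compared through signs in two situations, at the two ends of an edge and between a component and
-- a standard graph; hence the comparison is made for an abstract simulation. Words of rows are used
-- instead of fillings because the first letters then form a suffix, on which the small colours act,
-- and no shape has to be known in advance. Fillings return through biwords, which treat standard
-- and semistandard tableaux alike.

δ : ℕ → ℕ → ℕ
δ r x = if does (r ≟ x) then 1 else 0

δ-refl : ∀ r → δ r r ≡ 1
δ-refl r = cong (if_then 1 else 0) (dec-true (r ≟ r) refl)

δ-≢ : ∀ {r x} → r ≢ x → δ r x ≡ 0
δ-≢ {r} {x} r≢x = cong (if_then 1 else 0) (dec-false (r ≟ x) r≢x)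

-- A tableau is encoded by the rows (counted from 0) of its letters, the
-- largest letter first.
Word : Set
Word = List ℕ

count : ℕ → Word → ℕ
count r []      = 0
count r (x ∷ w) = δ r x + count r w

count-here : ∀ r w → count r (r ∷ w) ≡ suc (count r w)
count-here r w rewrite δ-refl r = refl

count-there : ∀ {r x} w → r ≢ x → count r (x ∷ w) ≡ count r w
count-there w r≢x rewrite δ-≢ r≢x = refl

count-≤ : ∀ r x w → count r w ≤ count r (x ∷ w)
count-≤ r x w = m≤n+m _ (δ r x)

-- Rows being drawn upwards, the last cell of row `r` is a corner exactly when the row above is
-- strictly shorter. The same inequality allows row `r + 1` to grow, whence `Addable`.
record Removable (r : ℕ) (w : Word) : Set where
  constructor removable
  field drop : count (suc r) w < count r w

open Removable

data Addable : ℕ → Word → Set where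
  zero : ∀ {w} → Addable zero w
  suc  : ∀ {r w} → Removable r w → Addable (suc r) w

-- Yamanouchi words, read from the right: every suffix is the tableau formed by the smaller letters.
data Yam : Word → Set where
  []  : Yam []
  _∷_ : ∀ {r w} → Addable r w → Yam w → Yam (r ∷ w)

infix 4 _∼_

record _∼_ (u v : Word) : Set where
  constructor same
  field counts : ∀ r → count r u ≡ count r v

open _∼_

∼-refl : ∀ {u} → u ∼ u
∼-refl = same λ _ → refl

∼-sym : ∀ {u v} → u ∼ v → v ∼ u
∼-sym (same eq) = same λ r → sym (eq r)

∼-trans : ∀ {u v w} → u ∼ v → v ∼ w → u ∼ w
∼-trans (same eq) (same eq′) = same λ r → trans (eq r) (eq′ r)

∷-∼ : ∀ x {u v} → u ∼ v → x ∷ u ∼ x ∷ v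
∷-∼ x (same eq) = same λ r → cong (δ r x +_) (eq r)

∷-∼⁻ : ∀ x {u v} → x ∷ u ∼ x ∷ v → u ∼ v
∷-∼⁻ x (same eq) = same λ r → +-cancelˡ-≡ (δ r x) _ _ (eq r)

∷∷-∼ : ∀ x y {u} → x ∷ y ∷ u ∼ y ∷ x ∷ u
∷∷-∼ x y {u} = same λ r → begin
  δ r x + (δ r y + count r u) ≡⟨ +-assoc (δ r x) _ _ ⟨
  δ r x + δ r y + count r u   ≡⟨ cong (_+ count r u) (+-comm (δ r x) _) ⟩
  δ r y + δ r x + count r u   ≡⟨ +-assoc (δ r y) _ _ ⟩
  δ r y + (δ r x + count r u) ∎
  where open ≡-Reasoning

Removable-resp : ∀ {r u v} → u ∼ v → Removable r u → Removable r v
Removable-resp (same eq) (removable p) = removable (subst₂ _<_ (eq _) (eq _) p)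

Addable-resp : ∀ {r u v} → u ∼ v → Addable r u → Addable r v
Addable-resp _   zero    = zero
Addable-resp u∼v (suc p) = suc (Removable-resp u∼v p)

count-suc : ∀ {w} → Yam w → ∀ j → count (suc j) w ≤ count j w
count-suc []                _ = z≤n
count-suc (_∷_ {r} {w} a y) j with suc j ≟ r | a
... | yes refl | suc (removable p) =
  ≤-trans (≤-reflexive (count-here (suc j) w)) (≤-trans p (count-≤ j r w))
... | no  j≢r  | _                 =
  ≤-trans (≤-reflexive (count-there w j≢r)) (≤-trans (count-suc y j) (count-≤ j r w))

count-antitone : ∀ {w} → Yam w → ∀ {i j} → i ≤ j → count j w ≤ count i w
count-antitone {w} y i≤j = go (≤⇒≤′ i≤j)
  where
  go : ∀ {i j} → i ≤′ j → count j w ≤ count i w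
  go ≤′-refl         = ≤-refl
  go (≤′-step {n} p) = ≤-trans (count-suc y n) (go p)

head-removable : ∀ {d w} → Yam (d ∷ w) → Removable d (d ∷ w)
head-removable {d} {w} (_ ∷ y) = removable
  (subst₂ _<_ (sym (count-there w 1+n≢n)) (sym (count-here d w)) (s≤s (count-suc y d)))

removable-tail : ∀ {d r w} → r ≢ d → Removable d (r ∷ w) → Removable d w
removable-tail {d} {r} {w} r≢d (removable p) = removable
  (≤-trans (s≤s (count-≤ (suc d) r w)) (≤-trans p (≤-reflexive (count-there w (r≢d ∘ sym)))))

addable-cons : ∀ {d r w} → r ≢ d → Addable d w → Addable d (r ∷ w)
addable-cons             _   zero              = zero
addable-cons {r = r} {w} r≢d (suc (removable p)) = suc (removable
  (≤-trans (s≤s (≤-reflexive (count-there w (r≢d ∘ sym)))) (≤-trans p (count-≤ _ r w))))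

addable-uncons : ∀ {x y w} → x ≢ suc y → x ≢ y → Addable x (y ∷ w) → Addable x w
addable-uncons             _     _   zero                = zero
addable-uncons {w = w} x≢1+y x≢y (suc (removable p)) = suc (removable
  (subst₂ _<_ (count-there w x≢y) (count-there w (x≢1+y ∘ cong suc)) p))

-- Any corner can hold the largest letter. The corner is moved to the front of the tail by
-- induction, and the old head `r` must remain addable. Only `r = d + 1` is delicate: there, that
-- `d` is a corner of the whole word leaves one spare cell in row `d`.
front : ∀ {d u} → Yam u → Removable d u →
        ∃[ t ] (Yam (d ∷ t) × d ∷ t ∼ u × length (d ∷ t) ≡ length u)
front {d} (_∷_ {r} {u} a y) p with r ≟ d
... | yes refl = u , a ∷ y , ∼-refl , refl
... | no  r≢d with front y (removable-tail r≢d p)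
... | t , (b ∷ z) , du , len =
  r ∷ t , addable-cons r≢d b ∷ (a′ a p ∷ z) ,
  ∼-trans (∷∷-∼ d r) (∷-∼ r du) , cong suc len
  where
  eq = counts du
  a′ : Addable r u → Removable d (r ∷ u) → Addable r t
  a′ zero                          _ = zero
  a′ (suc {r = r′} (removable q)) (removable p) with r′ ≟ d
  ... | no r′≢d = suc (removable (subst₂ _<_
          (trans (sym (eq (suc r′))) (count-there t r≢d))
          (trans (sym (eq r′)) (count-there t r′≢d)) q))
  ... | yes refl = suc (removable (s≤s⁻¹ (subst₂ _<_
          (trans (count-here (suc d) u) (cong suc (trans (sym (eq (suc d))) (count-there t r≢d))))
          (trans (count-there u (r≢d ∘ sym)) (trans (sym (eq d)) (count-here d t))) p)))

-- The witness is `e = b - 1`. Since `b` could be added, row `b - 1` is longer than row `b`, and it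
-- still ends in a corner after the corner of row `d` is gone as well. With this cell as third
-- letter, the two largest letters can be switched between rows `b` and `d`.
exchange : ∀ {b s d} → Yam (b ∷ s) → d < b → Removable d (b ∷ s) →
           ∃[ e ] ∃[ t ] (d ≤ e × e < b × Yam (d ∷ e ∷ t) × Yam (b ∷ e ∷ t) ×
                          d ∷ e ∷ t ∼ s × length (d ∷ e ∷ t) ≡ length s)
exchange {suc e} {s} {d} (suc a ∷ y) (s≤s d≤e) p
  with front y (removable-tail (λ { refl → 1+n≰n d≤e }) p)
... | s₁ , (b ∷ y₁) , ds₁ , len₁ with e-removable a p
  where
  eq = counts ds₁
  1+e≢d : suc e ≢ d
  1+e≢d refl = 1+n≰n d≤e
  e-removable : Removable e s → Removable d (suc e ∷ s) → Removable e s₁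
  e-removable (removable a) (removable p) with e ≟ d
  ... | no e≢d = removable (subst₂ _<_ (trans (sym (eq (suc e))) (count-there s₁ 1+e≢d))
                            (trans (sym (eq e)) (count-there s₁ e≢d)) a)
  ... | yes refl = removable (s≤s⁻¹ (subst₂ _<_
          (trans (count-here (suc d) s) (cong suc (trans (sym (eq (suc d))) (count-there s₁ 1+e≢d))))
          (trans (count-there s (1+e≢d ∘ sym)) (trans (sym (eq d)) (count-here d s₁))) p))
... | e-rem with front y₁ e-rem
... | t , z , et , len₂ =
  e , t , d≤e , ≤-refl , Addable-resp (∼-sym et) b ∷ z ,
  suc (Removable-resp (∼-sym et) e-rem) ∷ z ,
  ∼-trans (∷-∼ d et) ds₁ , trans (cong suc len₂) len₁

-- `sg r q` is the sign σ_i if i + 1 lies in row r and i in row q.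
sg : ℕ → ℕ → Sign
sg r q = if does (r ≤? q) then Sign.+ else Sign.-

sg-≤ : ∀ {r q} → r ≤ q → sg r q ≡ Sign.+
sg-≤ {r} {q} r≤q = cong (if_then Sign.+ else Sign.-) (dec-true (r ≤? q) r≤q)

sg-> : ∀ {r q} → q < r → sg r q ≡ Sign.-
sg-> {r} {q} q<r = cong (if_then Sign.+ else Sign.-) (dec-false (r ≤? q) (<⇒≱ q<r))

sg-+ : ∀ {r q} → sg r q ≡ Sign.+ → r ≤ q
sg-+ {r} {q} eq with ≤-<-connex r q
... | inj₁ r≤q = r≤q
... | inj₂ q<r = contradiction (trans (sym eq) (sg-> q<r)) λ ()

≢⇒opposite : ∀ {s t} → s ≢ t → s ≡ opposite t
≢⇒opposite {Sign.-} {Sign.-} s≢t = contradiction refl s≢t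
≢⇒opposite {Sign.-} {Sign.+} _   = refl
≢⇒opposite {Sign.+} {Sign.-} _   = refl
≢⇒opposite {Sign.+} {Sign.+} s≢t = contradiction refl s≢t

opposite⇒≢ : ∀ {s t} → s ≡ opposite t → s ≢ t
opposite⇒≢ {t = Sign.-} refl ()
opposite⇒≢ {t = Sign.+} refl ()

-- Elementary dual equivalences: p, q, r are the rows of the letters i - 1, i
-- and i + 1. Reading cells by increasing content lists the rows in decreasing
-- order (the smaller letter first in case of a tie), so these are the Knuth
-- relations; under Left the letters i - 1 and i are switched, with i + 1
-- between them, under Right the letters i and i + 1, with i - 1 between them.
data Left (p q r : ℕ) : Set where
  up   : p < r → r ≤ q → Left p q r
  down : q < r → r ≤ p → Left p q r

data Right (p q r : ℕ) : Set where
  up   : q ≤ p → p < r → Right p q r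
  down : r ≤ p → p < q → Right p q r

data Knuth (p q r : ℕ) : ℕ → ℕ → ℕ → Set where
  left  : Left p q r → Knuth p q r q p r
  right : Right p q r → Knuth p q r p r q

Left-sym : ∀ {p q r} → Left p q r → Left q p r
Left-sym (up a b)   = down a b
Left-sym (down a b) = up a b

Right-sym : ∀ {p q r} → Right p q r → Right p r q
Right-sym (up a b)   = down a b
Right-sym (down a b) = up a b

Left-≢ : ∀ {p q r} → Left p q r → p ≢ q
Left-≢ (up a b)   refl = <⇒≱ a b
Left-≢ (down a b) refl = <⇒≱ a b

Right-≢ : ∀ {p q r} → Right p q r → q ≢ r
Right-≢ (up a b)   refl = <⇒≱ b a
Right-≢ (down a b) refl = <⇒≱ b a

Left-Right : ∀ {p q r} → Left p q r → ¬ Right p q r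
Left-Right (up a b)   (up c d)   = <⇒≱ (<-≤-trans a b) c
Left-Right (up a b)   (down c d) = <⇒≱ a c
Left-Right (down a b) (up c d)   = <⇒≱ d b
Left-Right (down a b) (down c d) = <⇒≱ (<-≤-trans a b) (<⇒≤ d)

Knuth-sym : ∀ {p q r p′ q′ r′} → Knuth p q r p′ q′ r′ → Knuth p′ q′ r′ p q r
Knuth-sym (left l)  = left (Left-sym l)
Knuth-sym (right r) = right (Right-sym r)

Knuth-det : ∀ {p q r p′ q′ r′ p″ q″ r″} → Knuth p q r p′ q′ r′ → Knuth p q r p″ q″ r″ →
            p′ ≡ p″ × q′ ≡ q″ × r′ ≡ r″
Knuth-det (left _)  (left _)  = refl , refl , refl
Knuth-det (left l)  (right r) = contradiction r (Left-Right l)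
Knuth-det (right r) (left l)  = contradiction r (Left-Right l)
Knuth-det (right _) (right _) = refl , refl , refl

+≢- : ∀ {s t} → s ≡ Sign.+ → t ≡ Sign.- → s ≢ t
+≢- refl refl ()

Left-sg : ∀ {p q r} → Left p q r → sg q p ≢ sg r q
Left-sg (up a b)   = +≢- (sg-≤ b) (sg-> (<-≤-trans a b)) ∘ sym
Left-sg (down a b) = +≢- (sg-≤ (<⇒≤ (<-≤-trans a b))) (sg-> a)

Right-sg : ∀ {p q r} → Right p q r → sg q p ≢ sg r q
Right-sg (up a b)   = +≢- (sg-≤ a) (sg-> (≤-<-trans a b))
Right-sg (down a b) = +≢- (sg-≤ (<⇒≤ (≤-<-trans a b))) (sg-> b) ∘ sym

Knuth-sg : ∀ {p q r p′ q′ r′} → Knuth p q r p′ q′ r′ → sg q p ≢ sg r q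
Knuth-sg (left l)  = Left-sg l
Knuth-sg (right r) = Right-sg r

-- Different signs mean that the letter `i` is not in the middle in reading order; which of `i - 1`
-- and `i + 1` is there decides the case.
Left⊎Right : ∀ {p q r} → sg q p ≢ sg r q → Left p q r ⊎ Right p q r
Left⊎Right {p} {q} {r} ne with ≤-<-connex q p | ≤-<-connex r q | ≤-<-connex r p
... | inj₁ a | inj₁ b | _      = contradiction (trans (sg-≤ a) (sym (sg-≤ b))) ne
... | inj₁ a | inj₂ b | inj₁ c = inj₁ (down b c)
... | inj₁ a | inj₂ b | inj₂ c = inj₂ (up a c)
... | inj₂ a | inj₁ b | inj₁ c = inj₂ (down c a)
... | inj₂ a | inj₁ b | inj₂ c = inj₁ (up c b)
... | inj₂ a | inj₂ b | _      = contradiction (trans (sg-> a) (sym (sg-> b))) ne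

-- Dual equivalence moves on row words

infix 4 _⟶[_]_ _⟶_

-- The suffix `s` consists of the letters below `i - 1`, whence `i = 2 + length s`.
data _⟶[_]_ : Word → ℕ → Word → Set where
  here  : ∀ {i p q r p′ q′ r′ s} → i ≡ 2 + length s → Knuth p q r p′ q′ r′ →
          r ∷ q ∷ p ∷ s ⟶[ i ] r′ ∷ q′ ∷ p′ ∷ s
  there : ∀ {i c u v} → u ⟶[ i ] v → c ∷ u ⟶[ i ] c ∷ v

_⟶_ : Word → Word → Set
u ⟶ v = ∃[ i ] u ⟶[ i ] v

⟶-sym : ∀ {i u v} → u ⟶[ i ] v → v ⟶[ i ] u
⟶-sym (here eq k) = here eq (Knuth-sym k)
⟶-sym (there st)  = there (⟶-sym st)

⟶-colour : ∀ {i u v} → u ⟶[ i ] v → 1 < i × i < length u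
⟶-colour (here refl k) = s≤s (s≤s z≤n) , ≤-refl
⟶-colour (there st)    = proj₁ (⟶-colour st) , m<n⇒m<1+n (proj₂ (⟶-colour st))

⟶-from : ∀ {i u u′ v} → u ≡ u′ → u ⟶[ i ] v → u′ ⟶[ i ] v
⟶-from refl st = st

⟶-length : ∀ {i u v} → u ⟶[ i ] v → length u ≡ length v
⟶-length (here _ _) = refl
⟶-length (there st) = cong suc (⟶-length st)

⟶-∼ : ∀ {i u v} → u ⟶[ i ] v → u ∼ v
⟶-∼ (here _ (left l))  = ∷-∼ _ (∷∷-∼ _ _)
⟶-∼ (here _ (right r)) = ∷∷-∼ _ _
⟶-∼ (there st)         = ∷-∼ _ (⟶-∼ st)

-- A move of colour `i` affects no letter beyond `i + 1`, so for `i < length u` it happens inside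
-- `u`.
⟶-unskip : ∀ pre {i u x} → pre ++ u ⟶[ i ] x → i < length u →
           ∃[ v ] (x ≡ pre ++ v × u ⟶[ i ] v)
⟶-unskip []          st         _ = _ , refl , st
⟶-unskip (c ∷ [])          (here refl _) l = contradiction l (<-irrefl refl)
⟶-unskip (c ∷ d ∷ [])      (here refl _) l = contradiction (m≤n⇒m≤1+n l) (<-irrefl refl)
⟶-unskip (c ∷ d ∷ e ∷ pre) (here refl _) l = contradiction
  (≤-trans l (≤-trans (m≤n+m _ (2 + length pre)) (s≤s (s≤s (≤-reflexive (sym (length-++ pre)))))))
  (<-irrefl refl)
⟶-unskip (c ∷ pre) (there st) l with ⟶-unskip pre st l
... | v , refl , st′ = v , refl , st′

⟶-det : ∀ {i u v w} → u ⟶[ i ] v → u ⟶[ i ] w → v ≡ w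
⟶-det (here _ k) (here _ l) with Knuth-det k l
... | refl , refl , refl = refl
⟶-det (here refl _) (there st) = contradiction (proj₂ (⟶-colour st)) (<-irrefl refl)
⟶-det (there st) (here refl _) = contradiction (proj₂ (⟶-colour st)) (<-irrefl refl)
⟶-det (there st) (there st′) = cong (_ ∷_) (⟶-det st st′)

⟶-skip : ∀ pre {i u v} → u ⟶[ i ] v → pre ++ u ⟶[ i ] pre ++ v
⟶-skip []        st = st
⟶-skip (c ∷ pre) st = there (⟶-skip pre st)

⟶-letters : ∀ {i u v} → u ⟶[ i ] v →
  ∃[ pre ] ∃[ r ] ∃[ q ] ∃[ p ] ∃[ s ]
    (u ≡ pre ++ r ∷ q ∷ p ∷ s × i ≡ 2 + length s × sg q p ≢ sg r q)
⟶-letters (here eq k) = [] , _ , _ , _ , _ , refl , eq , Knuth-sg k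
⟶-letters (there {c = c} st) with ⟶-letters st
... | pre , _ , _ , _ , _ , refl , eq , ne = c ∷ pre , _ , _ , _ , _ , refl , eq , ne

swap-tops : ∀ {d e b t} → d ≤ e → e < b → b ∷ d ∷ e ∷ t ⟶[ 2 + length t ] d ∷ b ∷ e ∷ t
swap-tops d≤e e<b = here refl (right (up d≤e e<b))

⟶⋆-sym : ∀ {u v} → Star _⟶_ u v → Star _⟶_ v u
⟶⋆-sym = Star.reverse λ (i , st) → i , ⟶-sym st

-- The tableaux of one shape form a single dual equivalence class. When the largest letters lie in
-- distinct rows, `exchange` supplies one move switching these rows, and the induction on the size
-- connects its two ends with the given tableaux below a fixed largest letter.
connect : ∀ n {u v} → length u ≡ n → length v ≡ n → Yam u → Yam v → u ∼ v → Star _⟶_ u v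
connect-> : ∀ n {b s d s′} → length (b ∷ s) ≡ suc n → length (d ∷ s′) ≡ suc n →
            Yam (b ∷ s) → Yam (d ∷ s′) → d < b → b ∷ s ∼ d ∷ s′ → Star _⟶_ (b ∷ s) (d ∷ s′)

connect zero {[]} {[]} _ _ _ _ _ = ε
connect (suc n) {x ∷ u} {y ∷ v} lu lv yu@(_ ∷ yu′) yv@(_ ∷ yv′) eq with <-cmp x y
... | tri< x<y _ _ = ⟶⋆-sym (connect-> n lv lu yv yu x<y (∼-sym eq))
... | tri> _ _ y<x = connect-> n lu lv yu yv y<x eq
... | tri≈ _ refl _ = gmap (x ∷_) (λ (i , st) → i , there st)
        (connect n (suc-injective lu) (suc-injective lv) yu′ yv′ (∷-∼⁻ x eq))

connect-> n {b} {s} {d} {s′} lb ld yb@(_ ∷ ys) yd@(_ ∷ ys′) d<b eq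
  with exchange yb d<b (Removable-resp (∼-sym eq) (head-removable yd))
... | e , t , d≤e , e<b , yde , ybe , eq′ , len =
  gmap (b ∷_) (λ (i , st) → i , there st)
    (connect n (suc-injective lb) (trans len (suc-injective lb)) ys yde (∼-sym eq′))
  ◅◅ (_ , swap-tops d≤e e<b) ◅
  gmap (d ∷_) (λ (i , st) → i , there st)
    (connect n (trans len (suc-injective lb)) (suc-injective ld) ybe ys′
      (∷-∼⁻ d (∼-trans (∷∷-∼ d b) (∼-trans (∷-∼ b eq′) eq))))

-- Signs and local structure of dual equivalence graphs

-- Coordinates that do not exist are read as +.
sgn : ∀ {n N} (G : SignedColoredGraph n N) → Vertex G → ℕ → Sign
sgn {N = N} G v zero    = Sign.+
sgn {N = N} G v (suc h) with h <? N ∸ 1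
... | yes h<m = σ G v (fromℕ< h<m)
... | no  _   = Sign.+

sgn-σ : ∀ {n N} (G : SignedColoredGraph n N) v (h : Fin (N ∸ 1)) → sgn G v (pos h) ≡ σ G v h
sgn-σ {N = N} G v h with toℕ h <? N ∸ 1
... | yes h<m = cong (σ G v) (Fin.fromℕ<-toℕ h h<m)
... | no h≮m  = contradiction (Fin.toℕ<n h) h≮m

-- A view of an index that spares the statements about `sgn` all bounds: outside the range the sign
-- is constantly +, hence never changes along an edge.
data Coordinate {N} : ℕ → Set₁ where
  inside  : (h : Fin (N ∸ 1)) → Coordinate (pos h)
  outside : ∀ {j} → (∀ {n} (G : SignedColoredGraph n N) v → sgn G v j ≡ Sign.+) → Coordinate j

coordinate : ∀ {N} j → Coordinate {N} j
coordinate zero = outside λ _ _ → refl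
coordinate {N} (suc h) with h <? N ∸ 1
... | yes h<m = subst (Coordinate ∘ suc) (Fin.toℕ-fromℕ< h<m) (inside (fromℕ< h<m))
... | no  h≮m = outside λ G v → lemma G v
  where
  lemma : ∀ {n} (G : SignedColoredGraph n N) v → sgn G v (suc h) ≡ Sign.+
  lemma G v with h <? N ∸ 1
  ... | yes h<m = contradiction h<m h≮m
  ... | no _    = refl

inside? : ∀ {N j} → suc j < N → ∃[ h ] pos {N ∸ 1} h ≡ suc j
inside? {suc N} (s≤s j<N) = fromℕ< j<N , cong suc (Fin.toℕ-fromℕ< j<N)

-- A labelling assigns to every vertex the first k letters of a tableau; the
-- edges of colour less than e act on labels as elementary dual equivalences.
record Labelling {n N} (G : SignedColoredGraph n N) (k e : ℕ) : Set where
  field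
    L    : Vertex G → Word
    len  : ∀ v → length (L v) ≡ k
    yam  : ∀ v → Yam (L v)
    sig  : ∀ v pre {r q s} → L v ≡ pre ++ r ∷ q ∷ s → sgn G v (suc (length s)) ≡ sg r q
    edge : ∀ {i v w} → E G i v w → i < e → L v ⟶[ i ] L w

-- Patterns with tags instead of colours, on which statements about patterns
-- can be decided.
module Tags {m : ℕ} (P : List (Fin 3 × Fin m × Fin m)) where

  Edge : Fin 3 → Fin m → Fin m → Set
  Edge t a b = (t , a , b) ∈ P ⊎ (t , b , a) ∈ P

  edge? : ∀ t a b → Dec (Edge t a b)
  edge? t a b = ((t , a , b) ∈? P) ⊎-dec ((t , b , a) ∈? P)
    where open DecMembership (≡-dec Fin._≟_ (≡-dec Fin._≟_ Fin._≟_))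

  module _ (col : Fin 3 → ℕ) (col-inj : ∀ {s t} → col s ≡ col t → s ≡ t) where

    from∈ : ∀ {t a b} → (col t , a , b) ∈ map (map₁ col) P → (t , a , b) ∈ P
    from∈ p with ∈-map⁻ (map₁ col) p
    ... | (s , _) , q , eq with col-inj (cong proj₁ eq) | cong proj₂ eq
    ... | refl | refl = q

    from : ∀ {t a b} → HasEdge (map (map₁ col) P) (col t) a b → Edge t a b
    from (inj₁ p) = inj₁ (from∈ p)
    from (inj₂ p) = inj₂ (from∈ p)

    to : ∀ {t a b} → Edge t a b → HasEdge (map (map₁ col) P) (col t) a b
    to (inj₁ p) = inj₁ (∈-map⁺ (map₁ col) p)
    to (inj₂ p) = inj₂ (∈-map⁺ (map₁ col) p)

  -- In the path on three vertices no edge has the other colour at both of its ends, so the premises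
  -- can be met by a double edge alone.
  Two : Fin 3 → Fin 3 → Set
  Two s t = ∀ a b → Edge s a b → (∀ c → Edge t a c → ∀ d → Edge t b d → Edge t a b)

  -- Besides the square of six vertices, the pattern of five vertices has an edge of tag 0 with
  -- edges of tag 2 at both ends; there one of the latter is doubled by tag 1, which the premises
  -- exclude.
  Square : Set
  Square = ∀ a b → Edge 0F a b → ∀ c → Edge 2F a c → ¬ Edge 1F a c →
           ∀ d → Edge 2F b d → ¬ Edge 1F b d → Edge 0F c d

  two? : ∀ s t → Dec (Two s t)
  two? s t = Fin.all? λ a → Fin.all? λ b → edge? s a b →-dec Fin.all? λ c →
    edge? t a c →-dec Fin.all? λ d → edge? t b d →-dec edge? t a b

  square? : Dec Square
  square? = Fin.all? λ a → Fin.all? λ b → edge? 0F a b →-dec Fin.all? λ c →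
    edge? 2F a c →-dec ¬? (edge? 1F a c) →-dec Fin.all? λ d →
    edge? 2F b d →-dec ¬? (edge? 1F b d) →-dec edge? 0F c d

shift : ℕ → Fin 3 → ℕ
shift i 0F = i
shift i 1F = suc i
shift i 2F = suc (suc i)

shift-inj : ∀ i {s t} → shift i s ≡ shift i t → s ≡ t
shift-inj i {0F} {0F} _  = refl
shift-inj i {0F} {1F} ()
shift-inj i {0F} {2F} ()
shift-inj i {1F} {0F} ()
shift-inj i {1F} {1F} _  = refl
shift-inj i {1F} {2F} ()
shift-inj i {2F} {0F} ()
shift-inj i {2F} {1F} ()
shift-inj i {2F} {2F} _  = refl

tagged-path₃ : List (Fin 3 × Fin 3 × Fin 3)
tagged-path₃ = (0F , 0F , 1F) ∷ (1F , 1F , 2F) ∷ []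

tagged-double : List (Fin 3 × Fin 2 × Fin 2)
tagged-double = (0F , 0F , 1F) ∷ (1F , 0F , 1F) ∷ []

tagged-path₄ : List (Fin 3 × Fin 4 × Fin 4)
tagged-path₄ = (0F , 0F , 1F) ∷ (1F , 1F , 2F) ∷ (2F , 2F , 3F) ∷ []

tagged-five : List (Fin 3 × Fin 5 × Fin 5)
tagged-five =
  (0F , 0F , 1F) ∷ (1F , 0F , 1F) ∷ (2F , 1F , 2F) ∷
  (0F , 2F , 3F) ∷ (1F , 3F , 4F) ∷ (2F , 3F , 4F) ∷ []

tagged-six : List (Fin 3 × Fin 6 × Fin 6)
tagged-six =
  (1F , 0F , 1F) ∷ (0F , 1F , 2F) ∷ (2F , 1F , 3F) ∷
  (2F , 2F , 4F) ∷ (0F , 3F , 4F) ∷ (1F , 4F , 5F) ∷ []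

-- The axioms in terms of `sgn`, and the two consequences of ax4

module DEG {n} (G : SignedColoredGraph n n) (deg : IsDualEquivalenceGraph G) where

  open IsDualEquivalenceGraph deg

  V : Set
  V = Vertex G

  exists-edge : ∀ {m} v → 2 + m < n → sgn G v (1 + m) ≢ sgn G v (2 + m) → ∃[ x ] E G (2 + m) v x
  exists-edge {m} v l ne with inside? {n} {m} (<⇒≤ l) | inside? {n} {suc m} l
  ... | g , eg | h , eh = Equivalence.to
    (ax1 (2 + m) (s≤s (s≤s z≤n)) l v g h (trans (+-comm _ 1) (cong suc eg)) eh)
    (trans (sym (sgn-σ G v g)) (trans (cong (sgn G v) eg)
      (trans (≢⇒opposite ne) (cong opposite (trans (cong (sgn G v) (sym eh)) (sgn-σ G v h))))))

  edge-≢ : ∀ {m v x} → E G (2 + m) v x → sgn G v (1 + m) ≢ sgn G v (2 + m)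
  edge-≢ {m} {v} e with inside? {n} {m} (<⇒≤ (proj₂ (E-colour G e))) | inside? {n} {suc m} (proj₂ (E-colour G e))
  ... | g , eg | h , eh = subst₂ (λ a b → sgn G v a ≢ sgn G v b) eg eh
    (subst₂ _≢_ (sym (sgn-σ G v g)) (sym (sgn-σ G v h)) (opposite⇒≢ (Equivalence.from
      (ax1 (2 + m) (s≤s (s≤s z≤n)) (proj₂ (E-colour G e)) v g h (trans (+-comm _ 1) (cong suc eg)) eh)
      (_ , e))))

  flips : ∀ {i v x j} → E G i v x → suc j ≡ i ⊎ j ≡ i → 1 ≤ j → j < n → sgn G v j ≢ sgn G x j
  flips {j = suc j} e c _ l with inside? {n} {j} l
  ... | h , refl = subst₂ _≢_ (sym (sgn-σ G _ h)) (sym (sgn-σ G _ h))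
    (opposite⇒≢ (ax2-flip _ e h (Sum.map₁ (trans (+-comm _ 1)) c)))

  flipsʳ : ∀ {m v x} → E G (2 + m) v x → sgn G v (2 + m) ≢ sgn G x (2 + m)
  flipsʳ e = flips e (inj₂ refl) (s≤s z≤n) (proj₂ (E-colour G e))

  fixes : ∀ {i v x j} → E G i v x → 2 + j < i ⊎ suc i < j → sgn G v j ≡ sgn G x j
  fixes {i} {j = j} e c with coordinate {n} j
  ... | outside out = trans (out G _) (sym (out G _))
  ... | inside h    = trans (sgn-σ G _ h) (trans (ax2-fix _ e h
          (Sum.map (≤-trans (s≤s (≤-reflexive (+-comm (pos h) 2)))) (≤-trans (s≤s (≤-reflexive (+-comm i 1)))) c)) (sym (sgn-σ G _ h)))

  -- A default sign cannot change, so a change of sign certifies an actual coordinate, to which ax3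
  -- applies.
  proper : ∀ {v x j} → sgn G v j ≢ sgn G x j → ∃[ h ] pos {n ∸ 1} h ≡ j
  proper {j = j} ne with coordinate {n} j
  ... | inside h    = h , refl
  ... | outside out = contradiction (trans (out G _) (sym (out G _))) ne

  three-right : ∀ {m v x} → E G (2 + m) v x → sgn G v (3 + m) ≢ sgn G x (3 + m) →
                sgn G v (3 + m) ≢ sgn G v (2 + m)
  three-right {m} {v} {x} e ne with proper ne | inside? {n} {suc m} (proj₂ (E-colour G e))
  ... | g , eg | h , eh = subst₂ (λ a b → sgn G v a ≢ sgn G v b) eg eh
    (subst₂ _≢_ (sym (sgn-σ G v g)) (sym (sgn-σ G v h)) (opposite⇒≢ (ax3-right _ e g h
      (trans eg (+-comm 1 _)) eh
      (trans (sym (sgn-σ G v g)) (trans (≢⇒opposite (subst (λ a → sgn G v a ≢ sgn G x a) (sym eg) ne))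
        (cong opposite (sgn-σ G x g)))))))

  three-left : ∀ {m v x} → E G (3 + m) v x → sgn G v (1 + m) ≢ sgn G x (1 + m) →
               sgn G v (1 + m) ≢ sgn G v (2 + m)
  three-left {m} {v} {x} e ne
    with inside? {n} {m} (<⇒≤ (<⇒≤ (proj₂ (E-colour G e)))) | inside? {n} {suc m} (<⇒≤ (proj₂ (E-colour G e)))
  ... | g , eg | h , eh = subst₂ (λ a b → sgn G v a ≢ sgn G v b) eg eh
    (subst₂ _≢_ (sym (sgn-σ G v g)) (sym (sgn-σ G v h)) (opposite⇒≢ (ax3-left _ e g h
      (trans (+-comm _ 2) (cong (2 +_) eg))  (trans (+-comm _ 1) (cong suc eh))
      (trans (sym (sgn-σ G v g)) (trans (≢⇒opposite (subst (λ a → sgn G v a ≢ sgn G x a) (sym eg) ne))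
        (cong opposite (sgn-σ G x g)))))))

  module _ {i : ℕ} {K : ℕ → Set} {m : ℕ} (P : List (Fin 3 × Fin m × Fin m))
           (v : V) (c : ComponentIs G K v (map (map₁ (shift i)) P)) where

    private
      module T = Tags P
      f = proj₁ c
      in-component = λ w → proj₁ (proj₂ (proj₂ c)) w
      edges = proj₂ (proj₂ (proj₂ c))

    preimage : ∀ {w} → Path G K v w → ∃[ a ] f a ≡ w
    preimage = Equivalence.to (in-component _)

    to-tags : ∀ {t a b} → K (shift i t) → E G (shift i t) (f a) (f b) → T.Edge t a b
    to-tags k e = T.from (shift i) (shift-inj i) (Equivalence.to (edges _ k _ _) e)

    from-tags : ∀ {t a b} → K (shift i t) → T.Edge t a b → E G (shift i t) (f a) (f b)
    from-tags k e = Equivalence.from (edges _ k _ _) (T.to (shift i) (shift-inj i) e)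

    two-in : ∀ s t → K (shift i s) → K (shift i t) → T.Two s t → ∀ {z z′ w w′} → Path G K v z →
             E G (shift i s) z z′ → E G (shift i t) z w → E G (shift i t) z′ w′ → E G (shift i t) z z′
    two-in s t ks kt two p e₁ e₂ e₃
      with preimage p | preimage (p ◅◅ (_ , ks , e₁) ◅ ε) | preimage (p ◅◅ (_ , kt , e₂) ◅ ε)
         | preimage (p ◅◅ (_ , ks , e₁) ◅ (_ , kt , e₃) ◅ ε)
    ... | a , refl | b , refl | c , refl | d , refl =
      from-tags kt (two a b (to-tags ks e₁) c (to-tags kt e₂) d (to-tags kt e₃))

    square-in : (∀ t → K (shift i t)) → T.Square → ∀ {z z′ w w′} → Path G K v z →
                E G i z z′ → E G (2 + i) z w → E G (2 + i) z′ w′ →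
                ¬ E G (1 + i) z w → ¬ E G (1 + i) z′ w′ → E G i w w′
    square-in k sq p e₁ e₂ e₃ n₂ n₃
      with preimage p | preimage (p ◅◅ (_ , k 0F , e₁) ◅ ε) | preimage (p ◅◅ (_ , k 2F , e₂) ◅ ε)
         | preimage (p ◅◅ (_ , k 0F , e₁) ◅ (_ , k 2F , e₃) ◅ ε)
    ... | a , refl | b , refl | c , refl | d , refl =
      from-tags (k 0F) (sq a b (to-tags (k 0F) e₁) c (to-tags (k 2F) e₂) (n₂ ∘ from-tags (k 1F))
                              d (to-tags (k 2F) e₃) (n₃ ∘ from-tags (k 1F)))

  double : ∀ {m} s t → shift (2 + m) s ∈ 2 + m ∷ 3 + m ∷ [] → shift (2 + m) t ∈ 2 + m ∷ 3 + m ∷ [] →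
           Tags.Two tagged-path₃ s t → Tags.Two tagged-double s t → ∀ {z z′ w w′} → 3 + m < n →
           E G (shift (2 + m) s) z z′ → E G (shift (2 + m) t) z w → E G (shift (2 + m) t) z′ w′ →
           E G (shift (2 + m) t) z z′
  double {m} s t ks kt two₁ two₂ {z} l e₁ e₂ e₃ with ax4-two (3 + m) (s≤s (s≤s (s≤s z≤n))) l z
  ... | inj₁ c        = two-in {2 + m} [] z c s t ks kt (λ { _ _ (inj₁ ()) ; _ _ (inj₂ ()) }) ε e₁ e₂ e₃
  ... | inj₂ (inj₁ c) = two-in {2 + m} tagged-path₃ z c s t ks kt two₁ ε e₁ e₂ e₃
  ... | inj₂ (inj₂ c) = two-in {2 + m} tagged-double z c s t ks kt two₂ ε e₁ e₂ e₃

  -- This is how an edge of the new colour is located: the smaller colour is known on labels, and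
  -- the existence of the other two edges follows from signs.
  double-up : ∀ {m z z′ w w′} → E G (2 + m) z z′ → E G (3 + m) z w → E G (3 + m) z′ w′ →
              E G (3 + m) z z′
  double-up e₁ e₂ e₃ = double 0F 1F (here refl) (there (here refl))
    (from-yes (Tags.two? tagged-path₃ 0F 1F)) (from-yes (Tags.two? tagged-double 0F 1F))
    (proj₂ (E-colour G e₂)) e₁ e₂ e₃

  double-down : ∀ {m z z′ w w′} → E G (3 + m) z z′ → E G (2 + m) z w → E G (2 + m) z′ w′ →
                E G (2 + m) z z′
  double-down e₁ e₂ e₃ = double 1F 0F (there (here refl)) (here refl)
    (from-yes (Tags.two? tagged-path₃ 1F 0F)) (from-yes (Tags.two? tagged-double 1F 0F))
    (proj₂ (E-colour G e₁)) e₁ e₂ e₃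

  shift∈ : ∀ m t → shift m t ∈ m ∷ suc m ∷ suc (suc m) ∷ []
  shift∈ m 0F = here refl
  shift∈ m 1F = there (here refl)
  shift∈ m 2F = there (there (here refl))

  square : ∀ {m z z′ w w′} → E G (2 + m) z z′ → E G (4 + m) z w → E G (4 + m) z′ w′ →
           ¬ E G (3 + m) z w → ¬ E G (3 + m) z′ w′ → E G (2 + m) w w′
  square {m} {z} e₁ e₂ e₃ n₂ n₃
    with ax4-three (4 + m) (s≤s (s≤s (s≤s (s≤s z≤n)))) (proj₂ (E-colour G e₂)) z
  ... | inj₁ c = square-in {2 + m} [] z c (shift∈ (2 + m)) (λ { _ _ (inj₁ ()) ; _ _ (inj₂ ()) }) ε e₁ e₂ e₃ n₂ n₃
  ... | inj₂ (inj₁ c) =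
    square-in {2 + m} tagged-path₄ z c (shift∈ (2 + m)) (from-yes (Tags.square? tagged-path₄)) ε e₁ e₂ e₃ n₂ n₃
  ... | inj₂ (inj₂ (inj₁ c)) =
    square-in {2 + m} tagged-five z c (shift∈ (2 + m)) (from-yes (Tags.square? tagged-five)) ε e₁ e₂ e₃ n₂ n₃
  ... | inj₂ (inj₂ (inj₂ c)) =
    square-in {2 + m} tagged-six z c (shift∈ (2 + m)) (from-yes (Tags.square? tagged-six)) ε e₁ e₂ e₃ n₂ n₃

-- Labels of the vertices

-- The row just below the larger of two distinct addable rows is removable, and seen from it the two
-- have different signs.
addable-unique : ∀ {a a′ u} → Addable a u → Addable a′ u →
                 (∀ {d} → Removable d u → sg a d ≡ sg a′ d) → a ≡ a′
addable-unique {a} {a′} p p′ eq with <-cmp a a′ | p | p′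
... | tri≈ _ a≡a′ _ | _ | _ = a≡a′
... | tri< (s≤s a≤d) _ _ | _ | suc {d} r = contradiction (trans (sym (sg-≤ a≤d)) (trans (eq r) (sg-> {suc d} {d} ≤-refl))) λ ()
... | tri> _ _ (s≤s a≤d) | suc {d} r | _ = contradiction (trans (sym (sg-≤ a≤d)) (trans (sym (eq r)) (sg-> {suc d} {d} ≤-refl))) λ ()

Yam-suffix : ∀ pre {u} → Yam (pre ++ u) → Yam u
Yam-suffix []        y       = y
Yam-suffix (_ ∷ pre) (_ ∷ y) = Yam-suffix pre y

letter-bound : ∀ {w} → Yam w → ∀ {j} → 0 < count j w → j < length w
letter-bound (_∷_ {r} {w} a y) {j} p with j ≟ r | a
... | no j≢r   | _                      = m<n⇒m<1+n (letter-bound y (subst (0 <_) (count-there w j≢r) p))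
... | yes refl | zero                   = s≤s z≤n
... | yes refl | (suc (removable q))    = s≤s (letter-bound y (≤-<-trans z≤n q))

head-bound : ∀ {d s} → Yam (d ∷ s) → d ≤ length s
head-bound (zero ∷ y)              = z≤n
head-bound (suc (removable q) ∷ y) = letter-bound y (≤-<-trans z≤n q)

∷-length⁻¹ : ∀ {m} (w : Word) → length w ≡ suc m → ∃[ c ] ∃[ s ] (w ≡ c ∷ s × length s ≡ m)
∷-length⁻¹ (c ∷ s) refl = c , s , refl , refl

module Paths {n N} (G : SignedColoredGraph n N) where

  weaken : ∀ {l m v w} → l ≤ m → Path G (_< l) v w → Path G (_< m) v w
  weaken l≤m = Star.map λ (i , p , e) → i , <-≤-trans p l≤m , e

  path-sym : ∀ {m v w} → Path G (_< m) v w → Path G (_< m) w v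
  path-sym = Star.reverse λ (i , p , e) → i , p , E-sym G e

module _ {n N} {G : SignedColoredGraph n N} {k e} (Λ : Labelling G k e) where

  open Labelling Λ

  -- Colours below `m` permute the letters up to `m` among their cells, so the larger letters keep
  -- their rows.
  path-word : ∀ pre {m v w u} → Path G (_< m) v w → L v ≡ pre ++ u → length u ≡ m → m ≤ e →
              ∃[ u′ ] (L w ≡ pre ++ u′ × u ∼ u′ × length u′ ≡ m)
  path-word pre ε eq l _ = _ , eq , ∼-refl , l
  path-word pre ((i , i<m , e) ◅ p) eq refl m≤e
    with ⟶-unskip pre (⟶-from eq (edge e (<-≤-trans i<m m≤e))) i<m
  ... | u₁ , eq₁ , st with path-word pre p eq₁ (sym (⟶-length st)) m≤e
  ... | u′ , eq′ , u₁∼u′ , l = u′ , eq′ , ∼-trans (⟶-∼ st) u₁∼u′ , l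

  sig′ : ∀ v pre {r q p s} → L v ≡ pre ++ r ∷ q ∷ p ∷ s → sgn G v (suc (length s)) ≡ sg q p
  sig′ v pre {r} eq = sig v (pre ++ r ∷ []) (trans eq (sym (++-assoc pre (r ∷ []) _)))

module Lifting {n} (G : SignedColoredGraph n n) (deg : IsDualEquivalenceGraph G)
               {k e} (Λ : Labelling G k e) (k≤n : k ≤ n) where

  open DEG G deg
  open Labelling Λ

  -- A possible move shows up as a change between two consecutive signs, hence as an edge by ax1;
  -- moves being deterministic, this edge ends at the expected label.
  lift : ∀ {i v u} → i < e → L v ⟶[ i ] u → ∃[ w ] (E G i v w × L w ≡ u)
  lift {v = v} i<e st with ⟶-letters st | ⟶-colour st
  ... | pre , r , q , p , s , eq , refl , ne | _ , l
    with exists-edge v (<-≤-trans (subst (_ <_) (len v) l) k≤n)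
           (subst₂ _≢_ (sym (sig′ Λ v pre eq)) (sym (sig v pre eq)) ne)
  ... | x , ex = x , ex , ⟶-det (edge ex i<e) st

  lift⋆ : ∀ pre {u u′ v} → Star _⟶_ u u′ → L v ≡ pre ++ u → length u ≤ e →
          ∃[ w ] (Path G (_< length u) v w × L w ≡ pre ++ u′)
  lift⋆ pre ε eq l = _ , ε , eq
  lift⋆ pre {u} ((i , st) ◅ p) eq l
    with lift (<-≤-trans (proj₂ (⟶-colour st)) l) (⟶-from (sym eq) (⟶-skip pre st))
  ... | x , ex , eq₁ with lift⋆ pre p eq₁ (subst (_≤ e) (⟶-length st) l)
  ... | w , q , eq₂ =
    w , (i , proj₂ (⟶-colour st) , ex) ◅ subst (λ m → Path G (_< m) x w) (sym (⟶-length st)) q , eq₂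

  -- The smaller letters can be rearranged at will inside their shape by small colours only, which
  -- leave later signs alone.
  reach : ∀ pre {u u′ v} → L v ≡ pre ++ u → Yam u′ → u′ ∼ u → length u′ ≡ length u → length u ≤ e →
          ∃[ w ] (Path G (_< length u) v w × L w ≡ pre ++ u′)
  reach pre {u} {v = v} eq y′ u′∼u l l≤e =
    lift⋆ pre (connect (length u) refl l (Yam-suffix pre (subst Yam eq (yam v))) y′ (∼-sym u′∼u)) eq l≤e

  sgn-path : ∀ {m j v w} → Path G (_< m) v w → m < j → sgn G v j ≡ sgn G w j
  sgn-path ε _ = refl
  sgn-path ((i , i<m , e) ◅ p) m<j = trans (fixes e (inj₂ (≤-<-trans i<m m<j))) (sgn-path p m<j)

-- A simulation preserving signs preserves labels: between two distinct rows
-- for the next letter there is a removable row, which can be made the row of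
-- the current last letter, and then the two signs differ.
module Simulation {n} (G : SignedColoredGraph n n) (deg : IsDualEquivalenceGraph G)
                  {k e} (Λ : Labelling G k e) (k≤n : k ≤ n)
                  {n′ N′ k′ e′} {G′ : SignedColoredGraph n′ N′} (Λ′ : Labelling G′ k′ e′)
                  (R : Vertex G → Vertex G′ → Set) (M : ℕ) (M≤e : M ≤ suc e) (M≤e′ : M ≤ suc e′)
                  (closed : ∀ {i v v′ w} → R v v′ → suc i < M → E G i v w →
                            ∃[ w′ ] (E G′ i v′ w′ × R w w′))
                  (signs : ∀ {j v v′} → R v v′ → j < M → sgn G v j ≡ sgn G′ v′ j) where

  open Lifting G deg Λ k≤n
  open Labelling Λ
  open Labelling Λ′ using () renaming (L to L′; yam to yam′; sig to sig″)

  -- Moves become edges of `G` by ax1 and are then copied to `G′` by `closed`; no knowledge of how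
  -- `G′` realises moves enters.
  follow : ∀ pre {u u⋆ v v′} → Star _⟶_ u u⋆ → R v v′ → L v ≡ pre ++ u → length u < M →
           ∃[ w ] ∃[ w′ ] (R w w′ × L w ≡ pre ++ u⋆ × Path G′ (_< length u) v′ w′)
  follow pre ε r eq l = _ , _ , r , eq , ε
  follow pre {u} ((i , st) ◅ p) r eq l
    with lift (s≤s⁻¹ (≤-trans (s≤s (proj₂ (⟶-colour st))) (≤-trans l M≤e))) (⟶-from (sym eq) (⟶-skip pre st))
  ... | x , ex , eq₁ with closed r (<-≤-trans (s≤s (proj₂ (⟶-colour st))) l) ex
  ... | x′ , ex′ , r₁ with follow pre p r₁ eq₁ (subst (_< M) (⟶-length st) l)
  ... | w , w′ , r₂ , eq₂ , q =
    w , w′ , r₂ , eq₂ ,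
    (i , proj₂ (⟶-colour st) , ex′) ◅ subst (λ m → Path G′ (_< m) x′ w′) (sym (⟶-length st)) q

  same-label : ∀ m → m ≤ M → ∀ pre pre′ {u u′ v v′} → R v v′ → L v ≡ pre ++ u → L′ v′ ≡ pre′ ++ u′ →
               length u ≡ m → length u′ ≡ m → u ≡ u′
  same-label zero _ _ _ {[]} {[]} _ _ _ _ _ = refl
  same-label (suc m) m<M pre pre′ {c ∷ u} {c′ ∷ u′} {v} {v′} r eq eq′ l l′
    with Yam-suffix pre (subst Yam eq (yam v)) | Yam-suffix pre′ (subst Yam eq′ (yam′ v′))
       | same-label m (<⇒≤ m<M) (pre ++ c ∷ []) (pre′ ++ c′ ∷ []) r
           (trans eq (sym (++-assoc pre _ _))) (trans eq′ (sym (++-assoc pre′ _ _)))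
           (suc-injective l) (suc-injective l′)
  ... | a ∷ y | a′ ∷ _ | refl = cong (_∷ u) (addable-unique a a′ agree)
    where
    agree : ∀ {d} → Removable d u → sg c d ≡ sg c′ d
    -- Once the preceding letter is in row `d` at the first vertex, the induction hypothesis puts it
    -- in row `d` at the second one too; the common sign then compares `c` and `c′` with the same
    -- row.
    agree {d} rem with front y rem
    ... | t , yt , dt∼u , lt
      with follow (pre ++ c ∷ []) (connect (length u) refl lt y yt (∼-sym dt∼u)) r
             (trans eq (sym (++-assoc pre _ _))) (subst (_< M) (sym (suc-injective l)) m<M)
    ... | w , w′ , rw , eqw , p
      with path-word Λ′ (pre′ ++ c′ ∷ []) p (trans eq′ (sym (++-assoc pre′ _ _))) refl
             (s≤s⁻¹ (≤-trans (subst (_≤ M) (sym l) m<M) M≤e′))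
    ... | t′ , eqw′ , _ , lt′
      with same-label m (<⇒≤ m<M) (pre ++ c ∷ []) (pre′ ++ c′ ∷ []) rw eqw eqw′
             (trans lt (suc-injective l)) (trans lt′ (suc-injective l))
    ... | refl = trans (sym (sig w pre (trans eqw (++-assoc pre _ _))))
                   (trans (signs rw (subst (_< M) (sym (trans lt (suc-injective l))) m<M))
                          (sig″ w′ pre′ (trans eqw′ (++-assoc pre′ _ _))))

module Threshold {n} (G : SignedColoredGraph n n) (deg : IsDualEquivalenceGraph G)
                 {k} (Λ : Labelling G k k) (k<n : k < n)
                 (inj : ∀ {v w} → Path G (_< k) v w → Labelling.L Λ v ≡ Labelling.L Λ w → v ≡ w) where

  open DEG G deg
  open Paths G
  open Lifting G deg Λ (<⇒≤ k<n)
  open Labelling Λ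

  path-∼ : ∀ {v w} → Path G (_< k) v w → L v ∼ L w
  path-∼ {v} p with path-word Λ [] p refl (len v) ≤-refl
  ... | _ , refl , eq , _ = eq

  length-tail : ∀ {v d s} → L v ≡ d ∷ s → suc (length s) ≡ k
  length-tail {v} eq = trans (cong length (sym eq)) (len v)

  -- The tail can be rearranged by colours below `k - 1`, which do not affect σ_k by ax2. The vertex
  -- reached has the label of `w′` and equals it by injectivity.
  sgn-head : ∀ {w w′ d s s′} → Path G (_< k) w w′ → L w ≡ d ∷ s → L w′ ≡ d ∷ s′ →
             sgn G w k ≡ sgn G w′ k
  sgn-head {w} {w′} {d} {s} {s′} p eq eq′
    with Yam-suffix (d ∷ []) (subst Yam eq′ (yam w′))
  ... | y with reach (d ∷ []) eq y (∷-∼⁻ d (subst₂ _∼_ eq′ eq (∼-sym (path-∼ p))))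
             (suc-injective (trans (length-tail eq′) (sym (length-tail eq))))
             (<⇒≤ (≤-reflexive (length-tail eq)))
  ... | w″ , q , eq″ = trans (sgn-path q (≤-reflexive (length-tail eq))) (cong (λ x → sgn G x k)
          (inj (path-sym (weaken (<⇒≤ (≤-reflexive (length-tail eq))) q) ◅◅ p) (trans eq″ (sym eq′))))

  -- By `exchange` the two rows may be taken at the ends of an edge of colour `k - 1`. At the end
  -- with `b` on top σ_{k-1} is - because `d < b`; if σ_k changed along the edge, ax3 would make
  -- these two signs different, but σ_k is - as well.
  sgn-mono : ∀ {w w′ b d s s′} → Path G (_< k) w w′ → L w ≡ b ∷ s → L w′ ≡ d ∷ s′ → d < b →
             sgn G w k ≡ Sign.- → sgn G w′ k ≡ Sign.-
  sgn-mono {w} {w′} {b} {d} {s} p eq eq′ d<b neg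
    with subst Yam eq (yam w)
  ... | yb@(ab ∷ _)
    with exchange yb d<b (Removable-resp (subst₂ _∼_ eq′ eq (∼-sym (path-∼ p)))
           (head-removable (subst Yam eq′ (yam w′))))
  ... | e , t , d≤e , e<b , yde , ybe , det∼s , l
    with reach [] eq (Addable-resp (∼-sym det∼s) ab ∷ yde) (∷-∼ b det∼s) (cong suc l) (≤-reflexive (length-tail eq))
  ... | w₁ , p₁ , eq₁ with lift {v = w₁} {u = d ∷ b ∷ e ∷ t} (≤-reflexive (length-tail eq₁))
                             (⟶-from (sym eq₁) (swap-tops d≤e e<b))
  ... | w₂ , e₁₂ , eq₂ = trans (sym (sgn-head (path-sym p₁₂ ◅◅ path-sym p₁′ ◅◅ p) eq₂ eq′)) neg₂
    where
    k≡ : 3 + length t ≡ k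
    k≡ = length-tail eq₁
    p₁′ = subst (λ m → Path G (_< m) w w₁) (length-tail eq) p₁
    p₁₂ : Path G (_< k) w₁ w₂
    p₁₂ = (_ , ≤-reflexive k≡ , e₁₂) ◅ ε
    neg₁ : sgn G w₁ k ≡ Sign.-
    neg₁ = trans (sgn-head (path-sym p₁′) eq₁ eq) neg
    neg₂ : sgn G w₂ k ≡ Sign.-
    neg₂ with sgn G w₁ k Sign.≟ sgn G w₂ k
    ... | yes s≡s = trans (sym s≡s) neg₁
    ... | no ne = contradiction
      (trans (trans (cong (sgn G w₁) k≡) neg₁) (sym (trans (sig w₁ [] eq₁) (sg-> d<b))))
      (three-right e₁₂ (subst (λ j → sgn G w₁ j ≢ sgn G w₂ j) (sym k≡) ne))

  -- Induction on the rows allowed for the letter `k`. A row that is not a corner imposes nothing; a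
  -- corner with sign + keeps the threshold; a corner with sign - moves the threshold just above
  -- itself, which suits the lower rows by `sgn-mono`.
  threshold-below : ∀ v b → ∃[ a ] (a ≤ b × Addable a (L v) ×
    (∀ {w d s} → Path G (_< k) v w → L w ≡ d ∷ s → d < b → sgn G w k ≡ sg a d))
  threshold-below v zero    = 0 , z≤n , zero , λ _ _ ()
  threshold-below v (suc b) with threshold-below v b | count (suc b) (L v) <? count b (L v)
  ... | a , a≤b , add , sign | no b-fixed = a , m≤n⇒m≤1+n a≤b , add , sign′
    where
    sign′ : ∀ {w d s} → Path G (_< k) v w → L w ≡ d ∷ s → d < suc b → sgn G w k ≡ sg a d
    sign′ {w} p eq (s≤s d≤b) with m≤n⇒m<n∨m≡n d≤b
    ... | inj₁ d<b  = sign p eq d<b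
    ... | inj₂ refl = contradiction (drop (Removable-resp (subst (_∼ L v) eq (∼-sym (path-∼ p)))
                        (head-removable (subst Yam eq (yam w))))) b-fixed
  ... | a , a≤b , add , sign | yes b-rem with front (yam v) (removable b-rem)
  ... | t , yt , bt∼ , lt with reach [] refl yt bt∼ lt (≤-reflexive (len v))
  ... | w₀ , p₀ , eq₀ with sgn G w₀ k in s₀
  ... | Sign.+ = a , m≤n⇒m≤1+n a≤b , add , sign′
    where
    sign′ : ∀ {w d s} → Path G (_< k) v w → L w ≡ d ∷ s → d < suc b → sgn G w k ≡ sg a d
    sign′ {w} p eq (s≤s d≤b) with m≤n⇒m<n∨m≡n d≤b
    ... | inj₁ d<b  = sign p eq d<b
    ... | inj₂ refl = trans (sgn-head (path-sym p ◅◅ subst (λ m → Path G (_< m) v w₀) (len v) p₀) eq eq₀)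
                        (trans s₀ (sym (sg-≤ a≤b)))
  ... | Sign.- = suc b , ≤-refl , suc (removable b-rem) , sign′
    where
    sign′ : ∀ {w d s} → Path G (_< k) v w → L w ≡ d ∷ s → d < suc b → sgn G w k ≡ sg (suc b) d
    sign′ {w} p eq d≤b@(s≤s d≤b′) with m≤n⇒m<n∨m≡n d≤b′
    ... | inj₁ d<b  = trans (sgn-mono (path-sym (subst (λ m → Path G (_< m) v w₀) (len v) p₀) ◅◅ p)
                        eq₀ eq d<b s₀) (sym (sg-> d≤b))
    ... | inj₂ refl = trans (sgn-head (path-sym p ◅◅ subst (λ m → Path G (_< m) v w₀) (len v) p₀) eq eq₀)
                        (trans s₀ (sym (sg-> d≤b)))

  -- A tableau with `k` letters has no row beyond `k`, so the bound `suc k` covers all rows.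
  new-row : V → ℕ
  new-row v = proj₁ (threshold-below v (suc k))

  new-row-addable : ∀ v → Addable (new-row v) (L v)
  new-row-addable v = proj₁ (proj₂ (proj₂ (threshold-below v (suc k))))

  new-row-sign : ∀ {v w d s} → Path G (_< k) v w → L w ≡ d ∷ s → sgn G w k ≡ sg (new-row v) d
  new-row-sign {v} {w} p eq = proj₂ (proj₂ (proj₂ (threshold-below v (suc k)))) p eq
    (s≤s (≤-trans (head-bound (subst Yam eq (yam w))) (<⇒≤ (≤-reflexive (length-tail eq)))))

  new-row-path : ∀ {v w} → Path G (_< k) v w → new-row v ≡ new-row w
  new-row-path {v} {w} p =
    addable-unique (new-row-addable v) (Addable-resp (∼-sym (path-∼ p)) (new-row-addable w)) agree
    where
    agree : ∀ {d} → Removable d (L v) → sg (new-row v) d ≡ sg (new-row w) d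
    agree rem with front (yam v) rem
    ... | t , yt , dt∼ , lt with reach [] refl yt dt∼ lt (≤-reflexive (len v))
    ... | x , q , eq with subst (λ m → Path G (_< m) v x) (len v) q
    ... | q′ = trans (sym (new-row-sign q′ eq)) (new-row-sign (path-sym p ◅◅ q′) eq)

  -- One more letter, but no further colour yet: along edges of colour below `k` the new letter
  -- stays in its row. The colour `k` is added by `completed`.
  extended : Labelling G (suc k) k
  extended = record
    { L    = λ v → new-row v ∷ L v
    ; len  = λ v → cong suc (len v)
    ; yam  = λ v → new-row-addable v ∷ yam v
    ; sig  = sig⁺
    ; edge = λ {i} {v} {w} e i<k → subst (λ c → new-row v ∷ L v ⟶[ i ] c ∷ L w)
               (new-row-path ((i , i<k , e) ◅ ε)) (there (edge e i<k))
    }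
    where
    sig⁺ : ∀ v pre {r q s} → new-row v ∷ L v ≡ pre ++ r ∷ q ∷ s → sgn G v (suc (length s)) ≡ sg r q
    sig⁺ v []        eq = trans (cong (sgn G v) (length-tail (∷-injectiveʳ eq)))
      (trans (new-row-sign ε (∷-injectiveʳ eq)) (cong (λ c → sg c _) (∷-injectiveˡ eq)))
    sig⁺ v (_ ∷ pre) eq = sig v pre (∷-injectiveʳ eq)

-- Serves to place the preceding letter so that the rows `a` and `b` are also switched by the next
-- smaller colour. The row `e` is just below the higher of `a` and `b`; it is a corner of `s`
-- because the higher row was extended, the case `b = e` using that `c` fits on top of both.
top-removable : ∀ {c a b s} → Yam (c ∷ a ∷ b ∷ s) → Left b a c →
                ∃[ e ] (Removable e s × Right e b a × suc e ≡ a ⊔ b)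
top-removable (_ ∷ zero ∷ _) (up b<c c≤a) = contradiction (<-≤-trans b<c c≤a) λ ()
top-removable {b = b} {s} (cc ∷ suc {e} rem ∷ _) (up b<c c≤a) with b ≟ e
... | no b≢e = e , removable-tail b≢e rem , up (s≤s⁻¹ (<-≤-trans b<c c≤a)) ≤-refl ,
               sym (m≥n⇒m⊔n≡m (<⇒≤ (<-≤-trans b<c c≤a)))
... | yes refl with ≤-antisym c≤a b<c | cc
... | refl | suc rem′ = b , removable (s≤s⁻¹ (subst₂ _<_
        (trans (count-here (suc b) (b ∷ s)) (cong suc (count-there s 1+n≢n)))
        (trans (count-there (b ∷ s) (1+n≢n ∘ sym)) (count-here b s)) (Removable.drop rem′))) , up ≤-refl ≤-refl ,
        sym (m≥n⇒m⊔n≡m (n≤1+n b))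
top-removable (_ ∷ _ ∷ zero ∷ _)    (down a<c c≤b) = contradiction (<-≤-trans a<c c≤b) λ ()
top-removable (_ ∷ _ ∷ suc {e} rem ∷ _) (down a<c c≤b) = e , rem , down (s≤s⁻¹ (<-≤-trans a<c c≤b)) ≤-refl ,
  sym (m≤n⇒m⊔n≡n (<⇒≤ (<-≤-trans a<c c≤b)))

-- The version of `exchange` for either order of `d` and `b`. If `b < d`, the corner `d` is first
-- brought to the front and the roles are interchanged.
exchange′ : ∀ {b s d} → Yam (b ∷ s) → d ≢ b → Removable d (b ∷ s) →
            ∃[ e ] ∃[ t ] (Yam (d ∷ e ∷ t) × d ∷ e ∷ t ∼ s × length (d ∷ e ∷ t) ≡ length s × Right e d b)
exchange′ {b} {s} {d} y d≢b rem with <-cmp d b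
... | tri≈ _ d≡b _ = contradiction d≡b d≢b
... | tri< d<b _ _ with exchange y d<b rem
... | e , t , d≤e , e<b , yd , yb , eq , l = e , t , yd , eq , l , up d≤e e<b
exchange′ {b} {s} {d} y d≢b rem | tri> _ _ b<d with front y rem
... | s₁ , y₁ , ds₁∼bs , l₁ with exchange y₁ b<d (Removable-resp (∼-sym ds₁∼bs) (head-removable y))
... | e , t , b≤e , e<d , yb , yd , eq , l =
  e , t , yd ,
  ∷-∼⁻ b (∼-trans (∷∷-∼ b d) (∼-trans (∷-∼ d eq) ds₁∼bs)) ,
  trans l (suc-injective l₁) , down b≤e e<d

record Between (lo hi d : ℕ) : Set where
  constructor between
  field
    lower : lo ≤ d
    upper : d < hi

-- Addable rows sit just above removable ones. The row below `lo′` would violate the inclusion of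
-- corners if `lo` were smaller than `lo′`, and the row below `hi` is a corner of the first
-- interval, hence lies below `hi′`.
between-⊆ : ∀ {lo hi lo′ hi′ b u} → Addable lo′ u → Addable hi u →
            Between lo hi b → Between lo′ hi′ b →
            (∀ {d} → Removable d u → Between lo hi d → Between lo′ hi′ d) → lo′ ≤ lo × hi ≤ hi′
between-⊆ {lo} {hi} {lo′} {hi′} {b} {u} a h (between x y) (between x′ y′) f = lower a x′ (λ rem bt → Between.lower (f rem bt)) ,
  upper h y (λ rem bt → Between.upper (f rem bt))
  where
  lower : ∀ {l} → Addable l u → l ≤ b → (∀ {d} → Removable d u → Between lo hi d → l ≤ d) → l ≤ lo
  lower zero          _   _ = z≤n
  lower (suc {d} rem) d<b g with ≤-<-connex lo d
  ... | inj₁ lo≤d = contradiction (g rem (between lo≤d (<-trans d<b y))) (<-irrefl refl)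
  ... | inj₂ d<lo = d<lo
  upper : ∀ {h} → Addable h u → b < h → (∀ {d} → Removable d u → Between lo h d → d < hi′) → h ≤ hi′
  upper (suc {d} rem) (s≤s b≤d) g = g rem (between (≤-trans x b≤d) ≤-refl)

-- The row `b` separates `a` from `c`, so the two upper letters are placed independently of each
-- other.
Right-addable : ∀ {c a b s} → Yam (c ∷ a ∷ b ∷ s) → Right b a c →
                Addable a (b ∷ s) × Addable c (b ∷ s)
Right-addable {c} {a} {b} (cc ∷ ca ∷ y) (down c≤b b<a) =
  ca , addable-uncons {c} {a} (λ { refl → <⇒≱ b<a (≤-trans (n≤1+n _) c≤b) }) (λ { refl → <⇒≱ b<a c≤b }) cc
Right-addable {c} {a} {b} (cc ∷ ca ∷ y) (up a≤b b<c) with c ≟ suc b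
... | yes refl = ca , suc (head-removable y)
... | no c≢1+b = ca , addable-uncons {c} {a}
  (λ { refl → c≢1+b (cong suc (≤-antisym a≤b (s≤s⁻¹ b<c))) }) (λ { refl → <⇒≱ b<c a≤b }) cc

⟶-Yam : ∀ {i u v} → Yam u → u ⟶[ i ] v → Yam v
⟶-Yam (c ∷ y) (there st) = Addable-resp (⟶-∼ st) c ∷ ⟶-Yam y st
⟶-Yam y@(_ ∷ _ ∷ p ∷ ys) (here _ (right x)) with Right-addable y x
... | aq , ar = addable-cons (Right-≢ x ∘ sym) aq ∷ ar ∷ p ∷ ys
⟶-Yam y@(r ∷ q ∷ p ∷ ys) (here _ (left l@(down a b))) =
  Addable-resp (∷∷-∼ _ _) r ∷ addable-cons (<⇒≢ (<-≤-trans a b)) p ∷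
  addable-uncons (<⇒≢ (m<n⇒m<1+n (<-≤-trans a b))) (<⇒≢ (<-≤-trans a b)) q ∷ ys
-- Here `q` is the higher row, so `q = e + 1` for the corner `e` of `s` found by `top-removable`,
-- and `q` may be added before `p`.
⟶-Yam y@(r ∷ q ∷ p ∷ ys) (here _ (left l@(up a b))) with top-removable y l
... | e , rem , _ , eq =
  Addable-resp (∷∷-∼ _ _) r ∷ addable-cons (<⇒≢ (<-≤-trans a b) ∘ sym) p ∷
  subst (λ x → Addable x _) (trans eq (m≥n⇒m⊔n≡m (<⇒≤ (<-≤-trans a b)))) (suc rem) ∷ ys

letters₃ : ∀ {m} (w : Word) → length w ≡ 3 + m → ∃[ c ] ∃[ a ] ∃[ b ] ∃[ s ] (w ≡ c ∷ a ∷ b ∷ s)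
letters₃ (c ∷ a ∷ b ∷ s) _ = c , a , b , s , refl

⟶-between : ∀ {i u u′ v v′} → u ≡ u′ → v ≡ v′ → u ⟶[ i ] v → u′ ⟶[ i ] v′
⟶-between refl refl st = st

-- Edges of the new colour

module TopEdge {n} (G : SignedColoredGraph n n) (deg : IsDualEquivalenceGraph G)
               {k} (Λ : Labelling G (suc k) k) (k<n : k < n) where

  open IsDualEquivalenceGraph deg using (ax1-unique; ax5; ax6)
  open DEG G deg
  open Paths G
  open Lifting G deg Λ k<n
  open Labelling Λ

  length₃ : ∀ {v c a b s} → L v ≡ c ∷ a ∷ b ∷ s → 2 + length s ≡ k
  length₃ {v} eq = suc-injective (trans (cong length (sym eq)) (len v))

  top-edge : ∀ {v c a b s} → L v ≡ c ∷ a ∷ b ∷ s → sg a b ≢ sg c a → ∃[ x ] E G (2 + length s) v x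
  top-edge {v} eq ne = exists-edge v (subst (_< n) (sym (length₃ eq)) k<n)
    (subst₂ _≢_ (sym (sig′ Λ v [] eq)) (sym (sig v [] eq)) ne)

  switch-sg : ∀ {v w c a b s} → L v ≡ c ∷ a ∷ b ∷ s → E G (2 + length s) v w → sg a b ≢ sg c a
  switch-sg {v} eq e = subst₂ _≢_ (sig′ Λ v [] eq) (sig v [] eq) (edge-≢ e)

  distance : ∀ {i m} → i < m → 3 ≤ ∣ i - (2 + m) ∣
  distance {zero}  {suc m} _         = s≤s (s≤s (s≤s z≤n))
  distance {suc i} {suc m} (s≤s i<m) = distance i<m

  -- The colours `i < m` and `2 + m` differ by at least 3, so ax5 completes the two edges to a
  -- parallelogram.
  parallel : ∀ {m i v v₁ w} → i < m → E G i v v₁ → E G (2 + m) v w →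
             ∃[ w₁ ] (E G (2 + m) v₁ w₁ × E G i w w₁)
  parallel i<m e f with ax5 _ _ (E-sym G e) f (distance i<m)
  ... | w₁ , f₁ , e₁ = w₁ , f₁ , E-sym G e₁

  parallel⋆ : ∀ {m v v₁ w} → Path G (_< m) v v₁ → E G (2 + m) v w →
              ∃[ w₁ ] (E G (2 + m) v₁ w₁ × Path G (_< m) w w₁)
  parallel⋆ ε f = _ , f , ε
  parallel⋆ ((i , i<m , e) ◅ p) f with parallel i<m e f
  ... | w₁ , f₁ , e₁ with parallel⋆ p f₁
  ... | w₂ , f₂ , q = w₂ , f₂ , (i , i<m , e₁) ◅ q

  -- Along the path both ends of the edge undergo the same moves of the smaller letters, so the
  -- labels continue to differ by the switch; `ax1-unique` identifies the last parallel edge with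
  -- the given one.
  transport : ∀ {m v w z z′ c a b s t} → length t ≡ m → Path G (_< m) z v → L z ≡ c ∷ a ∷ b ∷ t →
              L z′ ≡ c ∷ b ∷ a ∷ t → E G (2 + m) z z′ → L v ≡ c ∷ a ∷ b ∷ s → E G (2 + m) v w →
              L w ≡ c ∷ b ∷ a ∷ s × Path G (_< m) z′ w
  transport {z = z} _ ε eqz eqz′ f eq g with ax1-unique _ z f g | trans (sym eqz) eq
  ... | refl | refl = eqz′ , ε
  transport {c = c} {a} {b} lt ((i , i<m , e) ◅ p) eqz eqz′ f eq g
    with parallel i<m e f | <-≤-trans (subst (i <_) (sym lt) i<m) (≤-trans (m≤n+m _ 2) (≤-reflexive (length₃ eqz)))
  ... | z₁′ , f₁ , e′ | i<k
    with ⟶-unskip (c ∷ a ∷ b ∷ []) (⟶-from eqz (edge e i<k)) (subst (i <_) (sym lt) i<m)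
  ... | t₁ , eqz₁ , st
    with transport (trans (sym (⟶-length st)) lt) p eqz₁
           (⟶-det (⟶-from eqz′ (edge e′ i<k)) (⟶-skip (c ∷ b ∷ a ∷ []) st)) f₁ eq g
  ... | eqw , q = eqw , (i , i<m , e′) ◅ q

  -- By ax5, moving the letters before the last three does not affect how the
  -- latter are switched, so it suffices to consider one arrangement of the
  -- former, chosen so that the edge is a double edge.
  left-edge : ∀ {v w c a b s} → L v ≡ c ∷ a ∷ b ∷ s → E G (2 + length s) v w → Left b a c →
              L w ≡ c ∷ b ∷ a ∷ s × Path G (_< k) v w
  left-edge {v} {w} {c} {a} {b} {s} eq f l
    with subst Yam eq (yam v)
  ... | y@(_ ∷ _ ∷ _ ∷ ys) with top-removable y l
  ... | e , rem , r , _ with front ys rem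
  ... | t , yt , et∼s , lt
    with reach (c ∷ a ∷ b ∷ []) eq yt et∼s lt (≤-trans (m≤n+m _ 2) (≤-reflexive (length₃ eq)))
  ... | z , p , eqz
    -- The letter in row `e` makes colour `k - 1` switch `a` and `b`. At both ends `c` is still in
    -- the middle, so both have an edge of colour `k`, and `double-up` applies.
    with lift {v = z} {u = c ∷ b ∷ a ∷ e ∷ t} (≤-reflexive (length₃ eqz)) (⟶-from (sym eqz)
           (there {c = c} (here refl (right r))))
  ... | z′ , ezz′ , eqz′
    with top-edge eqz (Left-sg l) | top-edge eqz′ (Left-sg (Left-sym l))
  ... | x , ezx | x′ , ezx′ with double-up ezz′ ezx ezx′
  ... | fzz′ with transport refl (path-sym (subst (λ m → Path G (_< m) v z) (sym lt) p)) eqz eqz′ fzz′ eq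
                            (subst (λ m → E G (2 + m) v w) (sym lt) f)
  ... | eqw , q = eqw , weaken l≤k p ◅◅ (_ , ≤-reflexive (length₃ eqz) , ezz′) ◅
                  weaken (≤-trans (m≤n+m _ 2) (≤-reflexive (length₃ eqz))) q
    where
    l≤k : length s ≤ k
    l≤k = ≤-trans (m≤n+m _ 2) (≤-reflexive (length₃ eq))

  -- An edge of colour `k` flips σ_k. One of colour `k - 1` keeps `c` in place and puts either `a`
  -- or `b` before it, and both compare with `c` in the same way, so σ_k would not change.
  right-not-double : ∀ {v w c a b s} → L v ≡ c ∷ a ∷ b ∷ s → Right b a c →
                     E G (2 + length s) v w → ¬ E G (1 + length s) v w
  right-not-double {s = []} eq r f g = contradiction (proj₁ (E-colour G g)) λ { (s≤s ()) }
  right-not-double {v} {w} {c} {a} {b} {h ∷ s} eq r f g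
    with ⟶-unskip (c ∷ []) (⟶-from eq (edge g (≤-reflexive (length₃ eq)))) ≤-refl
  ... | _ , eqw , there st = contradiction (proj₂ (⟶-colour st)) (<-irrefl refl)
  ... | _ , eqw , here _ (left _)  = flipsʳ f (trans (sig v [] eq) (sym (sig w [] eqw)))
  ... | _ , eqw , here _ (right _) = flipsʳ f (trans (sig v [] eq) (trans (unchanged r) (sym (sig w [] eqw))))
    where
    unchanged : Right b a c → sg c a ≡ sg c b
    unchanged (up a≤b b<c)   = trans (sg-> (≤-<-trans a≤b b<c)) (sym (sg-> b<c))
    unchanged (down c≤b b<a) = trans (sg-≤ (≤-trans c≤b (<⇒≤ b<a))) (sym (sg-≤ c≤b))

  -- The relation for `Simulation`: the two ends of an edge of colour `k = m + 2` at both of which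
  -- `k - 1` is the middle letter. It survives moves of the smaller letters by ax5.
  record RightPair (m : ℕ) (v w : V) : Set where
    constructor right-pair
    field
      {c a b c′ a′ b′} : ℕ
      {s s′}           : Word
      top    : E G (2 + m) v w
      eqᵥ    : L v ≡ c ∷ a ∷ b ∷ s
      eqₘ    : L w ≡ c′ ∷ a′ ∷ b′ ∷ s′
      rightᵥ : Right b a c
      rightₘ : Right b′ a′ c′
      lenᵥ   : length s ≡ m
      lenₘ   : length s′ ≡ m

  right-pair-closed : ∀ {m i v v′ w} → RightPair m v v′ → i < m → E G i v w →
                      ∃[ w′ ] (E G i v′ w′ × RightPair m w w′)
  right-pair-closed {m} {i} (right-pair {c} {a} {b} {c′} {a′} {b′} f eq eq′ r r′ refl l′) i<m e
    with parallel i<m e f | <-≤-trans i<m (≤-trans (m≤n+m _ 2) (≤-reflexive (length₃ eq)))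
  ... | w′ , f₁ , e′ | i<k
    with ⟶-unskip (c ∷ a ∷ b ∷ []) (⟶-from eq (edge e i<k)) i<m
       | ⟶-unskip (c′ ∷ a′ ∷ b′ ∷ []) (⟶-from eq′ (edge e′ i<k)) (subst (i <_) (sym l′) i<m)
  ... | _ , eq₁ , st | _ , eq₁′ , st′ = w′ , e′ ,
    right-pair f₁ eq₁ eq₁′ r r′ (sym (⟶-length st)) (trans (sym (⟶-length st′)) l′)

  -- By ax2 only σ_{k-2} needs an argument. If it changed, ax3 and ax1 would provide edges of colour
  -- `k - 1` at both ends, and `double-down` would turn the edge into a double one, against
  -- `right-not-double`.
  right-pair-signs : ∀ {m j v w} → RightPair m v w → j < suc m → sgn G v j ≡ sgn G w j
  right-pair-signs {m} {j} {v} {w} (right-pair f eq eq′ r r′ l l′) (s≤s j≤m) with m≤n⇒m<n∨m≡n j≤m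
  ... | inj₁ j<m = fixes f (inj₁ (s≤s (s≤s j<m)))
  right-pair-signs {zero} _ _ | inj₂ refl = refl
  right-pair-signs {suc m} {_} {v} {w} (right-pair f eq eq′ r r′ l l′) _ | inj₂ refl
    with sgn G v (suc m) Sign.≟ sgn G w (suc m)
  ... | yes s≡s = s≡s
  ... | no ne with exists-edge v (<⇒≤ (proj₂ (E-colour G f))) (three-left f ne)
                 | exists-edge w (<⇒≤ (proj₂ (E-colour G f))) (three-left (E-sym G f) (ne ∘ sym))
  ... | x , ex | y , ey = contradiction (subst (λ m → E G (1 + m) v w) (sym l) (double-down f ex ey))
          (right-not-double eq r (subst (λ m → E G (2 + m) v w) (sym l) f))

  right-pair-label : ∀ {v w c a b s c′ a′ b′ s′} → E G (2 + length s) v w →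
                     L v ≡ c ∷ a ∷ b ∷ s → L w ≡ c′ ∷ a′ ∷ b′ ∷ s′ → Right b a c → Right b′ a′ c′ →
                     b ∷ s ≡ b′ ∷ s′
  right-pair-label {c = c} {a} {s = s} {c′} {a′} f eq eq′ r r′ =
    same-label (suc (length s)) ≤-refl (c ∷ a ∷ []) (c′ ∷ a′ ∷ [])
      (right-pair f eq eq′ r r′ refl (suc-injective (suc-injective l))) eq eq′ refl (suc-injective l)
    where
    l = trans (length₃ eq′) (sym (length₃ eq))
    l≤k : suc (length s) ≤ suc k
    l≤k = s≤s (≤-trans (m≤n+m _ 2) (≤-reflexive (length₃ eq)))
    open Simulation G deg Λ k<n Λ (RightPair (length s)) (suc (length s)) l≤k l≤k
           (λ p i<m → right-pair-closed p (s≤s⁻¹ i<m)) right-pair-signs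


  -- The letter k - 1 is moved from row b to row d by an edge of colour k - 2,
  -- which spans the square of sixVertices together with edges of colour k.
  right-between : ∀ {v w c a b s c′ a′} → E G (2 + length s) v w →
                  L v ≡ c ∷ a ∷ b ∷ s → L w ≡ c′ ∷ a′ ∷ b ∷ s → Right b a c → Right b a′ c′ →
                  ∀ {d} → Removable d (b ∷ s) → Right d a c → Right d a′ c′
  right-between {v} {w} {c} {a} {b} {s} {c′} {a′} f eq eq′ r r′ {d} rem rd with d ≟ b | subst Yam eq (yam v)
  ... | yes refl | _ = r′
  ... | no d≢b   | _ ∷ _ ∷ y with exchange′ y d≢b rem
  ... | e , t , yd , eqs , l , rt
    with reach (c ∷ a ∷ b ∷ []) eq yd eqs l (≤-trans (m≤n+m _ 2) (≤-reflexive (length₃ eq)))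
  ... | v₁ , p , eqv₁ with parallel⋆ p f
  ... | w₁ , f₁ , q
    with path-word Λ (c′ ∷ a′ ∷ b ∷ []) q eq′ refl (≤-trans (m≤n+m _ 2) (≤-reflexive (length₃ eq)))
       | subst (λ m → E G (2 + m) v₁ w₁) (sym l) f₁
  ... | s₁ , eqw₁ , _ , _ | f₁′ with right-pair-label f₁′ eqv₁ eqw₁ r r′
  ... | refl
    with lift {v = v₁} {u = c ∷ a ∷ d ∷ b ∷ e ∷ t} (≤-trans (n≤1+n _) (≤-reflexive (length₃ eqv₁))) (⟶-from (sym eqv₁)
           (there {c = c} (there {c = a} (here refl (right rt)))))
  ... | v₂ , e₁ , eqv₂ with top-edge eqv₂ (Right-sg rd)
  ... | w₂ , f₂
    -- The labels at `v₁`, `w₁` and `v₂` are known; the fourth corner `w₂` is reached from `w₁` by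
    -- the edge of colour `k - 2` that closes the square, so its label is known as well.
    with square e₁ f₁′ f₂ (right-not-double eqv₁ r f₁′) (right-not-double eqv₂ rd f₂)
  ... | e₂
    with ⟶-det (⟶-from eqw₁ (edge e₂ (≤-trans (n≤1+n _) (≤-reflexive (length₃ eqv₁)))))
               (there {c = c′} (there {c = a′} (here refl (right rt))))
  ... | eqw₂ with Left⊎Right (switch-sg eqw₂ (E-sym G f₂))
  ... | inj₂ r₂ = r₂
  -- Were `k + 1` in the middle at `w₂`, then `left-edge` would give the label of `v₂`, and
  -- comparing it with the known one would force `d = a′`.
  ... | inj₁ l₂ with trans (sym eqv₂) (proj₁ (left-edge eqw₂ (E-sym G f₂) l₂))
  ... | refl = contradiction refl (Left-≢ l₂)

  -- Each end determines an interval of rows around `b` bounded by the rows of the two upper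
  -- letters. The intervals contain the same corners by `right-between` and have addable rows as
  -- bounds, hence they coincide; as σ_k flips, the bounds are interchanged.
  right-edge : ∀ {v w c a b s c′ a′ b′ s′} → E G (2 + length s) v w →
               L v ≡ c ∷ a ∷ b ∷ s → L w ≡ c′ ∷ a′ ∷ b′ ∷ s′ → Right b a c → Right b′ a′ c′ →
               L w ≡ a ∷ c ∷ b ∷ s
  right-edge {v} {w} {c} {a} {b} {s} {c′} {a′} f eq eq′ r r′ with right-pair-label f eq eq′ r r′
  ... | refl with Right-addable (subst Yam eq (yam v)) r | Right-addable (subst Yam eq′ (yam w)) r′
  ... | aa , ac | aa′ , ac′ with right-between f eq eq′ r r′ | right-between (E-sym G f) eq′ eq r′ r
  ... | to | from = trans eq′ (cong₂ (λ x y → x ∷ y ∷ b ∷ s) (proj₁ (ends r r′)) (proj₂ (ends r r′)))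
    where
    opposite-signs : sg c a ≢ sg c′ a′
    opposite-signs = subst₂ _≢_ (sig v [] eq) (sig w [] eq′) (flipsʳ f)
    up′ : ∀ {d a c} → Between a c d → Right d a c
    up′ (between x y) = up x y
    down′ : ∀ {d a c} → Between c a d → Right d a c
    down′ (between x y) = down x y
    unup : ∀ {d a c} → a ≤ c → Right d a c → Between a c d
    unup _   (up x y)   = between x y
    unup a≤c (down x y) = contradiction a≤c (<⇒≱ (≤-<-trans x y))
    undown : ∀ {d a c} → c ≤ a → Right d a c → Between c a d
    undown _   (down x y) = between x y
    undown c≤a (up x y)   = contradiction c≤a (<⇒≱ (≤-<-trans x y))
    ends : Right b a c → Right b a′ c′ → c′ ≡ a × a′ ≡ c
    -- In two cases of the same direction σ_k would be the same at both ends.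
    ends (up x y) (up x′ y′) = contradiction
      (trans (sg-> (≤-<-trans x y)) (sym (sg-> (≤-<-trans x′ y′)))) opposite-signs
    ends (down x y) (down x′ y′) = contradiction
      (trans (sg-≤ (<⇒≤ (≤-<-trans x y))) (sym (sg-≤ (<⇒≤ (≤-<-trans x′ y′))))) opposite-signs
    ends (up x y) (down x′ y′)
      with between-⊆ ac′ ac (between x y) (between x′ y′)
             (λ rm bt → undown (<⇒≤ (≤-<-trans x′ y′)) (to rm (up′ bt)))
         | between-⊆ aa aa′ (between x′ y′) (between x y)
             (λ rm bt → unup (<⇒≤ (≤-<-trans x y)) (from rm (down′ bt)))
    ... | p , q | p′ , q′ = ≤-antisym p p′ , ≤-antisym q′ q
    ends (down x y) (up x′ y′)
      with between-⊆ aa′ aa (between x y) (between x′ y′)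
             (λ rm bt → unup (<⇒≤ (≤-<-trans x′ y′)) (to rm (down′ bt)))
         | between-⊆ ac ac′ (between x′ y′) (between x y)
             (λ rm bt → undown (<⇒≤ (≤-<-trans x y)) (from rm (up′ bt)))
    ... | p , q | p′ , q′ = ≤-antisym q′ q , ≤-antisym p p′

  top-step-from : ∀ {v w c a b s c′ a′ b′ s′} → L v ≡ c ∷ a ∷ b ∷ s → L w ≡ c′ ∷ a′ ∷ b′ ∷ s′ →
                  E G (2 + length s) v w → E G (2 + length s′) w v →
                  Left b a c ⊎ Right b a c → Left b′ a′ c′ ⊎ Right b′ a′ c′ → L v ⟶[ k ] L w
  top-step-from eq eq′ f f′ (inj₁ l) _ = ⟶-between (sym eq) (sym (proj₁ (left-edge eq f l)))
    (here (sym (length₃ eq)) (left l))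
  top-step-from eq eq′ f f′ (inj₂ r) (inj₁ l) = ⟶-sym (⟶-between (sym eq′) (sym (proj₁ (left-edge eq′ f′ l)))
    (here (sym (length₃ eq′)) (left l)))
  top-step-from eq eq′ f f′ (inj₂ r) (inj₂ r′) = ⟶-between (sym eq) (sym (right-edge f eq eq′ r r′))
    (here (sym (length₃ eq)) (right r))

  recolour : ∀ {i j v w} → i ≡ j → E G i v w → E G j v w
  recolour refl e = e

  top-step : ∀ {v w} → E G k v w → L v ⟶[ k ] L w
  top-step {v} {w} f =
    let m , k≡ = m≤n⇒∃[o]m+o≡n (proj₁ (E-colour G f))
        c , a , b , s , eq = letters₃ (L v) (trans (len v) (cong suc (sym k≡)))
        c′ , a′ , b′ , s′ , eq′ = letters₃ (L w) (trans (len w) (cong suc (sym k≡)))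
        f₁ = recolour (sym (length₃ eq)) f
        f₂ = recolour (sym (length₃ eq′)) (E-sym G f)
    in top-step-from eq eq′ f₁ f₂ (Left⊎Right (switch-sg eq f₁)) (Left⊎Right (switch-sg eq′ f₂))

  completed : Labelling G (suc k) (suc k)
  completed = record { L = L ; len = len ; yam = yam ; sig = sig ; edge = edge⁺ }
    where
    edge⁺ : ∀ {i v w} → E G i v w → i < suc k → L v ⟶[ i ] L w
    edge⁺ e (s≤s i≤k) with m≤n⇒m<n∨m≡n i≤k
    ... | inj₁ i<k  = edge e i<k
    ... | inj₂ refl = top-step e

  module Injectivity (inj : ∀ {v w} → Path G (_< k) v w → L v ≡ L w → v ≡ w) where

    no-crossing : ∀ {v w} (p : Path G (_≤ k) v w) → crossings G k p ≤ 0 → Path G (_< k) v w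
    no-crossing ε _ = ε
    no-crossing ((i , i≤k , e) ◅ p) l with k ≟ i
    ... | yes refl = contradiction (subst (_≤ 0) (cong length (filter-accept (k ≟_) {k} {colours G p} refl)) l) λ ()
    ... | no k≢i   = (i , ≤∧≢⇒< i≤k (k≢i ∘ sym) , e) ◅
          no-crossing p (subst (_≤ 0) (cong length (filter-reject (k ≟_) {i} {colours G p} k≢i)) l)

    one-crossing : ∀ {v w} (p : Path G (_≤ k) v w) → crossings G k p ≤ 1 → Path G (_< k) v w ⊎
                   ∃[ x ] ∃[ y ] (Path G (_< k) v x × E G k x y × Path G (_< k) y w)
    one-crossing ε _ = inj₁ ε
    one-crossing ((i , i≤k , e) ◅ p) l with k ≟ i
    ... | yes refl = inj₂ (_ , _ , ε , e , no-crossing p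
          (s≤s⁻¹ (subst (_≤ 1) (cong length (filter-accept (k ≟_) {k} {colours G p} refl)) l)))
    ... | no k≢i with one-crossing p
          (subst (_≤ 1) (cong length (filter-reject (k ≟_) {i} {colours G p} k≢i)) l)
    ... | inj₁ q = inj₁ ((i , ≤∧≢⇒< i≤k (k≢i ∘ sym) , e) ◅ q)
    ... | inj₂ (x , y , q , f , q′) = inj₂ (x , y , (i , ≤∧≢⇒< i≤k (k≢i ∘ sym) , e) ◅ q , f , q′)

    few-crossings : ∀ {v w} → Path G (_< suc k) v w → Path G (_< k) v w ⊎
                    ∃[ x ] ∃[ y ] (Path G (_< k) v x × E G k x y × Path G (_< k) y w)
    few-crossings {v} {w} p with 1 <? k
    ... | yes 1<k with ax6 k 1<k k<n v w (Star.map (λ (i , l , e) → i , s≤s⁻¹ l , e) p)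
    ... | q , l = one-crossing q l
    few-crossings ε | no _ = inj₁ ε
    -- Outside the range of ax6 there is nothing to cross, since every colour is at least 2.
    few-crossings ((i , s≤s i≤k , e) ◅ p) | no 1≮k =
      contradiction (<-≤-trans (proj₁ (E-colour G e)) i≤k) 1≮k

    -- With the largest letter unmoved the switch must be a `Left` one, and `left-edge` found such
    -- an edge doubled up to smaller colours.
    short : ∀ {x y c u u′} → L x ≡ c ∷ u → L y ≡ c ∷ u′ → E G k x y →
            c ∷ u ⟶[ k ] c ∷ u′ → Path G (_< k) x y
    short {x} eqx eqy f (there st) = contradiction
      (subst (k <_) (suc-injective (trans (cong length (sym eqx)) (len x))) (proj₂ (⟶-colour st))) (<-irrefl refl)
    short eqx eqy f (here k≡ (left l))  = proj₂ (left-edge eqx (recolour k≡ f) l)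
    short eqx eqy f (here k≡ (right r)) = contradiction refl (Right-≢ r)

    -- By ax6 one edge of colour `k` suffices. The paths before and after it keep the largest
    -- letter, which agrees at `v` and `w`; so this edge fixes it too and is replaced by smaller
    -- colours.
    injective⁺ : ∀ {v w} → Path G (_< suc k) v w → L v ≡ L w → v ≡ w
    injective⁺ {v} {w} p eq with few-crossings p
    ... | inj₁ q = inj q eq
    ... | inj₂ (x , y , q , f , q′) =
      let c , u , eqv , l = ∷-length⁻¹ (L v) (len v)
          _ , eqx , _ = path-word Λ (c ∷ []) q eqv l ≤-refl
          _ , eqy , _ = path-word Λ (c ∷ []) (path-sym q′) (trans (sym eq) eqv) l ≤-refl
      in inj (q ◅◅ short eqx eqy f (⟶-between eqx eqy (top-step f)) ◅◅ q′) eq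

module Labels {n} (G : SignedColoredGraph n n) (deg : IsDualEquivalenceGraph G) where

  labelled : ∀ k → k ≤ n → Σ (Labelling G k k) λ Λ →
             ∀ {v w} → Path G (_< k) v w → Labelling.L Λ v ≡ Labelling.L Λ w → v ≡ w
  labelled zero _ =
    record { L = λ _ → [] ; len = λ _ → refl ; yam = λ _ → []
           ; sig = λ { _ [] () ; _ (_ ∷ _) () } ; edge = λ _ () } ,
    λ { ε _ → refl }
  labelled (suc k) k<n with labelled k (<⇒≤ k<n)
  ... | Λ , inj =
    TopEdge.completed G deg extended k<n ,
    TopEdge.Injectivity.injective⁺ G deg extended k<n λ p eq → inj p (∷-injectiveʳ eq)
    where open Threshold G deg Λ k<n inj

-- Fillings and biwords

-- A bijection given as a relation, so that neither direction has to be a function defined on all of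
-- a type; equal sums and equal lengths then follow from one permutation.
bij-↭ : ∀ {A B C : Set} {X : List A} {Y : List B} {h : A → C} {g : B → C} (ρ : A → B → Set) →
        Unique X → Unique Y →
        (∀ {x} → x ∈ X → ∃[ y ] (y ∈ Y × ρ x y)) → (∀ {y} → y ∈ Y → ∃[ x ] (x ∈ X × ρ x y)) →
        (∀ {x y y′} → ρ x y → ρ x y′ → y ≡ y′) → (∀ {x x′ y} → ρ x y → ρ x′ y → x ≡ x′) →
        (∀ {x y} → x ∈ X → ρ x y → h x ≡ g y) → map h X ↭ map g Y
bij-↭ {X = []} {[]} ρ _ _ _ _ _ _ _ = ↭-refl
bij-↭ {X = []} {y ∷ Y} ρ _ _ _ from _ _ _ = case from (here refl) of λ { (_ , () , _) }
bij-↭ {X = x ∷ X} {Y} {h} {g} ρ (x∉X ∷ uX) uY to from func inj eq with to (here refl)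
... | y , y∈Y , r with ∈-∃++ y∈Y
... | Y₁ , Y₂ , refl = begin
  h x ∷ map h X            <⟨ bij-↭ {X = X} {Y₁ ++ Y₂} ρ uX (drop-middle Y₁ uY) to′ from′ func inj (eq ∘ there) ⟩
  h x ∷ map g (Y₁ ++ Y₂)   ≡⟨ cong (_∷ map g (Y₁ ++ Y₂)) (eq (here refl) r) ⟩
  map g (y ∷ Y₁ ++ Y₂)     ↭⟨ Perm.map⁺ g (↭-sym (Perm.shift y Y₁ Y₂)) ⟩
  map g (Y₁ ++ y ∷ Y₂)     ∎
  where
  open Perm.PermutationReasoning
  drop-middle : ∀ ys → Unique (ys ++ y ∷ Y₂) → Unique (ys ++ Y₂)
  drop-middle []       (_ ∷ u) = u
  drop-middle (z ∷ zs) (p ∷ u) = All.++⁺ (All.++⁻ˡ zs p) (All.tail (All.++⁻ʳ zs p)) ∷ drop-middle zs u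
  fresh : ∀ ys → Unique (ys ++ y ∷ Y₂) → y ∉ ys ++ Y₂
  fresh []       (p ∷ _) y∈ = All.lookup p y∈ refl
  fresh (z ∷ zs) (p ∷ u) (here refl) = All.lookup p (∈-++⁺ʳ zs (here refl)) refl
  fresh (z ∷ zs) (p ∷ u) (there y∈)  = fresh zs u y∈
  other : ∀ {z} ys → z ∈ ys ++ y ∷ Y₂ → z ≢ y → z ∈ ys ++ Y₂
  other []       (here z≡y) z≢y = contradiction z≡y z≢y
  other []       (there z∈) _   = z∈
  other (_ ∷ ys) (here z≡)  _   = here z≡
  other (_ ∷ ys) (there z∈) z≢y = there (other ys z∈ z≢y)
  to′ : ∀ {x′} → x′ ∈ X → ∃[ y′ ] (y′ ∈ Y₁ ++ Y₂ × ρ x′ y′)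
  to′ x′∈X with to (there x′∈X)
  ... | y′ , y′∈ , r′ = y′ , other Y₁ y′∈ (λ { refl → All.lookup x∉X x′∈X (inj r r′) }) , r′
  widen : ∀ {z} ys → z ∈ ys ++ Y₂ → z ∈ ys ++ y ∷ Y₂
  widen []       z∈         = there z∈
  widen (_ ∷ ys) (here z≡)  = here z≡
  widen (_ ∷ ys) (there z∈) = there (widen ys z∈)
  from′ : ∀ {y′} → y′ ∈ Y₁ ++ Y₂ → ∃[ x′ ] (x′ ∈ X × ρ x′ y′)
  from′ {y′} y′∈ with from (widen Y₁ y′∈)
  ... | x′ , there x′∈ , r′ = x′ , x′∈ , r′
  ... | x′ , here refl , r′ = contradiction (subst (_∈ Y₁ ++ Y₂) (func r′ r) y′∈) (fresh Y₁ uY)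

data At {A : Set} : List A → ℕ → A → Set where
  here  : ∀ {x xs} → At (x ∷ xs) 0 x
  there : ∀ {x xs i y} → At xs i y → At (x ∷ xs) (suc i) y

At⇒∈ : ∀ {A : Set} {xs : List A} {i x} → At xs i x → x ∈ xs
At⇒∈ here      = here refl
At⇒∈ (there p) = there (At⇒∈ p)

∈⇒At : ∀ {A : Set} {xs : List A} {x} → x ∈ xs → ∃[ i ] At xs i x
∈⇒At (here refl) = 0 , here
∈⇒At (there p)   = let i , q = ∈⇒At p in suc i , there q

At-functional : ∀ {A : Set} {xs : List A} {i x y} → At xs i x → At xs i y → x ≡ y
At-functional here      here      = refl
At-functional (there p) (there q) = At-functional p q

At⇒< : ∀ {A : Set} {xs : List A} {i x} → At xs i x → i < length xs
At⇒< here      = s≤s z≤n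
At⇒< (there p) = s≤s (At⇒< p)

<⇒At : ∀ {A : Set} (xs : List A) {i} → i < length xs → ∃[ x ] At xs i x
<⇒At (x ∷ xs) {zero}  _       = x , here
<⇒At (x ∷ xs) {suc i} (s≤s p) = map₂ there (<⇒At xs p)

rowAt : Filling → ℕ → List ℕ
rowAt []      _       = []
rowAt (r ∷ T) zero    = r
rowAt (r ∷ T) (suc j) = rowAt T j

rowAt-ext : ∀ {T S} → length T ≡ length S → (∀ j → rowAt T j ≡ rowAt S j) → T ≡ S
rowAt-ext {[]}    {[]}    _ _  = refl
rowAt-ext {r ∷ T} {s ∷ S} l eq = cong₂ _∷_ (eq 0) (rowAt-ext (suc-injective l) (eq ∘ suc))

addAt : ℕ → ℕ → Filling → Filling
addAt _       x []      = []
addAt zero    x (r ∷ T) = (r ∷ʳ x) ∷ T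
addAt (suc j) x (r ∷ T) = r ∷ addAt j x T

length-addAt : ∀ r x T → length (addAt r x T) ≡ length T
length-addAt r       x []      = refl
length-addAt zero    x (_ ∷ T) = refl
length-addAt (suc r) x (_ ∷ T) = cong suc (length-addAt r x T)

rowAt-addAt : ∀ {r} x T → r < length T → rowAt (addAt r x T) r ≡ rowAt T r ∷ʳ x
rowAt-addAt {zero}  x (_ ∷ T) _       = refl
rowAt-addAt {suc r} x (_ ∷ T) (s≤s p) = rowAt-addAt x T p

rowAt-addAt-≢ : ∀ {r j} x T → r ≢ j → rowAt (addAt r x T) j ≡ rowAt T j
rowAt-addAt-≢ {r}     {j}     x []      _   = refl
rowAt-addAt-≢ {zero}  {zero}  x (_ ∷ T) r≢j = contradiction refl r≢j
rowAt-addAt-≢ {zero}  {suc j} x (_ ∷ T) _   = refl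
rowAt-addAt-≢ {suc r} {zero}  x (_ ∷ T) _   = refl
rowAt-addAt-≢ {suc r} {suc j} x (_ ∷ T) r≢j = rowAt-addAt-≢ x T (r≢j ∘ cong suc)

addAt-comm : ∀ {r s} x y T → r ≢ s → addAt r x (addAt s y T) ≡ addAt s y (addAt r x T)
addAt-comm {r}     {s}     x y []      _   = refl
addAt-comm {zero}  {zero}  x y (_ ∷ T) r≢s = contradiction refl r≢s
addAt-comm {zero}  {suc s} x y (_ ∷ T) _   = refl
addAt-comm {suc r} {zero}  x y (_ ∷ T) _   = refl
addAt-comm {suc r} {suc s} x y (_ ∷ T) r≢s = cong (_ ∷_) (addAt-comm x y T (r≢s ∘ cong suc))

map-addAt : ∀ f r x T → map (map f) (addAt r x T) ≡ addAt r (f x) (map (map f) T)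
map-addAt f r       x []      = refl
map-addAt f zero    x (w ∷ T) = cong (_∷ map (map f) T) (map-++ f w (x ∷ []))
map-addAt f (suc r) x (w ∷ T) = cong (map f w ∷_) (map-addAt f r x T)

concat-addAt : ∀ {r} x T → r < length T → concat (addAt r x T) ↭ x ∷ concat T
concat-addAt {zero}  x (w ∷ T) _ = ↭-trans (Perm.↭-reflexive (++-assoc w (x ∷ []) _)) (Perm.shift x w (concat T))
concat-addAt {suc r} x (w ∷ T) (s≤s p) =
  ↭-trans (Perm.++⁺ˡ w (concat-addAt x T p)) (Perm.shift x w (concat T))

-- A biword lists the (row , entry) pairs in the order in which the cells are
-- added to the tableau, the last one first.
Biword : Set
Biword = List (ℕ × ℕ)

rows : Biword → Word
rows = map proj₁

fill : ℕ → Biword → Filling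
fill ℓ []            = replicate ℓ []
fill ℓ ((r , x) ∷ β) = addAt r x (fill ℓ β)

length-fill : ∀ ℓ β → length (fill ℓ β) ≡ ℓ
length-fill ℓ []            = length-replicate ℓ
length-fill ℓ ((r , x) ∷ β) = trans (length-addAt r x (fill ℓ β)) (length-fill ℓ β)

rowAt-empty : ∀ ℓ j → rowAt (replicate ℓ []) j ≡ []
rowAt-empty zero    j       = refl
rowAt-empty (suc ℓ) zero    = refl
rowAt-empty (suc ℓ) (suc j) = rowAt-empty ℓ j

rowAt-head : ∀ {ℓ r} x β → r < ℓ → rowAt (fill ℓ ((r , x) ∷ β)) r ≡ rowAt (fill ℓ β) r ∷ʳ x
rowAt-head {ℓ} x β r<ℓ = rowAt-addAt x (fill ℓ β) (subst (_ <_) (sym (length-fill ℓ β)) r<ℓ)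

Bounded : ℕ → Biword → Set
Bounded ℓ = All (λ (r , _) → r < ℓ)

∈-row⇒∈ : ∀ {ℓ} β {j a} → Bounded ℓ β → a ∈ rowAt (fill ℓ β) j → (j , a) ∈ β
∈-row⇒∈ {ℓ} [] {j} _ a∈ rewrite rowAt-empty ℓ j = case a∈ of λ ()
∈-row⇒∈ {ℓ} ((r , x) ∷ β) {j} {a} (r<ℓ ∷ b) a∈ with r ≟ j
... | no r≢j = there (∈-row⇒∈ β b (subst (a ∈_) (rowAt-addAt-≢ x (fill ℓ β) r≢j) a∈))
... | yes refl with ∈-++⁻ (rowAt (fill ℓ β) r) (subst (a ∈_) (rowAt-head x β r<ℓ) a∈)
... | inj₁ a∈′         = there (∈-row⇒∈ β b a∈′)
... | inj₂ (here refl) = here refl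

∈⇒∈-row : ∀ {ℓ} β {j a} → Bounded ℓ β → (j , a) ∈ β → a ∈ rowAt (fill ℓ β) j
∈⇒∈-row {ℓ} ((r , x) ∷ β) (r<ℓ ∷ b) (here refl) =
  subst (x ∈_) (sym (rowAt-head x β r<ℓ)) (∈-++⁺ʳ (rowAt (fill ℓ β) r) (here refl))
∈⇒∈-row {ℓ} ((r , x) ∷ β) {j} {a} (r<ℓ ∷ b) (there p) with r ≟ j
... | no r≢j   = subst (a ∈_) (sym (rowAt-addAt-≢ x (fill ℓ β) r≢j)) (∈⇒∈-row β b p)
... | yes refl = subst (a ∈_) (sym (rowAt-head x β r<ℓ)) (∈-++⁺ˡ (∈⇒∈-row β b p))

length-row : ∀ {ℓ} β j → Bounded ℓ β → length (rowAt (fill ℓ β) j) ≡ count j (rows β)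
length-row {ℓ} [] j _ rewrite rowAt-empty ℓ j = refl
length-row {ℓ} ((r , x) ∷ β) j (r<ℓ ∷ b) with j ≟ r
... | no j≢r   = trans (cong length (rowAt-addAt-≢ x (fill ℓ β) (j≢r ∘ sym)))
                   (trans (length-row β j b) (sym (count-there (rows β) j≢r)))
... | yes refl = trans (cong length (rowAt-head x β r<ℓ)) (trans (trans (length-++ (rowAt (fill ℓ β) r)) (+-comm _ 1))
                   (trans (cong suc (length-row β j b)) (sym (count-here j (rows β)))))

concat-fill : ∀ {ℓ} β → Bounded ℓ β → concat (fill ℓ β) ↭ map proj₂ β
concat-fill {ℓ} [] _ = Perm.↭-reflexive (empty ℓ)
  where
  empty : ∀ ℓ → concat (replicate ℓ []) ≡ []
  empty zero    = refl
  empty (suc ℓ) = empty ℓ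
concat-fill {ℓ} ((r , x) ∷ β) (r<ℓ ∷ b) =
  ↭-trans (concat-addAt x (fill ℓ β) (subst (r <_) (sym (length-fill ℓ β)) r<ℓ)) (Perm.prep x (concat-fill β b))

data Above : List ℕ → List ℕ → Set where
  []  : ∀ {xs} → Above xs []
  _∷_ : ∀ {x y xs ys} → x < y → Above xs ys → Above (x ∷ xs) (y ∷ ys)

record Semistandard (R : Rel ℕ 0ℓ) (T : Filling) : Set where
  field
    row-pairs : ∀ j → AllPairs R (rowAt T j)
    columns   : ∀ j → Above (rowAt T j) (rowAt T (suc j))

Above-length : ∀ {xs ys} → Above xs ys → length ys ≤ length xs
Above-length []      = z≤n
Above-length (_ ∷ p) = s≤s (Above-length p)

Above-extend : ∀ {xs ys} x → Above xs ys → Above (xs ∷ʳ x) ys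
Above-extend x []      = []
Above-extend x (p ∷ q) = p ∷ Above-extend x q

Above-∷ʳ : ∀ {xs ys x} → Above xs ys → length ys < length xs → All (_< x) xs → Above xs (ys ∷ʳ x)
Above-∷ʳ {_ ∷ _} []      _       (q ∷ _)  = q ∷ []
Above-∷ʳ         (p ∷ q) (s≤s l) (_ ∷ qs) = p ∷ Above-∷ʳ q l qs

Above-∷ʳ⁻ : ∀ {xs} ys {x} → Above xs (ys ∷ʳ x) → Above xs ys
Above-∷ʳ⁻ []       _       = []
Above-∷ʳ⁻ (_ ∷ ys) (p ∷ q) = p ∷ Above-∷ʳ⁻ ys q

Above-shrink : ∀ xs {x ys} → Above (xs ∷ʳ x) ys → All (_≤ x) ys → Above xs ys
Above-shrink []       []       _        = []
Above-shrink (_ ∷ xs) []       _        = []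
Above-shrink []       (p ∷ _)  (q ∷ _)  = contradiction p (≤⇒≯ q)
Above-shrink (_ ∷ xs) (p ∷ ps) (_ ∷ qs) = p ∷ Above-shrink xs ps qs

AllPairs-∷ʳ : ∀ {A : Set} {R : Rel A 0ℓ} {xs x} → AllPairs R xs → All (λ a → R a x) xs → AllPairs R (xs ∷ʳ x)
AllPairs-∷ʳ []       []       = [] ∷ []
AllPairs-∷ʳ (p ∷ ps) (q ∷ qs) = All.∷ʳ⁺ p q ∷ AllPairs-∷ʳ ps qs

AllPairs-∷ʳ⁻ : ∀ {A : Set} {R : Rel A 0ℓ} xs {x} → AllPairs R (xs ∷ʳ x) → AllPairs R xs × All (λ a → R a x) xs
AllPairs-∷ʳ⁻ []       _        = [] , []
AllPairs-∷ʳ⁻ (_ ∷ xs) (p ∷ ps) with AllPairs-∷ʳ⁻ xs ps | All.∷ʳ⁻ p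
... | r , q | p′ , s = p′ ∷ r , s ∷ q

-- The standardisation order: equal entries form a horizontal strip and are added from left to
-- right, that is, with weakly decreasing rows. The parameter `R` is `_≤_` for semistandard and
-- `_<_` for standard fillings.
record After (R : Rel ℕ 0ℓ) (e f : ℕ × ℕ) : Set where
  constructor after
  field
    order : proj₂ f < proj₂ e ⊎ (proj₂ f ≡ proj₂ e × proj₁ e ≤ proj₁ f)
    in-row : proj₁ f ≡ proj₁ e → R (proj₂ f) (proj₂ e)

record Admissible (R : Rel ℕ 0ℓ) (ℓ : ℕ) (β : Biword) : Set where
  constructor admissible
  field
    bounded : Bounded ℓ β
    lattice : Yam (rows β)
    sorted  : AllPairs (After R) β

fill-semistandard : ∀ {R ℓ β} → Admissible R ℓ β → Semistandard R (fill ℓ β)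
fill-semistandard {R} {ℓ} {[]} _ = record
  { row-pairs = λ j → subst (AllPairs R) (sym (rowAt-empty ℓ j)) []
  ; columns   = λ j → subst (Above _) (sym (rowAt-empty ℓ (suc j))) [] }
fill-semistandard {R} {ℓ} {(r , x) ∷ β} (admissible (r<ℓ ∷ b) (a ∷ y) (s ∷ ss)) = record
  { row-pairs = row-pairs′ ; columns = columns′ }
  where
  T = fill ℓ β
  open Semistandard (fill-semistandard {R} {ℓ} {β} (admissible b y ss))
  row-pairs′ : ∀ j → AllPairs R (rowAt (addAt r x T) j)
  row-pairs′ j with r ≟ j
  ... | no r≢j   = subst (AllPairs R) (sym (rowAt-addAt-≢ x T r≢j)) (row-pairs j)
  ... | yes refl = subst (AllPairs R) (sym (rowAt-head x β r<ℓ)) (AllPairs-∷ʳ (row-pairs r)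
          (All.tabulate λ a∈ → After.in-row (All.lookup s (∈-row⇒∈ β b a∈)) refl))
  below : ∀ {j} → suc j ≡ r → Addable r (rows β) →
          length (rowAt T r) < length (rowAt T j) × All (_< x) (rowAt T j)
  below {j} refl (suc (removable p)) =
    subst₂ _<_ (sym (length-row β (suc j) b)) (sym (length-row β j b)) p ,
    -- An earlier entry equal to `x` would lie in a row at least `suc j`, so the entries of row `j`
    -- are strictly smaller.
    All.tabulate λ a∈ → case After.order (All.lookup s (∈-row⇒∈ β b a∈)) of λ
      { (inj₁ a<x) → a<x ; (inj₂ (_ , 1+j≤j)) → contradiction 1+j≤j 1+n≰n }
  columns′ : ∀ j → Above (rowAt (addAt r x T) j) (rowAt (addAt r x T) (suc j))
  columns′ j with r ≟ j | r ≟ suc j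
  ... | yes refl | yes r≡1+r = contradiction (sym r≡1+r) 1+n≢n
  ... | yes refl | no r≢1+r  = subst₂ Above (sym (rowAt-head x β r<ℓ)) (sym (rowAt-addAt-≢ x T r≢1+r))
          (Above-extend x (columns r))
  ... | no r≢j   | no r≢1+j  = subst₂ Above (sym (rowAt-addAt-≢ x T r≢j)) (sym (rowAt-addAt-≢ x T r≢1+j)) (columns j)
  ... | no r≢j   | yes refl  = subst₂ Above (sym (rowAt-addAt-≢ x T r≢j)) (sym (rowAt-head x β r<ℓ))
          (Above-∷ʳ (columns j) (proj₁ (below refl a)) (proj₂ (below refl a)))

addAt-injective : ∀ {r x} T S → r < length T → length T ≡ length S → addAt r x T ≡ addAt r x S → T ≡ S
addAt-injective {zero}  {x} (t ∷ T) (s ∷ S) _ _ eq =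
  cong₂ _∷_ (proj₁ (∷ʳ-injective t s (∷-injectiveˡ eq))) (∷-injectiveʳ eq)
addAt-injective {suc r} (t ∷ T) (s ∷ S) (s≤s p) l eq =
  cong₂ _∷_ (∷-injectiveˡ eq) (addAt-injective T S p (suc-injective l) (∷-injectiveʳ eq))

fill-length : ∀ {ℓ} β → Bounded ℓ β → length (concat (fill ℓ β)) ≡ length β
fill-length β b = trans (Perm.↭-length (concat-fill β b)) (length-map proj₂ β)

-- The head is the last pair in the standardisation order. Each head occurs in the other biword,
-- hence neither comes strictly before the other.
fill-injective : ∀ {R ℓ β γ} → Admissible R ℓ β → Admissible R ℓ γ → fill ℓ β ≡ fill ℓ γ → β ≡ γ
fill-injective {β = []}    {[]}    _ _ _ = refl
fill-injective {β = []}    {_ ∷ _} p q eq = contradiction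
  (trans (sym (fill-length _ (Admissible.bounded p))) (trans (cong (length ∘ concat) eq) (fill-length _ (Admissible.bounded q)))) λ ()
fill-injective {β = _ ∷ _} {[]}    p q eq = contradiction
  (trans (sym (fill-length _ (Admissible.bounded p))) (trans (cong (length ∘ concat) eq) (fill-length _ (Admissible.bounded q)))) λ ()
fill-injective {R} {ℓ} {(r , x) ∷ β} {(r′ , x′) ∷ γ} (admissible bβ@(r<ℓ ∷ b) (_ ∷ y) (s ∷ ss)) (admissible bγ@(_ ∷ b′) (_ ∷ y′) (s′ ∷ ss′)) eq
  with ∈-row⇒∈ ((r , x) ∷ β) bβ (subst (λ T → x′ ∈ rowAt T r′) (sym eq) (∈⇒∈-row ((r′ , x′) ∷ γ) bγ (here refl)))
     | ∈-row⇒∈ ((r′ , x′) ∷ γ) bγ (subst (λ T → x ∈ rowAt T r) eq (∈⇒∈-row ((r , x) ∷ β) bβ (here refl)))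
... | p | q = case same-head p q of λ { refl → cong (_ ∷_) (fill-injective (admissible b y ss) (admissible b′ y′ ss′)
    (addAt-injective (fill ℓ β) (fill ℓ γ) (subst (r <_) (sym (length-fill ℓ β)) r<ℓ)
      (trans (length-fill ℓ β) (sym (length-fill ℓ γ))) eq)) }
  where
  same-head : (r′ , x′) ∈ (r , x) ∷ β → (r , x) ∈ (r′ , x′) ∷ γ → (r , x) ≡ (r′ , x′)
  same-head (here eq) _         = sym eq
  same-head _         (here eq) = eq
  same-head (there p) (there q) with After.order (All.lookup s p) | After.order (All.lookup s′ q)
  ... | inj₁ l          | inj₁ l′          = contradiction l (<⇒≯ l′)
  ... | inj₁ l          | inj₂ (refl , _)  = contradiction l (<-irrefl refl)
  ... | inj₂ (refl , _) | inj₁ l           = contradiction l (<-irrefl refl)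
  ... | inj₂ (refl , l) | inj₂ (_ , l′)    = cong (_, x) (≤-antisym l l′)

-- The cell added last: the largest entry, in the lowest row in case of ties.
TopCell : Filling → Set
TopCell T = ∃[ r ] ∃[ x ] ∃[ S ] (r < length S × T ≡ addAt r x S ×
  (∀ {j a} → a ∈ rowAt T j → a < x ⊎ (a ≡ x × r ≤ j)))

top-cell : ∀ T → (∀ j → AllPairs _≤_ (rowAt T j)) → T ≡ replicate (length T) [] ⊎ TopCell T
top-cell []        _ = inj₁ refl
top-cell (row ∷ T) p with top-cell T (p ∘ suc) | initLast row
... | inj₁ eq                          | []        = inj₁ (cong ([] ∷_) eq)
... | inj₁ eq                          | ys ∷ʳ′ y  = inj₂ (0 , y , ys ∷ T , s≤s z≤n , refl , top)
  where
  top : ∀ {j a} → a ∈ rowAt ((ys ∷ʳ y) ∷ T) j → a < y ⊎ (a ≡ y × 0 ≤ j)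
  top {zero}  a∈ with ∈-++⁻ ys a∈
  ... | inj₁ a∈′         = Sum.map₂ (_, z≤n) (m≤n⇒m<n∨m≡n (All.lookup (proj₂ (AllPairs-∷ʳ⁻ ys (p 0))) a∈′))
  ... | inj₂ (here refl) = inj₂ (refl , z≤n)
  top {suc j} {a} a∈ with subst (λ T → a ∈ rowAt T j) eq a∈
  ... | a∈′ rewrite rowAt-empty (length T) j = case a∈′ of λ ()
... | inj₂ (r , x , S , l , eq , top) | []       = inj₂ (suc r , x , [] ∷ S , s≤s l , cong ([] ∷_) eq , top′)
  where
  top′ : ∀ {j a} → a ∈ rowAt ([] ∷ T) j → a < x ⊎ (a ≡ x × suc r ≤ j)
  top′ {suc j} a∈ = Sum.map₂ (map₂ s≤s) (top a∈)
... | inj₂ (r , x , S , l , eq , top) | ys ∷ʳ′ y with ≤-<-connex x y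
... | inj₁ x≤y = inj₂ (0 , y , ys ∷ T , s≤s z≤n , refl , top′)
  where
  top′ : ∀ {j a} → a ∈ rowAt ((ys ∷ʳ y) ∷ T) j → a < y ⊎ (a ≡ y × 0 ≤ j)
  top′ {zero}  a∈ with ∈-++⁻ ys a∈
  ... | inj₁ a∈′         = Sum.map₂ (_, z≤n) (m≤n⇒m<n∨m≡n (All.lookup (proj₂ (AllPairs-∷ʳ⁻ ys (p 0))) a∈′))
  ... | inj₂ (here refl) = inj₂ (refl , z≤n)
  top′ {suc j} a∈ with top a∈
  ... | inj₁ a<x        = inj₁ (<-≤-trans a<x x≤y)
  ... | inj₂ (refl , _) = Sum.map₂ (_, z≤n) (m≤n⇒m<n∨m≡n x≤y)
... | inj₂ y<x = inj₂ (suc r , x , (ys ∷ʳ y) ∷ S , s≤s l , cong ((ys ∷ʳ y) ∷_) eq , top′)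
  where
  top′ : ∀ {j a} → a ∈ rowAt ((ys ∷ʳ y) ∷ T) j → a < x ⊎ (a ≡ x × suc r ≤ j)
  top′ {zero}  a∈ with ∈-++⁻ ys a∈
  ... | inj₁ a∈′         = inj₁ (≤-<-trans (All.lookup (proj₂ (AllPairs-∷ʳ⁻ ys (p 0))) a∈′) y<x)
  ... | inj₂ (here refl) = inj₁ y<x
  top′ {suc j} a∈ = Sum.map₂ (map₂ s≤s) (top a∈)

Semistandard-drop : ∀ {r x} T → r < length T → Semistandard _≤_ (addAt r x T) →
                    (∀ {a} → a ∈ rowAt T (suc r) → a ≤ x) → Semistandard _≤_ T
Semistandard-drop {r} {x} T r< sst top = record { row-pairs = row-pairs′ ; columns = columns′ }
  where
  open Semistandard sst
  row-pairs′ : ∀ j → AllPairs _≤_ (rowAt T j)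
  row-pairs′ j with r ≟ j
  ... | no r≢j   = subst (AllPairs _≤_) (rowAt-addAt-≢ x T r≢j) (row-pairs j)
  ... | yes refl = proj₁ (AllPairs-∷ʳ⁻ (rowAt T r) (subst (AllPairs _≤_) (rowAt-addAt x T r<) (row-pairs r)))
  columns′ : ∀ j → Above (rowAt T j) (rowAt T (suc j))
  columns′ j with r ≟ j | r ≟ suc j
  ... | yes refl | yes r≡1+r = contradiction (sym r≡1+r) 1+n≢n
  ... | yes refl | no r≢1+r  = Above-shrink (rowAt T r)
          (subst₂ Above (rowAt-addAt x T r<) (rowAt-addAt-≢ x T r≢1+r) (columns r)) (All.tabulate top)
  ... | no r≢j   | no r≢1+j  = subst₂ Above (rowAt-addAt-≢ x T r≢j) (rowAt-addAt-≢ x T r≢1+j) (columns j)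
  ... | no r≢j   | yes refl  = Above-∷ʳ⁻ (rowAt T (suc j))
          (subst₂ Above (rowAt-addAt-≢ x T r≢j) (rowAt-addAt x T r<) (columns j))

-- Removing the top cell over and over inverts `fill`. That the row can take this cell is read off
-- from the columns before its removal.
peel : ∀ n T → length (concat T) ≡ n → Semistandard _≤_ T →
       ∃[ β ] (Admissible _≤_ (length T) β × fill (length T) β ≡ T)
peel n T ln sst with top-cell T (Semistandard.row-pairs sst)
... | inj₁ eq = [] , admissible [] [] [] , sym eq
peel zero    _ ln sst | inj₂ (r , x , S , l , refl , top) =
  contradiction (trans (sym ln) (Perm.↭-length (concat-addAt x S l))) λ ()
peel (suc n) _ ln sst | inj₂ (r , x , S , l , refl , top)
  with peel n S (suc-injective (trans (sym (Perm.↭-length (concat-addAt x S l))) ln))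
         (Semistandard-drop S l sst (λ {a} a∈ → case top (subst (a ∈_) (sym (rowAt-addAt-≢ x S (1+n≢n ∘ sym))) a∈) of λ
            { (inj₁ a<x) → <⇒≤ a<x ; (inj₂ (refl , _)) → ≤-refl }))
... | β , admissible b y s , eq = (r , x) ∷ β ,
  subst (λ ℓ → Admissible _≤_ ℓ ((r , x) ∷ β)) (sym (length-addAt r x S))
    (admissible (l ∷ b) (addable r l (Semistandard.columns sst) ∷ y) (All.tabulate later ∷ s)) ,
  trans (cong (λ ℓ → fill ℓ ((r , x) ∷ β)) (length-addAt r x S)) (cong (addAt r x) eq)
  where
  length-β : ∀ j → length (rowAt S j) ≡ count j (rows β)
  length-β j = trans (cong (λ T → length (rowAt T j)) (sym eq)) (length-row β j b)
  in-S : ∀ {j a} → (j , a) ∈ β → a ∈ rowAt S j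
  in-S {j} {a} p = subst (λ T → a ∈ rowAt T j) eq (∈⇒∈-row β b p)
  in-T : ∀ {j a} → a ∈ rowAt S j → a ∈ rowAt (addAt r x S) j
  in-T {j} {a} p with r ≟ j
  ... | no r≢j   = subst (a ∈_) (sym (rowAt-addAt-≢ x S r≢j)) p
  ... | yes refl = subst (a ∈_) (sym (rowAt-addAt x S l)) (∈-++⁺ˡ p)
  later : ∀ {e} → e ∈ β → After _≤_ (r , x) e
  later e∈ with top (in-T (in-S e∈))
  ... | inj₁ a<x        = after (inj₁ a<x) (λ _ → <⇒≤ a<x)
  ... | inj₂ (refl , p) = after (inj₂ (refl , p)) (λ _ → ≤-refl)
  addable : ∀ r → r < length S →
            (∀ j → Above (rowAt (addAt r x S) j) (rowAt (addAt r x S) (suc j))) → Addable r (rows β)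
  addable zero    _ _       = zero
  addable (suc j) l columns = suc (removable (subst₂ _<_ (length-β (suc j)) (length-β j)
    (subst₂ _≤_ (trans (cong length (rowAt-addAt x S l)) (trans (length-++ (rowAt S (suc j))) (+-comm _ 1)))
      (cong length (rowAt-addAt-≢ x S 1+n≢n)) (Above-length (columns j)))))

-- Cells and entries of fillings

∈-zip⁻ : ∀ {A : Set} (f : ℕ → ℕ) (xs : List A) {i a} → (i , a) ∈ zip (applyUpTo f (length xs)) xs →
         ∃[ k ] (i ≡ f k × At xs k a)
∈-zip⁻ f (x ∷ xs) (here refl) = 0 , refl , here
∈-zip⁻ f (x ∷ xs) (there p)   = let k , eq , q = ∈-zip⁻ (f ∘ suc) xs p in suc k , eq , there q

∈-zip⁺ : ∀ {A : Set} (f : ℕ → ℕ) {xs : List A} {k a} → At xs k a → (f k , a) ∈ zip (applyUpTo f (length xs)) xs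
∈-zip⁺ f here      = here refl
∈-zip⁺ f (there p) = there (∈-zip⁺ (f ∘ suc) p)

At⇒rowAt : ∀ {T j row} → At T j row → rowAt T j ≡ row
At⇒rowAt here      = refl
At⇒rowAt (there p) = At⇒rowAt p

rowAt⇒At : ∀ T {j i a} → At (rowAt T j) i a → At T j (rowAt T j)
rowAt⇒At (r ∷ T) {zero}  _ = here
rowAt⇒At (r ∷ T) {suc j} p = there (rowAt⇒At T p)

entry⁺ : ∀ T {j i a} → At (rowAt T j) i a → ((suc i , suc j) , a) ∈ entries T
entry⁺ T {j} p = ∈-concat⁺′ (∈-map⁺ _ (∈-zip⁺ suc p)) (∈-map⁺ _ (∈-zip⁺ suc (rowAt⇒At T p)))

row-entries : ℕ × List ℕ → List (Cell × ℕ)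
row-entries (j , r) = map (λ (i , a) → (i , j) , a) (number r)

row-entry⁻ : ∀ j r {e} → e ∈ row-entries (j , r) → ∃[ i ] ∃[ a ] (e ≡ ((suc i , j) , a) × At r i a)
row-entry⁻ j r e∈ with ∈-map⁻ {A = ℕ × ℕ} (λ (i , a) → (i , j) , a) {xs = number r} e∈
... | (i′ , a) , ia∈ , refl with ∈-zip⁻ suc r ia∈
... | i , refl , q = i , a , refl , q

entry⁻ : ∀ T {e} → e ∈ entries T → ∃[ j ] ∃[ i ] ∃[ a ] (e ≡ ((suc i , suc j) , a) × At (rowAt T j) i a)
entry⁻ T e∈ with ∈-concat⁻′ (map row-entries (number T)) e∈
... | es , e∈es , es∈ with ∈-map⁻ {A = ℕ × List ℕ} row-entries {xs = number T} es∈
... | (j′ , r) , jr∈ , refl with ∈-zip⁻ suc T jr∈ | row-entry⁻ j′ r e∈es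
... | j , refl , p | i , a , refl , q = j , i , a , refl , subst (λ r → At r i a) (sym (At⇒rowAt p)) q

PartitionShaped : Filling → Set
PartitionShaped T = ∀ j → length (rowAt T (suc j)) ≤ length (rowAt T j)

Increasing⇒Semistandard : ∀ {R} T → PartitionShaped T → Increasing R _<_ T → Semistandard R T
Increasing⇒Semistandard {R} T shape inc = record
  { row-pairs = λ j → pairs (rowAt T j) λ p q i<k → proj₁ (at p q) refl (s≤s i<k)
  ; columns   = λ j → above (rowAt T j) (rowAt T (suc j)) (shape j) λ p q → proj₂ (at p q) refl (s≤s ≤-refl) }
  where
  at : ∀ {j i a j′ i′ a′} → At (rowAt T j) i a → At (rowAt T j′) i′ a′ →
       (suc j ≡ suc j′ → suc i < suc i′ → R a a′) × (suc i ≡ suc i′ → suc j < suc j′ → a < a′)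
  at p q = All.lookup (All.lookup inc (entry⁺ T p)) (entry⁺ T q)
  pairs : ∀ xs → (∀ {i k a b} → At xs i a → At xs k b → i < k → R a b) → AllPairs R xs
  pairs []       _ = []
  pairs (x ∷ xs) f = All.tabulate (λ b∈ → let _ , q = ∈⇒At b∈ in f here (there q) (s≤s z≤n)) ∷
                     pairs xs (λ p q l → f (there p) (there q) (s≤s l))
  above : ∀ xs ys → length ys ≤ length xs → (∀ {i a b} → At xs i a → At ys i b → a < b) → Above xs ys
  above xs       []       _       _ = []
  above (x ∷ xs) (y ∷ ys) (s≤s l) f = f here here ∷ above xs ys l (λ p q → f (there p) (there q))

Semistandard⇒Increasing : ∀ {R} T → Semistandard R T → Increasing R _<_ T
Semistandard⇒Increasing {R} T sst = All.tabulate λ e∈ → All.tabulate λ f∈ → at e∈ f∈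
  where
  open Semistandard sst
  pair : ∀ {xs i k a b} → AllPairs R xs → At xs i a → At xs k b → i < k → R a b
  pair (p ∷ _)  here      (there q) _       = All.lookup p (At⇒∈ q)
  pair (_ ∷ ps) (there p) (there q) (s≤s l) = pair ps p q l
  under : ∀ {xs ys i b} → Above xs ys → At ys i b → ∃[ a ] (At xs i a × a < b)
  under (l ∷ _) here      = _ , here , l
  under (_ ∷ p) (there q) = let a , r , l = under p q in a , there r , l
  column< : ∀ {j j′ i a b} → At (rowAt T j) i a → At (rowAt T j′) i b → j <′ j′ → a < b
  column< {j} p q (≤′-reflexive refl) with under (columns j) q
  ... | c , r , c<b = subst (_< _) (At-functional r p) c<b
  column< p q (≤′-step l) with under (columns _) q
  ... | c , r , c<b = <-trans (column< p r l) c<b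
  at : ∀ {e f} → e ∈ entries T → f ∈ entries T →
       (row (proj₁ e) ≡ row (proj₁ f) → column (proj₁ e) < column (proj₁ f) → R (proj₂ e) (proj₂ f)) ×
       (column (proj₁ e) ≡ column (proj₁ f) → row (proj₁ e) < row (proj₁ f) → proj₂ e < proj₂ f)
  at e∈ f∈ with entry⁻ T e∈ | entry⁻ T f∈
  ... | j , i , a , refl , p | j′ , i′ , a′ , refl , q =
    (λ { refl (s≤s l) → pair (row-pairs j) p q l }) , (λ { refl (s≤s l) → column< p q (≤⇒≤′ l) })

Unique-resp-↭ : ∀ {A : Set} {xs ys : List A} → xs ↭ ys → Unique xs → Unique ys
Unique-resp-↭ Perm.refl         u = u
Unique-resp-↭ (Perm.prep x p)   (q ∷ u) = Perm.All-resp-↭ p q ∷ Unique-resp-↭ p u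
Unique-resp-↭ (Perm.swap x y p) ((x≢y ∷ q) ∷ r ∷ u) =
  ((x≢y ∘ sym) ∷ Perm.All-resp-↭ p r) ∷ Perm.All-resp-↭ p q ∷ Unique-resp-↭ p u
Unique-resp-↭ (Perm.trans p q)  u = Unique-resp-↭ q (Unique-resp-↭ p u)

∈-words⁺ : ∀ {A : Set} {as : List A} {k v} → length v ≡ k → All (_∈ as) v → v ∈ words as k
∈-words⁺ refl []       = here refl
∈-words⁺ refl (p ∷ ps) = ∈-cartesianProductWith⁺ _∷_ p (∈-words⁺ refl ps)

∈-words⁻ : ∀ {A : Set} {as : List A} k {v} → v ∈ words as k → length v ≡ k × All (_∈ as) v
∈-words⁻ zero (here refl) = refl , []
∈-words⁻ {as = as} (suc k) v∈ with ∈-cartesianProductWith⁻ _∷_ as (words as k) v∈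
... | _ , _ , a∈ , u∈ , refl = let l , p = ∈-words⁻ k u∈ in cong suc l , a∈ ∷ p

words-unique : ∀ {A : Set} {as : List A} k → Unique as → Unique (words as k)
words-unique zero    u = [] ∷ []
words-unique (suc k) u = Unique.cartesianProductWith⁺ _∷_ ∷-injective u (words-unique k u)

∈-fillings⁺ : ∀ {as} T → All (_∈ as) (concat T) → T ∈ fillings as (map length T)
∈-fillings⁺ []      _ = here refl
∈-fillings⁺ (r ∷ T) p = ∈-cartesianProductWith⁺ _∷_ (∈-words⁺ refl (All.++⁻ˡ r p)) (∈-fillings⁺ T (All.++⁻ʳ r p))

∈-fillings⁻ : ∀ {as} μ {T} → T ∈ fillings as μ → map length T ≡ μ × All (_∈ as) (concat T)
∈-fillings⁻ []      (here refl) = refl , []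
∈-fillings⁻ {as} (r ∷ μ) T∈ with ∈-cartesianProductWith⁻ _∷_ (words as r) (fillings as μ) T∈
... | v , S , v∈ , S∈ , refl =
  let l , p = ∈-words⁻ r v∈ ; eq , q = ∈-fillings⁻ μ S∈ in cong₂ _∷_ l eq , All.++⁺ p q

fillings-unique : ∀ {as} μ → Unique as → Unique (fillings as μ)
fillings-unique []      u = [] ∷ []
fillings-unique (r ∷ μ) u = Unique.cartesianProductWith⁺ _∷_ ∷-injective (words-unique r u) (fillings-unique μ u)

[1‥]-unique : ∀ m → Unique [1‥ m ]
[1‥]-unique m = Unique.applyUpTo⁺₁ suc m λ i<j _ → <⇒≢ i<j ∘ suc-injective

∈-[1‥]⁺ : ∀ {a m} → 1 ≤ a → a ≤ m → a ∈ [1‥ m ]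
∈-[1‥]⁺ {suc a} _ a<m = ∈-applyUpTo⁺ suc a<m

∈-[1‥]⁻ : ∀ {a m} → a ∈ [1‥ m ] → 1 ≤ a × a ≤ m
∈-[1‥]⁻ a∈ with ∈-applyUpTo⁻ suc a∈
... | _ , i<m , refl = s≤s z≤n , i<m

-- Shapes, and tableaux as words

part : List ℕ → ℕ → ℕ
part []      _       = 0
part (r ∷ μ) zero    = r
part (r ∷ μ) (suc j) = part μ j

length-rowAt : ∀ T j → length (rowAt T j) ≡ part (map length T) j
length-rowAt []      j       = refl
length-rowAt (r ∷ T) zero    = refl
length-rowAt (r ∷ T) (suc j) = length-rowAt T j

part-ext : ∀ {μ ν} → length μ ≡ length ν → (∀ j → part μ j ≡ part ν j) → μ ≡ ν
part-ext {[]}    {[]}    _ _  = refl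
part-ext {r ∷ μ} {s ∷ ν} l eq = cong₂ _∷_ (eq 0) (part-ext (suc-injective l) (eq ∘ suc))

part-antitone : ∀ {μ} → Linked _≥_ μ → ∀ j → part μ (suc j) ≤ part μ j
part-antitone []      j       = z≤n
part-antitone [-]     zero    = z≤n
part-antitone [-]     (suc j) = z≤n
part-antitone (p ∷ l) zero    = p
part-antitone (p ∷ l) (suc j) = part-antitone l j

part-bound : ∀ μ {j} → 0 < part μ j → j < length μ
part-bound (r ∷ μ) {zero}  _ = s≤s z≤n
part-bound (r ∷ μ) {suc j} p = s≤s (part-bound μ p)

record Shape (μ : List ℕ) (w : Word) : Set where
  constructor shape
  field row-lengths : ∀ j → count j w ≡ part μ j

open Shape

count-∈ : ∀ {r w} → r ∈ w → 0 < count r w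
count-∈ {r} {_ ∷ w} (here refl) = ≤-trans (s≤s z≤n) (≤-reflexive (sym (count-here r w)))
count-∈ {r} {x ∷ w} (there p)   = ≤-trans (count-∈ p) (count-≤ r x w)

Shape-bounded : ∀ {μ} β → Shape μ (rows β) → Bounded (length μ) β
Shape-bounded {μ} β (shape eq) = All.tabulate λ e∈ →
  part-bound μ (subst (0 <_) (eq _) (count-∈ (∈-map⁺ proj₁ e∈)))

map-length-fill : ∀ {μ} β → Shape μ (rows β) → map length (fill (length μ) β) ≡ μ
map-length-fill {μ} β sh = part-ext (trans (length-map length (fill (length μ) β)) (length-fill (length μ) β))
  λ j → trans (sym (length-rowAt (fill (length μ) β) j))
          (trans (length-row β j (Shape-bounded β sh)) (row-lengths sh j))

fill-∈-fillings : ∀ {as μ} β → Shape μ (rows β) → All (_∈ as) (map proj₂ β) → fill (length μ) β ∈ fillings as μ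
fill-∈-fillings {as} {μ} β sh p = subst (λ ν → fill (length μ) β ∈ fillings as ν) (map-length-fill β sh)
  (∈-fillings⁺ (fill (length μ) β) (Perm.All-resp-↭ (↭-sym (concat-fill β (Shape-bounded β sh))) p))

length-concat : ∀ (T : Filling) → length (concat T) ≡ sum (map length T)
length-concat []      = refl
length-concat (r ∷ T) = trans (length-++ r) (cong (length r +_) (length-concat T))

record Decomposition (n : ℕ) (μ : List ℕ) (as : List ℕ) (T : Filling) : Set where
  field
    word     : Biword
    valid    : Admissible _≤_ (length μ) word
    shaped   : Shape μ (rows word)
    size≡    : length word ≡ n
    values   : All (_∈ as) (map proj₂ word)
    filled   : fill (length μ) word ≡ T

decompose : ∀ {R n μ as T} → (∀ {a b} → R a b → a ≤ b) → IsPartition n μ → T ∈ fillings as μ →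
            Increasing R _<_ T → Decomposition n μ as T
decompose {R} {n} {μ} {as} {T} R⇒≤ (linked , _ , total) T∈ inc with ∈-fillings⁻ μ T∈
... | refl , T⊆as
  with peel n T (trans (length-concat T) total) (Increasing⇒Semistandard T
         (λ j → subst₂ _≤_ (sym (length-rowAt T (suc j))) (sym (length-rowAt T j)) (part-antitone linked j))
         (All.map (All.map λ (f , g) → (λ e l → R⇒≤ (f e l)) , g) inc))
... | β , adm , eq = record
  { word   = β
  ; valid  = subst (λ ℓ → Admissible _≤_ ℓ β) (sym (length-map length T)) adm
  ; shaped = shape λ j → trans (sym (length-row β j bounded)) (trans (cong (λ S → length (rowAt S j)) eq) (length-rowAt T j))
  ; size≡  = trans (sym (fill-length β bounded)) (trans (cong (length ∘ concat) eq) (trans (length-concat T) total))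
  ; values = Perm.All-resp-↭ (concat-fill β bounded) (subst (All (_∈ as) ∘ concat) (sym eq) T⊆as)
  ; filled = trans (cong (λ ℓ → fill ℓ β) (length-map length T)) eq
  }
  where open Admissible adm

∈-SSYT⁺ : ∀ {m μ} β → Admissible _≤_ (length μ) β → Shape μ (rows β) → All (_∈ [1‥ m ]) (map proj₂ β) →
          fill (length μ) β ∈ SSYT m μ
∈-SSYT⁺ {m} {μ} β adm sh p = ∈-filter⁺ (increasing? _≤?_ _<?_) (fill-∈-fillings β sh p)
  (Semistandard⇒Increasing (fill (length μ) β) (fill-semistandard adm))

∈-SSYT⁻ : ∀ {n m μ T} → IsPartition n μ → T ∈ SSYT m μ → Decomposition n μ [1‥ m ] T
∈-SSYT⁻ {m = m} {μ} part T∈ =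
  let T∈f , inc = ∈-filter⁻ (increasing? _≤?_ _<?_) {xs = fillings [1‥ m ] μ} T∈
  in decompose id part T∈f inc

label : Word → Biword
label []      = []
label (r ∷ w) = (r , suc (length w)) ∷ label w

rows-label : ∀ w → rows (label w) ≡ w
rows-label []      = refl
rows-label (r ∷ w) = cong (r ∷_) (rows-label w)

label-bound : ∀ w → All (λ e → 1 ≤ proj₂ e × proj₂ e ≤ length w) (label w)
label-bound []      = []
label-bound (r ∷ w) = (s≤s z≤n , ≤-refl) ∷ All.map (map₂ m≤n⇒m≤1+n) (label-bound w)

label-admissible : ∀ {μ w} → Yam w → Shape μ w → Admissible _<_ (length μ) (label w)
label-admissible {μ} {w} y sh = admissible (Shape-bounded (label w) (subst (Shape μ) (sym (rows-label w)) sh))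
  (subst Yam (sym (rows-label w)) y) (sorted w)
  where
  sorted : ∀ w → AllPairs (After _<_) (label w)
  sorted []      = []
  sorted (r ∷ w) = All.map (λ (_ , l) → after (inj₁ (s≤s l)) (λ _ → s≤s l)) (label-bound w) ∷ sorted w

tab : List ℕ → Word → Filling
tab μ w = fill (length μ) (label w)

label-values : ∀ w → Unique (map proj₂ (label w))
label-values []      = []
label-values (r ∷ w) = All.map⁺ (All.map (λ (_ , l) eq → <⇒≢ (s≤s l) (sym eq)) (label-bound w)) ∷ label-values w

∈-label : ∀ w {a} → 1 ≤ a → a ≤ length w → a ∈ map proj₂ (label w)
∈-label [] (s≤s _) ()
∈-label (r ∷ w) 1≤a a≤ with m≤n⇒m<n∨m≡n a≤
... | inj₁ (s≤s a≤w) = there (∈-label w 1≤a a≤w)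
... | inj₂ refl      = here refl

∈-SYT⁺ : ∀ {n μ w} → Yam w → Shape μ w → length w ≡ n → tab μ w ∈ SYT n μ
∈-SYT⁺ {n} {μ} {w} y sh refl = ∈-filter⁺ (isStandard? n)
  (fill-∈-fillings (label w) sh′ (All.map⁺ (All.map (λ (l , u) → ∈-[1‥]⁺ l u) (label-bound w))))
  ( Unique-resp-↭ (↭-sym perm) (label-values w)
  , All.tabulate (λ a∈ → let l , u = ∈-[1‥]⁻ a∈ in Perm.∈-resp-↭ (↭-sym perm) (∈-label w l u))
  , Semistandard⇒Increasing (tab μ w) (fill-semistandard (label-admissible y sh)) )
  where
  sh′ = subst (Shape μ) (sym (rows-label w)) sh
  perm = concat-fill (label w) (Shape-bounded (label w) sh′)

-- Values that strictly decrease inside {1, ..., n}, `n` in number, leave no choice.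
standard-values : ∀ n β → length β ≡ n → AllPairs (λ e f → proj₂ f < proj₂ e) β →
                  All (λ e → 1 ≤ proj₂ e × proj₂ e ≤ n) β → β ≡ label (rows β)
standard-values zero    []            _ _ _ = refl
standard-values (suc n) ((r , x) ∷ β) l (p ∷ ps) ((1≤x , x≤n) ∷ bs)
  with standard-values n β (suc-injective l) ps
         (All.zipWith (λ (q , b , _) → b , s≤s⁻¹ (≤-trans q x≤n)) (p , bs))
... | eq = cong₂ (λ y γ → (r , y) ∷ γ) (trans (head≡ n (suc-injective l) x≤n 1≤x eq p) (cong suc (sym length-rows))) eq
  where
  length-rows : length (rows β) ≡ n
  length-rows = trans (length-map proj₁ β) (suc-injective l)
  head≡ : ∀ {β} n → length β ≡ n → x ≤ suc n → 1 ≤ x → β ≡ label (rows β) → All (λ f → proj₂ f < x) β → x ≡ suc n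
  head≡ {[]}    zero    _ x≤1 1≤x _  _       = ≤-antisym x≤1 1≤x
  head≡ {_ ∷ β} (suc n) l x≤n _   eq (q ∷ _) = ≤-antisym x≤n
    (subst (_< x) (trans (cong proj₂ (∷-injectiveˡ eq)) (trans (cong suc (length-map proj₁ β)) l)) q)

∈-SYT⁻ : ∀ {n μ T} → IsPartition n μ → T ∈ SYT n μ →
         ∃[ w ] (Yam w × Shape μ w × length w ≡ n × tab μ w ≡ T)
∈-SYT⁻ {n} {μ} {T} part T∈ with ∈-filter⁻ (isStandard? n) {xs = fillings [1‥ n ] μ} T∈
... | T∈f , unique , _ , inc with decompose <⇒≤ part T∈f inc
... | d = rows word , lattice , shaped , trans (length-map proj₁ word) size≡ ,
      trans (cong (fill (length μ)) (sym β≡)) filled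
  where
  open Decomposition d
  open Admissible valid
  distinct : AllPairs (λ e f → proj₂ e ≢ proj₂ f) word
  distinct = AllPairs.map⁻ (Unique-resp-↭ (concat-fill word bounded) (subst (Unique ∘ concat) (sym filled) unique))
  strict : AllPairs (λ e f → proj₂ f < proj₂ e) word
  strict = AllPairs.zipWith (λ (a , ne) → case After.order a of λ
    { (inj₁ l) → l ; (inj₂ (eq , _)) → contradiction (sym eq) ne }) (sorted , distinct)
  β≡ : word ≡ label (rows word)
  β≡ = standard-values n word size≡ strict (All.map ∈-[1‥]⁻ (All.map⁻ values))

-- Content reading words

At-∷ʳ⁺ : ∀ {A : Set} {xs : List A} {i a} x → At xs i a → At (xs ∷ʳ x) i a
At-∷ʳ⁺ x here      = here
At-∷ʳ⁺ x (there p) = there (At-∷ʳ⁺ x p)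

At-last : ∀ {A : Set} (xs : List A) {x} → At (xs ∷ʳ x) (length xs) x
At-last []       = here
At-last (_ ∷ xs) = there (At-last xs)

At-∷ʳ⁻ : ∀ {A : Set} (xs : List A) {x i a} → At (xs ∷ʳ x) i a → At xs i a ⊎ (i ≡ length xs × a ≡ x)
At-∷ʳ⁻ []       here      = inj₂ (refl , refl)
At-∷ʳ⁻ (_ ∷ xs) here      = inj₁ here
At-∷ʳ⁻ (_ ∷ xs) (there p) = Sum.map there (λ (e , f) → cong suc e , f) (At-∷ʳ⁻ xs p)

-- The column of a letter is one more than the number of smaller letters in its row; both
-- coordinates start at 1, as in `entries`.
cells : Word → List (Cell × ℕ)
cells []      = []
cells (r ∷ w) = ((suc (count r w) , suc r) , suc (length w)) ∷ cells w

label-bounded : ∀ {ℓ} w → All (_< ℓ) w → Bounded ℓ (label w)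
label-bounded []      []       = []
label-bounded (r ∷ w) (p ∷ ps) = p ∷ label-bounded w ps

length-row-label : ∀ {ℓ w} j → All (_< ℓ) w → length (rowAt (fill ℓ (label w)) j) ≡ count j w
length-row-label {ℓ} {w} j b = trans (length-row (label w) j (label-bounded w b)) (cong (count j) (rows-label w))

At⇒cells : ∀ {ℓ} w {j i a} → All (_< ℓ) w → At (rowAt (fill ℓ (label w)) j) i a → ((suc i , suc j) , a) ∈ cells w
At⇒cells {ℓ} [] {j} _ p rewrite rowAt-empty ℓ j = case p of λ ()
At⇒cells {ℓ} (r ∷ w) {j} {i} {a} (r<ℓ ∷ b) p with r ≟ j
... | no r≢j   = there (At⇒cells w b (subst (λ v → At v i a) (rowAt-addAt-≢ _ (fill ℓ (label w)) r≢j) p))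
... | yes refl with At-∷ʳ⁻ (rowAt (fill ℓ (label w)) r) (subst (λ v → At v i a) (rowAt-head _ (label w) r<ℓ) p)
... | inj₁ q              = there (At⇒cells w b q)
... | inj₂ (refl , refl) = here (cong (λ k → (suc k , suc r) , suc (length w)) (length-row-label r b))

cells⇒At : ∀ {ℓ} w {e} → All (_< ℓ) w → e ∈ cells w →
           ∃[ j ] ∃[ i ] ∃[ a ] (e ≡ ((suc i , suc j) , a) × At (rowAt (fill ℓ (label w)) j) i a)
cells⇒At {ℓ} (r ∷ w) (r<ℓ ∷ b) (here refl) = r , count r w , suc (length w) , refl ,
  subst₂ (λ v i → At v i (suc (length w))) (sym (rowAt-head _ (label w) r<ℓ)) (length-row-label r b)
    (At-last (rowAt (fill ℓ (label w)) r))
cells⇒At {ℓ} (r ∷ w) (r<ℓ ∷ b) (there e∈) with cells⇒At w b e∈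
... | j , i , a , eq , p with r ≟ j
... | no r≢j   = j , i , a , eq , subst (λ v → At v i a) (sym (rowAt-addAt-≢ _ (fill ℓ (label w)) r≢j)) p
... | yes refl = j , i , a , eq , subst (λ v → At v i a) (sym (rowAt-head _ (label w) r<ℓ)) (At-∷ʳ⁺ _ p)

Shape-letters : ∀ {μ w} → Shape μ w → All (_< length μ) w
Shape-letters {μ} (shape eq) = All.tabulate λ r∈ → part-bound μ (subst (0 <_) (eq _) (count-∈ r∈))

entries-tab⁻ : ∀ {μ w e} → Shape μ w → e ∈ entries (tab μ w) → e ∈ cells w
entries-tab⁻ {μ} {w} sh e∈ with entry⁻ (tab μ w) e∈
... | j , i , a , refl , p = At⇒cells w (Shape-letters sh) p

entries-tab⁺ : ∀ {μ w e} → Shape μ w → e ∈ cells w → e ∈ entries (tab μ w)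
entries-tab⁺ {μ} {w} sh e∈ with cells⇒At w (Shape-letters sh) e∈
... | j , i , a , refl , p = entry⁺ (tab μ w) p

cells-bound : ∀ {w} → Yam w → All (λ ((c , r) , a) → 1 ≤ c × c ≤ length w × 1 ≤ r × r ≤ length w) (cells w)
cells-bound [] = []
cells-bound yw@(_∷_ {r} {w} _ y) = (s≤s z≤n , s≤s (count≤length w) , s≤s z≤n , s≤s (head-bound yw)) ∷
  All.map (λ (a , b , c , d) → a , m≤n⇒m≤1+n b , c , m≤n⇒m≤1+n d) (cells-bound y)
  where
  count≤length : ∀ w → count r w ≤ length w
  count≤length []      = z≤n
  count≤length (x ∷ w) with r ≟ x
  ... | yes refl = ≤-trans (≤-reflexive (count-here r w)) (s≤s (count≤length w))
  ... | no r≢x   = ≤-trans (≤-reflexive (count-there w r≢x)) (m≤n⇒m≤1+n (count≤length w))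

cells-values : ∀ w → map proj₂ (cells w) ≡ map proj₂ (label w)
cells-values []      = refl
cells-values (r ∷ w) = cong (suc (length w) ∷_) (cells-values w)

infix 4 _≺_

data _≺_ (c d : Cell) : Set where
  earlier : content c ℤ.< content d → c ≺ d
  aligned : content c ≡ content d → row c < row d → c ≺ d

≺-asym : ∀ {c d} → c ≺ d → ¬ d ≺ c
≺-asym (earlier p)    (earlier q)    = ℤ.<-asym p q
≺-asym (earlier p)    (aligned eq _) = ℤ.<-irrefl (sym eq) p
≺-asym (aligned eq _) (earlier q)    = ℤ.<-irrefl (sym eq) q
≺-asym (aligned _ p)  (aligned _ q)  = <-asym p q

content-⊖ : ∀ c → content c ≡ column c ℤ.⊖ row c
content-⊖ (i , j) = ℤ.m-n≡m⊖n i j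

≺-intro : ∀ {c d} → column c + row d < column d + row c → c ≺ d
≺-intro {c@(i , j)} {d@(k , l)} p = earlier (subst₂ ℤ._<_
  (trans (cong₂ ℤ._⊖_ (+-comm i l) (+-comm j l)) (trans (ℤ.+-cancelˡ-⊖ l i j) (sym (content-⊖ c))))
  (trans (cong (ℤ._⊖ (j + l)) (+-comm k j)) (trans (ℤ.+-cancelˡ-⊖ j k l) (sym (content-⊖ d))))
  (ℤ.⊖-monoˡ-< (j + l) p))

diagonals : ℕ → List ℤ
diagonals n = map (λ d → ℤ.+ d ℤ.- ℤ.+ n) (upTo (suc (n + n)))

on-diagonal : List (Cell × ℕ) → ℤ → List (Cell × ℕ)
on-diagonal es k = filter (λ (c , _) → content c ℤ.≟ k) es

-- The reading word before its cells are forgotten, so that positions of letters can be derived from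
-- the order of cells.
sortedEntries : ℕ → Filling → List (Cell × ℕ)
sortedEntries n T = concatMap (on-diagonal (entries T)) (diagonals n)

contentWord-sorted : ∀ n T → contentWord n T ≡ map proj₂ (sortedEntries n T)
contentWord-sorted n T = sym (map-concatMap proj₂ (on-diagonal (entries T)) (diagonals n))

∈-sorted⁻ : ∀ n T {e} → e ∈ sortedEntries n T → e ∈ entries T
∈-sorted⁻ n T e∈ with ∈-concat⁻′ (map (on-diagonal (entries T)) (diagonals n)) e∈
... | es , e∈es , es∈ with ∈-map⁻ (on-diagonal (entries T)) es∈
... | k , _ , refl = proj₁ (∈-filter⁻ (λ (c , _) → content c ℤ.≟ k) {xs = entries T} e∈es)

∈-sorted⁺ : ∀ n T {c a} → (c , a) ∈ entries T → column c ≤ n → row c ≤ n → (c , a) ∈ sortedEntries n T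
∈-sorted⁺ n T {c@(i , j)} e∈ i≤n j≤n = ∈-concat⁺′
  (∈-filter⁺ (λ (d , _) → content d ℤ.≟ content c) e∈ refl)
  (∈-map⁺ (on-diagonal (entries T)) (subst (_∈ diagonals n) eq
    (∈-map⁺ (λ d → ℤ.+ d ℤ.- ℤ.+ n) (∈-upTo⁺ (s≤s (≤-trans (m∸n≤m (n + i) j) (+-monoʳ-≤ n i≤n)))))))
  where
  open ≡-Reasoning
  d = n + i ∸ j
  eq : ℤ.+ d ℤ.- ℤ.+ n ≡ content c
  eq = begin
    ℤ.+ d ℤ.- ℤ.+ n         ≡⟨ ℤ.m-n≡m⊖n d n ⟩
    d ℤ.⊖ n                 ≡⟨ ℤ.+-cancelˡ-⊖ j d n ⟨
    (j + d) ℤ.⊖ (j + n)     ≡⟨ cong₂ ℤ._⊖_ (m+[n∸m]≡n (≤-trans j≤n (m≤m+n n i))) (+-comm j n) ⟩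
    (n + i) ℤ.⊖ (n + j)     ≡⟨ ℤ.+-cancelˡ-⊖ n i j ⟩
    i ℤ.⊖ j                 ≡⟨ content-⊖ c ⟨
    content c               ∎

-- On a fixed diagonal this order runs from southwest to northeast, which is how the reading word
-- breaks ties.
entries-row-major : ∀ T → AllPairs (λ (c , _) (d , _) → row c < row d ⊎ (row c ≡ row d × column c < column d)) (entries T)
entries-row-major T = go suc T (λ {i} → s≤s)
  where
  Major : Rel (Cell × ℕ) 0ℓ
  Major (c , _) (d , _) = row c < row d ⊎ (row c ≡ row d × column c < column d)
  cols : ∀ (f : ℕ → ℕ) (r : List ℕ) → (∀ {i k} → i < k → f i < f k) →
         AllPairs (λ e e′ → proj₁ e < proj₁ e′) (zip (applyUpTo f (length r)) r)
  cols f []      _ = []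
  cols f (x ∷ r) m = All.tabulate (λ e∈ → let k , eq , _ = ∈-zip⁻ (f ∘ suc) r e∈ in
    subst (f 0 <_) (sym eq) (m (s≤s z≤n))) ∷ cols (f ∘ suc) r (m ∘ s≤s)
  go : ∀ (f : ℕ → ℕ) T → (∀ {i k} → i < k → f i < f k) →
       AllPairs Major (concatMap row-entries (zip (applyUpTo f (length T)) T))
  go f []      _ = []
  go f (r ∷ T) m = AllPairs.++⁺
    (AllPairs.map⁺ (AllPairs.map (λ l → inj₂ (refl , l)) (cols suc r s≤s)))
    (go (f ∘ suc) T (m ∘ s≤s))
    (All.tabulate λ e∈ → All.tabulate λ e′∈ → across e∈ e′∈)
    where
    across : ∀ {e e′} → e ∈ row-entries (f 0 , r) →
             e′ ∈ concatMap row-entries (zip (applyUpTo (f ∘ suc) (length T)) T) → Major e e′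
    across e∈ e′∈ with row-entry⁻ (f 0) r e∈ | ∈-concat⁻′ (map row-entries (zip (applyUpTo (f ∘ suc) (length T)) T)) e′∈
    ... | i , a , refl , _ | es , e′∈es , es∈ with ∈-map⁻ {A = ℕ × List ℕ} row-entries es∈
    ... | (j , r′) , jr∈ , refl with ∈-zip⁻ (f ∘ suc) T jr∈ | row-entry⁻ j r′ e′∈es
    ... | k , refl , _ | i′ , a′ , refl , _ = inj₁ (m (s≤s z≤n))

sortedEntries-sorted : ∀ n T → AllPairs (λ e f → proj₁ e ≺ proj₁ f) (sortedEntries n T)
sortedEntries-sorted n T = AllPairs.concat⁺
  (All.map⁺ (All.tabulate λ {k} _ → along k))
  (AllPairs.map⁺ (AllPairs.map across (AllPairs.map⁺ (AllPairs.applyUpTo⁺₁ id (suc (n + n)) λ {i} {j} i<j _ →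
    ℤ.+-monoˡ-< (ℤ.- ℤ.+ n) (ℤ.+<+ i<j)))))
  where
  P? = λ (k : ℤ) (e : Cell × ℕ) → content (proj₁ e) ℤ.≟ k
  along : ∀ k → AllPairs (λ e f → proj₁ e ≺ proj₁ f) (on-diagonal (entries T) k)
  along k = refine (AllPairs.filter⁺ (P? k) (entries-row-major T)) (All.all-filter (P? k) (entries T))
    where
    refine : ∀ {es} → AllPairs (λ (c , _) (d , _) → row c < row d ⊎ (row c ≡ row d × column c < column d)) es →
             All (λ e → content (proj₁ e) ≡ k) es → AllPairs (λ e f → proj₁ e ≺ proj₁ f) es
    refine []       []       = []
    refine (p ∷ ps) (q ∷ qs) = All.zipWith (λ
      { (inj₁ l , eq)          → aligned (trans q (sym eq)) l
      ; (inj₂ (refl , l) , eq) → ≺-intro (+-monoˡ-< _ l) }) (p , qs) ∷ refine ps qs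
  across : ∀ {k l} → k ℤ.< l → All (λ e → All (λ f → proj₁ e ≺ proj₁ f) (on-diagonal (entries T) l)) (on-diagonal (entries T) k)
  across {k} {l} k<l = All.map (λ eq → All.map (λ eq′ → earlier (subst₂ ℤ._<_ (sym eq) (sym eq′) k<l))
    (All.all-filter (P? l) (entries T))) (All.all-filter (P? k) (entries T))

sorted-unique : ∀ {A : Set} {R : Rel A 0ℓ} → (∀ {x y} → R x y → ¬ R y x) → ∀ {xs ys} →
                AllPairs R xs → AllPairs R ys → (∀ {x} → x ∈ xs → x ∈ ys) → (∀ {x} → x ∈ ys → x ∈ xs) → xs ≡ ys
sorted-unique asym {[]}    {[]}    _ _ _ _ = refl
sorted-unique asym {[]}    {y ∷ _} _ _ _ g = case g (here refl) of λ ()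
sorted-unique asym {x ∷ _} {[]}    _ _ f _ = case f (here refl) of λ ()
sorted-unique {R = R} asym {x ∷ xs} {y ∷ ys} (p ∷ ps) (q ∷ qs) f g with heads (f (here refl)) (g (here refl))
  where
  heads : x ∈ y ∷ ys → y ∈ x ∷ xs → x ≡ y
  heads (here eq)  _          = eq
  heads (there _)  (here eq)  = sym eq
  heads (there x∈) (there y∈) = contradiction (All.lookup q x∈) (asym (All.lookup p y∈))
... | refl = cong (x ∷_) (sorted-unique asym ps qs (λ z∈ → tail p (f (there z∈)) z∈) (λ z∈ → tail q (g (there z∈)) z∈))
  where
  tail : ∀ {z us vs} → All (R x) us → z ∈ x ∷ vs → z ∈ us → z ∈ vs
  tail r (here refl) z∈ = contradiction (All.lookup r z∈) (asym (All.lookup r z∈))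
  tail r (there z∈′) _  = z∈′

AllPairs-map∈ : ∀ {A : Set} {R Q : Rel A 0ℓ} {xs} → (∀ {x y} → x ∈ xs → y ∈ xs → R x y → Q x y) →
                AllPairs R xs → AllPairs Q xs
AllPairs-map∈ f []       = []
AllPairs-map∈ f (p ∷ ps) = All.tabulate (λ y∈ → f (here refl) (there y∈) (All.lookup p y∈)) ∷
                           AllPairs-map∈ (λ x∈ y∈ → f (there x∈) (there y∈)) ps

Unique-map⇒injective : ∀ {A B : Set} {f : A → B} {xs x y} → Unique (map f xs) → x ∈ xs → y ∈ xs → f x ≡ f y → x ≡ y
Unique-map⇒injective (_ ∷ u) (here refl) (here refl) _  = refl
Unique-map⇒injective (p ∷ u) (here refl) (there y∈)  eq = contradiction eq (All.lookup p (∈-map⁺ _ y∈))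
Unique-map⇒injective (p ∷ u) (there x∈)  (here refl) eq = contradiction (sym eq) (All.lookup p (∈-map⁺ _ x∈))
Unique-map⇒injective (_ ∷ u) (there x∈)  (there y∈)  eq = Unique-map⇒injective u x∈ y∈ eq

position-here : ∀ a w → position (a ∷ w) a ≡ 0
position-here a w rewrite dec-true (a ≟ a) refl = refl

position-there : ∀ {x a} w → x ≢ a → position (x ∷ w) a ≡ suc (position w a)
position-there {x} {a} w x≢a rewrite dec-false (x ≟ a) x≢a = refl

position-≺ : ∀ {S c d a b} → AllPairs (λ e f → proj₁ e ≺ proj₁ f) S → Unique (map proj₂ S) →
             (c , a) ∈ S → (d , b) ∈ S → c ≺ d → position (map proj₂ S) a < position (map proj₂ S) b
position-≺ _ _ (here refl) (here refl) c≺c = contradiction c≺c (≺-asym c≺c)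
position-≺ {_ ∷ S} {a = a} _ (q ∷ _) (here refl) (there d∈) _ =
  subst₂ _<_ (sym (position-here a (map proj₂ S))) (sym (position-there (map proj₂ S) (All.lookup q (∈-map⁺ proj₂ d∈)))) (s≤s z≤n)
position-≺ (p ∷ _) _ (there c∈) (here refl) c≺d = contradiction c≺d (≺-asym (All.lookup p c∈))
position-≺ {_ ∷ S} (_ ∷ ps) (q ∷ u) (there c∈) (there d∈) c≺d =
  subst₂ _<_ (sym (position-there (map proj₂ S) (All.lookup q (∈-map⁺ proj₂ c∈))))
             (sym (position-there (map proj₂ S) (All.lookup q (∈-map⁺ proj₂ d∈))))
             (s≤s (position-≺ ps u c∈ d∈ c≺d))

position-sorted : ∀ {u} → Unique u → AllPairs (λ a b → position u a < position u b) u
position-sorted {[]}    []      = []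
position-sorted {x ∷ u} (p ∷ q) =
  All.map (λ x≢b → subst₂ _<_ (sym (position-here x u)) (sym (position-there u x≢b)) (s≤s z≤n)) p ∷
  AllPairs-map∈ (λ a∈ b∈ l → subst₂ _<_ (sym (position-there u (All.lookup p a∈)))
                                        (sym (position-there u (All.lookup p b∈))) (s≤s l)) (position-sorted q)

right-of : ∀ {c₁ c₂ p r} → r ≤ p → c₁ ≤ c₂ → (r ≡ p → c₁ < c₂) → (suc c₁ , suc p) ≺ (suc c₂ , suc r)
right-of r≤p c≤ f with m≤n⇒m<n∨m≡n r≤p
... | inj₁ r<p  = ≺-intro (+-mono-≤-< (s≤s c≤) (s≤s r<p))
... | inj₂ refl = ≺-intro (+-monoˡ-< _ (s≤s (f refl)))

left-of : ∀ {c₁ c₂ p r} → c₂ + p < c₁ + r → (suc c₂ , suc r) ≺ (suc c₁ , suc p)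
left-of {c₁} {c₂} {p} {r} l = ≺-intro (s≤s (subst₂ _<_ (sym (+-suc c₂ p)) (sym (+-suc c₁ r)) (s≤s l)))

-- Lower rows are at least as long, so a later letter in a weakly lower row lies in a column at
-- least as far right, strictly so within one row.
cell-right : ∀ {r p s} (mid : Word) → Yam s → r ≤ p →
             (suc (count p s) , suc p) ≺ (suc (count r (mid ++ p ∷ s)) , suc r)
cell-right {r} {p} {s} mid y r≤p = right-of r≤p
  (≤-trans (count-antitone y r≤p) (≤-trans (count-≤ r p s) (skip mid)))
  (λ { refl → ≤-trans (≤-reflexive (sym (count-here r s))) (skip mid) })
  where
  skip : ∀ (mid : Word) → count r (p ∷ s) ≤ count r (mid ++ p ∷ s)
  skip []        = ≤-refl
  skip (x ∷ mid) = ≤-trans (skip mid) (count-≤ r x (mid ++ p ∷ s))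

cell-left₁ : ∀ {r p s} → Yam s → p < r → (suc (count r (p ∷ s)) , suc r) ≺ (suc (count p s) , suc p)
cell-left₁ {r} {p} {s} y p<r = left-of (+-mono-≤-<
  (≤-trans (≤-reflexive (count-there s (<⇒≢ p<r ∘ sym))) (count-antitone y (<⇒≤ p<r))) p<r)

-- Rows decide the reading order only for letters that are close. With one letter in between, row
-- `r` may have grown before the later letter arrives; in the tight case `r = p + 1` the addability
-- of that later letter provides the missing inequality.
cell-left₂ : ∀ {r q p s} → Yam (r ∷ q ∷ p ∷ s) → p < r →
             (suc (count r (q ∷ p ∷ s)) , suc r) ≺ (suc (count p s) , suc p)
cell-left₂ {r} {q} {p} {s} (a ∷ _ ∷ _ ∷ y) p<r with r ≟ q
... | no r≢q = left-of (+-mono-≤-< (≤-trans (≤-reflexive (trans (count-there (p ∷ s) r≢q)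
        (count-there s (<⇒≢ p<r ∘ sym)))) (count-antitone y (<⇒≤ p<r))) p<r)
... | yes refl = left-of (subst (λ k → k + p < count p s + r) (sym counted) (close a))
  where
  counted : count r (r ∷ p ∷ s) ≡ suc (count r s)
  counted = trans (count-here r (p ∷ s)) (cong suc (count-there s (<⇒≢ p<r ∘ sym)))
  close : Addable r (r ∷ p ∷ s) → suc (count r s + p) < count p s + r
  close (suc {r′} (removable l)) with m≤n⇒m<n∨m≡n p<r
  ... | inj₁ 1+p<r = subst (_< count p s + r) (+-suc _ p) (+-mono-≤-< (count-antitone y (<⇒≤ p<r)) 1+p<r)
  ... | inj₂ refl  = subst (_≤ count p s + r) (cong suc (+-suc _ p)) (+-monoˡ-≤ r (s≤s⁻¹ (subst₂ _<_
          counted (trans (count-there (p ∷ s) (1+n≢n ∘ sym)) (count-here p s)) l)))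

cells-suffix : ∀ pre {u e} → e ∈ cells u → e ∈ cells (pre ++ u)
cells-suffix []        e∈ = e∈
cells-suffix (_ ∷ pre) e∈ = there (cells-suffix pre e∈)

record Standard (n : ℕ) (μ : List ℕ) (w : Word) : Set where
  constructor standard
  field
    is-yam   : Yam w
    is-shape : Shape μ w
    has-size : length w ≡ n

module Reading {n μ w} (st : Standard n μ w) where

  open Standard st

  sorted : List (Cell × ℕ)
  sorted = sortedEntries n (tab μ w)

  reading : List ℕ
  reading = contentWord n (tab μ w)

  ∈-sorted⇒cells : ∀ {e} → e ∈ sorted → e ∈ cells w
  ∈-sorted⇒cells e∈ = entries-tab⁻ is-shape (∈-sorted⁻ n (tab μ w) e∈)

  cells⇒∈-sorted : ∀ {e} → e ∈ cells w → e ∈ sorted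
  cells⇒∈-sorted e∈ with All.lookup (cells-bound is-yam) e∈
  ... | _ , c≤ , _ , r≤ = ∈-sorted⁺ n (tab μ w) (entries-tab⁺ is-shape e∈)
          (subst (_ ≤_) has-size c≤) (subst (_ ≤_) has-size r≤)

  sorted-values : Unique (map proj₂ sorted)
  sorted-values = AllPairs.map⁺ (AllPairs-map∈ (λ { {x} {y} x∈ y∈ x≺y eq → contradiction x≺y
    (subst (λ z → ¬ proj₁ x ≺ proj₁ z) (Unique-map⇒injective {f = proj₂} (subst Unique (sym (cells-values w)) (label-values w))
      (∈-sorted⇒cells x∈) (∈-sorted⇒cells y∈) eq) λ p → ≺-asym p p) }) (sortedEntries-sorted n (tab μ w)))

  reading-unique : Unique reading
  reading-unique = subst Unique (sym (contentWord-sorted n (tab μ w))) sorted-values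

  before : ∀ {c d a b} → (c , a) ∈ cells w → (d , b) ∈ cells w → c ≺ d → position reading a < position reading b
  before {a = a} {b} c∈ d∈ c≺d = subst (λ u → position u a < position u b) (sym (contentWord-sorted n (tab μ w)))
    (position-≺ (sortedEntries-sorted n (tab μ w)) sorted-values (cells⇒∈-sorted c∈) (cells⇒∈-sorted d∈) c≺d)

  ∈-reading : ∀ {c a} → (c , a) ∈ cells w → a ∈ reading
  ∈-reading c∈ = subst (_ ∈_) (sym (contentWord-sorted n (tab μ w))) (∈-map⁺ proj₂ (cells⇒∈-sorted c∈))

  signature-at : ∀ pre {r q s} → w ≡ pre ++ r ∷ q ∷ s →
    (if does (position reading (suc (length s)) <? position reading (2 + length s)) then Sign.+ else Sign.-) ≡ sg r q
  signature-at pre {r} {q} {s} refl with Yam-suffix pre is-yam | ≤-<-connex r q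
  ... | _ ∷ _ ∷ y | inj₁ r≤q = trans (cong (if_then Sign.+ else Sign.-)
          (dec-true (position reading (suc (length s)) <? position reading (2 + length s))
            (before (cells-suffix pre (there (here refl))) (cells-suffix pre (here refl)) (cell-right [] y r≤q)))) (sym (sg-≤ r≤q))
  ... | _ ∷ _ ∷ y | inj₂ q<r = trans (cong (if_then Sign.+ else Sign.-)
          (dec-false (position reading (suc (length s)) <? position reading (2 + length s))
            (<⇒≯ (before (cells-suffix pre (here refl)) (cells-suffix pre (there (here refl))) (cell-left₁ y q<r))))) (sym (sg-> q<r))

  three : ∀ {P : Pred ℕ 0ℓ} (P? : ∀ x → Dec (P x)) x y z → x ∈ reading → y ∈ reading → z ∈ reading →
          P x → P y → P z → (∀ {a} → P a → a ≡ x ⊎ a ≡ y ⊎ a ≡ z) →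
          position reading x < position reading y → position reading y < position reading z →
          filter P? reading ≡ x ∷ y ∷ z ∷ []
  three {P} P? x y z x∈ y∈ z∈ px py pz only x<y y<z = sorted-unique {R = λ a b → position reading a < position reading b} <-asym
    (AllPairs.filter⁺ P? (position-sorted reading-unique))
    ((x<y ∷ <-trans x<y y<z ∷ []) ∷ (y<z ∷ []) ∷ [] ∷ [])
    (λ a∈ → case only (proj₂ (∈-filter⁻ P? {xs = reading} a∈)) of λ
      { (inj₁ refl) → here refl ; (inj₂ (inj₁ refl)) → there (here refl) ; (inj₂ (inj₂ refl)) → there (there (here refl)) })
    (λ { (here refl) → ∈-filter⁺ P? x∈ px ; (there (here refl)) → ∈-filter⁺ P? y∈ py
       ; (there (there (here refl))) → ∈-filter⁺ P? z∈ pz })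

entry-at : ∀ T {j i a} → ((suc i , suc j) , a) ∈ entries T → At (rowAt T j) i a
entry-at T e∈ with entry⁻ T e∈
... | _ , _ , _ , refl , p = p

sorted-cell⁻ : ∀ n T {c} → c ∈ map proj₁ (sortedEntries n T) →
               ∃[ j ] ∃[ i ] ∃[ a ] (c ≡ (suc i , suc j) × At (rowAt T j) i a)
sorted-cell⁻ n T c∈ =
  let _ , e∈ , eq = ∈-map⁻ proj₁ c∈
      j , i , a , eq′ , p = entry⁻ T (∈-sorted⁻ n T e∈)
  in j , i , a , trans eq (cong proj₁ eq′) , p

pairs≡ : ∀ {xs ys : List (Cell × ℕ)} → map proj₁ xs ≡ map proj₁ ys → map proj₂ xs ≡ map proj₂ ys → xs ≡ ys
pairs≡ {[]}    {[]}    _ _ = refl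
pairs≡ {_ ∷ _} {_ ∷ _} e f = cong₂ _∷_ (cong₂ _,_ (∷-injectiveˡ e) (∷-injectiveˡ f)) (pairs≡ (∷-injectiveʳ e) (∷-injectiveʳ f))

At-ext : ∀ {xs ys : List ℕ} → length xs ≡ length ys → (∀ {i a} → At xs i a → At ys i a) → xs ≡ ys
At-ext {[]}     {[]}     _ _ = refl
At-ext {x ∷ xs} {y ∷ ys} l f = cong₂ _∷_ (At-functional (f here) here)
  (At-ext (suc-injective l) λ p → case f (there p) of λ { (there q) → q })

sorted-injective : ∀ n {T S} → length T ≡ length S → (∀ j → length (rowAt T j) ≡ length (rowAt S j)) →
                   (∀ {e} → e ∈ entries T → e ∈ sortedEntries n T) → sortedEntries n T ≡ sortedEntries n S → T ≡ S
sorted-injective n {T} {S} l ls complete eq = rowAt-ext l λ j → At-ext (ls j) λ p →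
  entry-at S (∈-sorted⁻ n S (subst (_ ∈_) eq (complete (entry⁺ T p))))

row-length : ∀ {n μ w} → Standard n μ w → ∀ j → length (rowAt (tab μ w) j) ≡ part μ j
row-length (standard _ sh _) j = trans (length-row-label j (Shape-letters sh)) (row-lengths sh j)

sorted-cell⁺ : ∀ {n μ w} → Standard n μ w → ∀ {i j} → i < part μ j → (suc i , suc j) ∈ map proj₁ (sortedEntries n (tab μ w))
sorted-cell⁺ {n} {μ} {w} st {i} {j} i< =
  let a , p = <⇒At (rowAt (tab μ w) j) (subst (i <_) (sym (row-length st j)) i<)
  in ∈-map⁺ proj₁ (Reading.cells⇒∈-sorted st (entries-tab⁻ (Standard.is-shape st) (entry⁺ (tab μ w) p)))

same-cells : ∀ {n μ w w′} → Standard n μ w → Standard n μ w′ → ∀ {c} →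
             c ∈ map proj₁ (sortedEntries n (tab μ w)) → c ∈ map proj₁ (sortedEntries n (tab μ w′))
same-cells {n} {μ} {w} {w′} st st′ c∈ =
  let j , i , a , eq , p = sorted-cell⁻ n (tab μ w) c∈
  in subst (_∈ map proj₁ (sortedEntries n (tab μ w′))) (sym eq)
       (sorted-cell⁺ st′ (subst (i <_) (row-length st j) (At⇒< p)))

-- The cells in reading order depend on the shape alone, so the word of letters returns the entry of
-- each cell.
reading-injective : ∀ {n μ w w′} → Standard n μ w → Standard n μ w′ →
                    contentWord n (tab μ w) ≡ contentWord n (tab μ w′) → w ≡ w′
reading-injective {n} {μ} {w} {w′} st st′ eq = trans (sym (rows-label w)) (trans (cong rows
  (fill-injective (label-admissible (Standard.is-yam st) (Standard.is-shape st))
                  (label-admissible (Standard.is-yam st′) (Standard.is-shape st′)) tab≡)) (rows-label w′))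
  where
  cells≡ : map proj₁ (sortedEntries n (tab μ w)) ≡ map proj₁ (sortedEntries n (tab μ w′))
  cells≡ = sorted-unique {R = _≺_} ≺-asym (AllPairs.map⁺ (sortedEntries-sorted n (tab μ w)))
    (AllPairs.map⁺ (sortedEntries-sorted n (tab μ w′))) (same-cells st st′) (same-cells st′ st)
  tab≡ : tab μ w ≡ tab μ w′
  tab≡ = sorted-injective n (trans (length-fill (length μ) (label w)) (sym (length-fill (length μ) (label w′))))
    (λ j → trans (row-length st j) (sym (row-length st′ j)))
    (λ e∈ → Reading.cells⇒∈-sorted st (entries-tab⁻ (Standard.is-shape st) e∈))
    (pairs≡ cells≡ (trans (sym (contentWord-sorted n (tab μ w))) (trans eq (contentWord-sorted n (tab μ w′)))))

-- Elementary dual equivalences of reading words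

map-zip : ∀ {A B : Set} (h : A → B) (g : ℕ → ℕ) xs →
          zip (applyUpTo g (length (map h xs))) (map h xs) ≡ map (map₂ h) (zip (applyUpTo g (length xs)) xs)
map-zip h g []       = refl
map-zip h g (x ∷ xs) = cong (_ ∷_) (map-zip h (g ∘ suc) xs)

row-entries-map : ∀ f j r → row-entries (j , map f r) ≡ map (map₂ f) (row-entries (j , r))
row-entries-map f j r = begin
  map (λ (i , a) → (i , j) , a) (number (map f r))             ≡⟨ cong (map _) (map-zip f suc r) ⟩
  map (λ (i , a) → (i , j) , a) (map (map₂ f) (number r))      ≡⟨ map-∘ (number r) ⟨
  map (λ (i , a) → (i , j) , f a) (number r)                   ≡⟨ map-∘ (number r) ⟩
  map (map₂ f) (map (λ (i , a) → (i , j) , a) (number r))      ∎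
  where open ≡-Reasoning

entries-map : ∀ f T → entries (map (map f) T) ≡ map (map₂ f) (entries T)
entries-map f T = trans (cong (concatMap row-entries) (map-zip (map f) suc T)) (go (number T))
  where
  go : ∀ rs → concatMap row-entries (map (map₂ (map f)) rs) ≡ map (map₂ f) (concatMap row-entries rs)
  go []             = refl
  go ((j , r) ∷ rs) = trans (cong₂ _++_ (row-entries-map f j r) (go rs)) (sym (map-++ (map₂ f) (row-entries (j , r)) _))

on-diagonal-map : ∀ (f : ℕ → ℕ) k es → on-diagonal (map (map₂ f) es) k ≡ map (map₂ f) (on-diagonal es k)
on-diagonal-map f k []             = refl
on-diagonal-map f k ((c , a) ∷ es) with does (content c ℤ.≟ k)
... | true  = cong (_ ∷_) (on-diagonal-map f k es)
... | false = on-diagonal-map f k es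

contentWord-map : ∀ n f T → contentWord n (map (map f) T) ≡ map f (contentWord n T)
contentWord-map n f T = begin
  contentWord n (map (map f) T)                        ≡⟨ contentWord-sorted n (map (map f) T) ⟩
  map proj₂ (sortedEntries n (map (map f) T))          ≡⟨ cong (map proj₂) sorted-map ⟩
  map proj₂ (map (map₂ f) (sortedEntries n T))         ≡⟨ map-∘ (sortedEntries n T) ⟨
  map (f ∘ proj₂) (sortedEntries n T)                  ≡⟨ map-∘ (sortedEntries n T) ⟩
  map f (map proj₂ (sortedEntries n T))                ≡⟨ cong (map f) (contentWord-sorted n T) ⟨
  map f (contentWord n T)                              ∎
  where
  open ≡-Reasoning
  go : ∀ ks → concatMap (on-diagonal (map (map₂ f) (entries T))) ks ≡ map (map₂ f) (concatMap (on-diagonal (entries T)) ks)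
  go []       = refl
  go (k ∷ ks) = trans (cong₂ _++_ (on-diagonal-map f k (entries T)) (go ks))
                      (sym (map-++ (map₂ f) (on-diagonal (entries T) k) _))
  sorted-map : sortedEntries n (map (map f) T) ≡ map (map₂ f) (sortedEntries n T)
  sorted-map = trans (cong (λ es → concatMap (on-diagonal es) (diagonals n)) (entries-map f T)) (go (diagonals n))

relabel-id : ∀ {f} ℓ s → (∀ k → k ≤ length s → f k ≡ k) → map (map f) (fill ℓ (label s)) ≡ fill ℓ (label s)
relabel-id {f} ℓ [] _ = empty ℓ
  where
  empty : ∀ ℓ → map (map f) (replicate ℓ []) ≡ replicate ℓ []
  empty zero    = refl
  empty (suc ℓ) = cong ([] ∷_) (empty ℓ)
relabel-id {f} ℓ (r ∷ s) fix = trans (map-addAt f r (suc (length s)) (fill ℓ (label s)))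
  (cong₂ (addAt r) (fix _ ≤-refl) (relabel-id ℓ s (λ k k≤ → fix k (m≤n⇒m≤1+n k≤))))

record Switches (f : ℕ → ℕ) (a : ℕ) : Set where
  constructor switches
  field
    first  : f a ≡ suc a
    second : f (suc a) ≡ a
    others : ∀ k → k ≢ a → k ≢ suc a → f k ≡ k

-- Cells added in two distinct rows may be added in either order; the exchange of the two entries
-- accounts for the change of order.
relabel-swap : ∀ {f} ℓ pre {x y s} → x ≢ y → Switches f (suc (length s)) →
               map (map f) (fill ℓ (label (pre ++ y ∷ x ∷ s))) ≡ fill ℓ (label (pre ++ x ∷ y ∷ s))
relabel-swap {f} ℓ [] {x} {y} {s} x≢y (switches f₁ f₂ fix) = begin
  map (map f) (addAt y (2 + l) (addAt x (1 + l) F))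
    ≡⟨ map-addAt f y (2 + l) (addAt x (1 + l) F) ⟩
  addAt y (f (2 + l)) (map (map f) (addAt x (1 + l) F))
    ≡⟨ cong (addAt y (f (2 + l))) (map-addAt f x (1 + l) F) ⟩
  addAt y (f (2 + l)) (addAt x (f (1 + l)) (map (map f) F))
    ≡⟨ cong₂ (λ a G → addAt y a G) f₂ (cong₂ (addAt x) f₁ (relabel-id ℓ s λ k k≤ →
         fix k (<⇒≢ (s≤s k≤)) (<⇒≢ (m≤n⇒m≤1+n (s≤s k≤))))) ⟩
  addAt y (1 + l) (addAt x (2 + l) F)
    ≡⟨ addAt-comm (1 + l) (2 + l) F (x≢y ∘ sym) ⟩
  addAt x (2 + l) (addAt y (1 + l) F) ∎
  where
  open ≡-Reasoning
  l = length s
  F = fill ℓ (label s)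
relabel-swap {f} ℓ (c ∷ pre) {x} {y} {s} x≢y sw@(switches _ _ fix) =
  trans (map-addAt f c (suc (length (pre ++ y ∷ x ∷ s))) (fill ℓ (label (pre ++ y ∷ x ∷ s)))) (cong₂ (addAt c)
    (trans (fix _ (<⇒≢ (<⇒≤ big) ∘ sym) (<⇒≢ big ∘ sym)) (cong suc same-length)) (relabel-swap ℓ pre x≢y sw))
  where
  same-length : length (pre ++ y ∷ x ∷ s) ≡ length (pre ++ x ∷ y ∷ s)
  same-length = trans (length-++ pre) (sym (length-++ pre))
  big : 2 + length s < suc (length (pre ++ y ∷ x ∷ s))
  big = s≤s (subst (2 + length s ≤_) (sym (length-++ pre)) (m≤n+m _ (length pre)))

if-yes : ∀ {A P : Set} {x y : A} (d : Dec P) → P → (if does d then x else y) ≡ x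
if-yes (yes _) _ = refl
if-yes (no ¬p) p = contradiction p ¬p

if-no : ∀ {A P : Set} {x y : A} (d : Dec P) → ¬ P → (if does d then x else y) ≡ y
if-no (yes p) ¬p = contradiction p ¬p
if-no (no _)  _  = refl

switch-first : ∀ a b → switch a b a ≡ b
switch-first a b = if-yes (a ≟ a) refl

switch-other : ∀ a b {k} → k ≢ a → k ≢ b → switch a b k ≡ k
switch-other a b {k} k≢a k≢b = trans (if-no (k ≟ a) k≢a) (if-no (k ≟ b) k≢b)

switch-second : ∀ a b → switch a b b ≡ a
switch-second a b with a ≟ b
... | yes refl = switch-first a a
... | no a≢b   = trans (if-no (b ≟ a) (a≢b ∘ sym)) (if-yes (b ≟ b) refl)

switches-up : ∀ a → Switches (switch a (suc a)) a
switches-up a = switches (switch-first a (suc a)) (switch-second a (suc a)) (λ k → switch-other a (suc a))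

switches-down : ∀ a → Switches (switch (suc a) a) a
switches-down a = switches (switch-second (suc a) a) (switch-first (suc a) a) (λ k p q → switch-other (suc a) a q p)

letters-of : ℕ → List ℕ → List ℕ
letters-of i w = filter (λ a → DecMembership._∈?_ _≟_ a (i ∸ 1 ∷ i ∷ suc i ∷ [])) w

elementary-just : ∀ i w {a b c} → letters-of i w ≡ a ∷ b ∷ c ∷ [] → b ≢ i → elementary i w ≡ just (map (switch a c) w)
elementary-just i w {a} {b} {c} eq b≢i rewrite eq = if-no (b ≟ i) b≢i

elementary-nothing : ∀ i w {a b c} → letters-of i w ≡ a ∷ b ∷ c ∷ [] → b ≡ i → elementary i w ≡ nothing
elementary-nothing i w {a} {b} {c} eq b≡i rewrite eq = if-yes (b ≟ i) b≡i

module Elementary {n μ} pre {r q p s} (st : Standard n μ (pre ++ r ∷ q ∷ p ∷ s)) where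

  open Reading st public

  private
    l = length s
    word : Word
    word = pre ++ r ∷ q ∷ p ∷ s
    ypqr : Yam (r ∷ q ∷ p ∷ s)
    ypqr = Yam-suffix pre (Standard.is-yam st)
    yqp : Yam (q ∷ p ∷ s)
    yqp = Yam-suffix (r ∷ []) ypqr
    yp : Yam (p ∷ s)
    yp = Yam-suffix (q ∷ []) yqp
    ys : Yam s
    ys = Yam-suffix (p ∷ []) yp
    cell-p : ((suc (count p s) , suc p) , 1 + l) ∈ cells word
    cell-p = cells-suffix pre (there (there (here refl)))
    cell-q : ((suc (count q (p ∷ s)) , suc q) , 2 + l) ∈ cells word
    cell-q = cells-suffix pre (there (here refl))
    cell-r : ((suc (count r (q ∷ p ∷ s)) , suc r) , 3 + l) ∈ cells word
    cell-r = cells-suffix pre (here refl)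

  pos′ : ℕ → ℕ
  pos′ = position reading

  p<q : q ≤ p → pos′ (1 + l) < pos′ (2 + l)
  p<q q≤p = before cell-p cell-q (cell-right [] ys q≤p)

  q<p : p < q → pos′ (2 + l) < pos′ (1 + l)
  q<p p<q = before cell-q cell-p (cell-left₁ ys p<q)

  q<r : r ≤ q → pos′ (2 + l) < pos′ (3 + l)
  q<r r≤q = before cell-q cell-r (cell-right [] yp r≤q)

  r<q : q < r → pos′ (3 + l) < pos′ (2 + l)
  r<q q<r = before cell-r cell-q (cell-left₁ yp q<r)

  p<r : r ≤ p → pos′ (1 + l) < pos′ (3 + l)
  p<r r≤p = before cell-p cell-r (cell-right (q ∷ []) ys r≤p)

  r<p : p < r → pos′ (3 + l) < pos′ (1 + l)
  r<p p<r = before cell-r cell-p (cell-left₂ ypqr p<r)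

  letters≡ : ∀ x y z → (∀ {a} → a ∈ 1 + l ∷ 2 + l ∷ 3 + l ∷ [] → a ∈ x ∷ y ∷ z ∷ []) →
             (∀ {a} → a ∈ x ∷ y ∷ z ∷ [] → a ∈ 1 + l ∷ 2 + l ∷ 3 + l ∷ []) →
             pos′ x < pos′ y → pos′ y < pos′ z → letters-of (2 + l) reading ≡ x ∷ y ∷ z ∷ []
  letters≡ x y z f g = three (λ a → DecMembership._∈?_ _≟_ a (1 + l ∷ 2 + l ∷ 3 + l ∷ [])) x y z
    (∈-reading′ (g (here refl))) (∈-reading′ (g (there (here refl)))) (∈-reading′ (g (there (there (here refl)))))
    (g (here refl)) (g (there (here refl))) (g (there (there (here refl))))
    (λ a∈ → case f a∈ of λ { (here e) → inj₁ e ; (there (here e)) → inj₂ (inj₁ e) ; (there (there (here e))) → inj₂ (inj₂ e) })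
    where
    ∈-reading′ : ∀ {a} → a ∈ 1 + l ∷ 2 + l ∷ 3 + l ∷ [] → a ∈ reading
    ∈-reading′ (here refl)                 = ∈-reading cell-p
    ∈-reading′ (there (here refl))         = ∈-reading cell-q
    ∈-reading′ (there (there (here refl))) = ∈-reading cell-r

  swapped : ∀ {f} v → map (map f) (tab μ word) ≡ tab μ v → map f reading ≡ contentWord n (tab μ v)
  swapped {f} v eq = trans (sym (contentWord-map n f (tab μ word))) (cong (contentWord n) eq)

  pattern 1st = here refl
  pattern 2nd = there (here refl)
  pattern 3rd = there (there (here refl))

  left-tab : ∀ {f} → Left p q r → Switches f (1 + l) → map (map f) (tab μ word) ≡ tab μ (pre ++ r ∷ p ∷ q ∷ s)
  left-tab lf sw = subst₂ (λ u v → map (map _) (tab μ u) ≡ tab μ v) (++-assoc pre (r ∷ []) _) (++-assoc pre (r ∷ []) _)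
    (relabel-swap (length μ) (pre ++ r ∷ []) (Left-≢ lf) sw)

  -- The letter `i + 1` stands in the middle of the reading word, so the outer letters `i - 1` and
  -- `i` are switched, which exchanges their rows.
  elementary-left : Left p q r → elementary (2 + l) reading ≡ just (contentWord n (tab μ (pre ++ r ∷ p ∷ q ∷ s)))
  elementary-left lf@(up x y) = trans (elementary-just (2 + l) reading
    (letters≡ (2 + l) (3 + l) (1 + l) (λ { 1st → 3rd ; 2nd → 1st ; 3rd → 2nd }) (λ { 1st → 2nd ; 2nd → 3rd ; 3rd → 1st })
      (q<r y) (r<p x)) 1+n≢n)
    (cong just (swapped (pre ++ r ∷ p ∷ q ∷ s) (left-tab lf (switches-down (1 + l)))))
  elementary-left lf@(down x y) = trans (elementary-just (2 + l) reading
    (letters≡ (1 + l) (3 + l) (2 + l) (λ { 1st → 1st ; 2nd → 3rd ; 3rd → 2nd }) (λ { 1st → 1st ; 2nd → 3rd ; 3rd → 2nd })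
      (p<r y) (r<q x)) 1+n≢n)
    (cong just (swapped (pre ++ r ∷ p ∷ q ∷ s) (left-tab lf (switches-up (1 + l)))))

  elementary-right : Right p q r → elementary (2 + l) reading ≡ just (contentWord n (tab μ (pre ++ q ∷ r ∷ p ∷ s)))
  elementary-right rt@(up x y) = trans (elementary-just (2 + l) reading
    (letters≡ (3 + l) (1 + l) (2 + l) (λ { 1st → 2nd ; 2nd → 3rd ; 3rd → 1st }) (λ { 1st → 3rd ; 2nd → 1st ; 3rd → 2nd })
      (r<p y) (p<q x)) (1+n≢n ∘ sym))
    (cong just (swapped (pre ++ q ∷ r ∷ p ∷ s) (relabel-swap (length μ) pre (Right-≢ rt) (switches-down (2 + l)))))
  elementary-right rt@(down x y) = trans (elementary-just (2 + l) reading
    (letters≡ (2 + l) (1 + l) (3 + l) (λ { 1st → 2nd ; 2nd → 1st ; 3rd → 3rd }) (λ { 1st → 2nd ; 2nd → 1st ; 3rd → 3rd })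
      (q<p y) (p<r x)) (1+n≢n ∘ sym))
    (cong just (swapped (pre ++ q ∷ r ∷ p ∷ s) (relabel-swap (length μ) pre (Right-≢ rt) (switches-up (2 + l)))))

  -- Equal signs put `i` between `i - 1` and `i + 1`, in one direction or the other.
  elementary-none : sg q p ≡ sg r q → elementary (2 + l) reading ≡ nothing
  elementary-none eq with ≤-<-connex q p | ≤-<-connex r q
  ... | inj₁ q≤p | inj₁ r≤q = elementary-nothing (2 + l) reading
    (letters≡ (1 + l) (2 + l) (3 + l) id id (p<q q≤p) (q<r r≤q)) refl
  ... | inj₂ p<q | inj₂ q<r = elementary-nothing (2 + l) reading
    (letters≡ (3 + l) (2 + l) (1 + l) (λ { 1st → 3rd ; 2nd → 2nd ; 3rd → 1st }) (λ { 1st → 3rd ; 2nd → 2nd ; 3rd → 1st })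
      (r<q q<r) (q<p p<q)) refl
  ... | inj₁ q≤p | inj₂ q<r = contradiction eq (+≢- (sg-≤ q≤p) (sg-> q<r))
  ... | inj₂ p<q | inj₁ r≤q = contradiction (sym eq) (+≢- (sg-≤ r≤q) (sg-> p<q))

⟶-split : ∀ {i u v} → u ⟶[ i ] v → ∃[ pre ] ∃[ r ] ∃[ q ] ∃[ p ] ∃[ r′ ] ∃[ q′ ] ∃[ p′ ] ∃[ s ]
  (u ≡ pre ++ r ∷ q ∷ p ∷ s × v ≡ pre ++ r′ ∷ q′ ∷ p′ ∷ s × i ≡ 2 + length s × Knuth p q r p′ q′ r′)
⟶-split (here eq k) = [] , _ , _ , _ , _ , _ , _ , _ , refl , refl , eq , k
⟶-split (there {c = c} st) with ⟶-split st
... | pre , _ , _ , _ , _ , _ , _ , _ , refl , refl , eq , k = c ∷ pre , _ , _ , _ , _ , _ , _ , _ , refl , refl , eq , k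

elementary-step : ∀ {n μ i w w′} → Standard n μ w → w ⟶[ i ] w′ →
                  elementary i (contentWord n (tab μ w)) ≡ just (contentWord n (tab μ w′))
elementary-step st step with ⟶-split step
... | pre , _ , _ , _ , _ , _ , _ , _ , refl , refl , refl , left l  = Elementary.elementary-left pre st l
... | pre , _ , _ , _ , _ , _ , _ , _ , refl , refl , refl , right r = Elementary.elementary-right pre st r

word-split : ∀ m (w : Word) → 3 + m ≤ length w →
             ∃[ pre ] ∃[ r ] ∃[ q ] ∃[ p ] ∃[ s ] (w ≡ pre ++ r ∷ q ∷ p ∷ s × length s ≡ m)
word-split m (x ∷ w) l with m≤n⇒m<n∨m≡n l
... | inj₁ (s≤s l′) with word-split m w l′
... | pre , _ , _ , _ , _ , refl , eq = x ∷ pre , _ , _ , _ , _ , refl , eq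
word-split m (r ∷ q ∷ p ∷ s) l | inj₂ eq =
  [] , r , q , p , s , refl , suc-injective (suc-injective (suc-injective (sym eq)))
word-split m (r ∷ q ∷ []) l | inj₂ ()
word-split m (r ∷ [])     l | inj₂ ()

elementary-step⁻ : ∀ {n μ m w u} → Standard n μ w → 2 + m < n →
                   elementary (2 + m) (contentWord n (tab μ w)) ≡ just u →
                   ∃[ w′ ] (w ⟶[ 2 + m ] w′ × u ≡ contentWord n (tab μ w′))
elementary-step⁻ {m = m} {w} st l eq with word-split m w (≤-trans l (≤-reflexive (sym (Standard.has-size st))))
... | pre , r , q , p , s , refl , refl with sg q p Sign.≟ sg r q
... | yes s≡s = contradiction (trans (sym (Elementary.elementary-none pre st s≡s)) eq) λ ()
... | no differ with Left⊎Right differ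
... | inj₁ x = _ , ⟶-skip pre (here refl (left x)) , just-injective (trans (sym eq) (Elementary.elementary-left pre st x))
... | inj₂ x = _ , ⟶-skip pre (here refl (right x)) , just-injective (trans (sym eq) (Elementary.elementary-right pre st x))

⟶-Standard : ∀ {n μ i w w′} → Standard n μ w → w ⟶[ i ] w′ → Standard n μ w′
⟶-Standard (standard y (shape sh) l) st =
  standard (⟶-Yam y st) (shape λ j → trans (sym (counts (⟶-∼ st) j)) (sh j)) (trans (sym (⟶-length st)) l)

⟶-irrefl : ∀ {i u} → ¬ u ⟶[ i ] u
⟶-irrefl (here _ (left l))  = Left-≢ l refl
⟶-irrefl (here _ (right r)) = Right-≢ r refl
⟶-irrefl (there st)         = ⟶-irrefl st

-- The standard graph as a labelled graph

lookup-injective : ∀ {A : Set} {xs : List A} → Unique xs → ∀ i j → lookup xs i ≡ lookup xs j → i ≡ j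
lookup-injective (p ∷ u) Fin.zero    Fin.zero    _  = refl
lookup-injective (p ∷ u) Fin.zero    (Fin.suc j) eq = contradiction eq (All.lookup p (∈-lookup j))
lookup-injective (p ∷ u) (Fin.suc i) Fin.zero    eq = contradiction (sym eq) (All.lookup p (∈-lookup i))
lookup-injective (p ∷ u) (Fin.suc i) (Fin.suc j) eq = cong Fin.suc (lookup-injective u i j eq)

SYT-unique : ∀ n μ → Unique (SYT n μ)
SYT-unique n μ = Unique.filter⁺ (isStandard? n) (fillings-unique μ ([1‥]-unique n))

tab-injective : ∀ {n μ w w′} → Standard n μ w → Standard n μ w′ → tab μ w ≡ tab μ w′ → w ≡ w′
tab-injective {n} st st′ eq = reading-injective st st′ (cong (contentWord n) eq)

wordSignature-sgn : ∀ {n} (G : SignedColoredGraph n n) v u → signature G v ≡ wordSignature n u → ∀ {j} → suc j < n →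
  sgn G v (suc j) ≡ (if does (position u (suc j) <? position u (2 + j)) then Sign.+ else Sign.-)
wordSignature-sgn {n} G v u eq {j} l with inside? {n} {j} l
... | h , refl = trans (sgn-σ G v h) (trans (cong (λ σ → Vec.lookup σ h) eq) (Vec.lookup∘tabulate _ h))

module StandardGraph (n : ℕ) (μ : List ℕ) (part : IsPartition n μ) where

  H : SignedColoredGraph n n
  H = standardGraph n μ

  word-of : ∀ T → T ∈ SYT n μ → ∃[ w ] (Standard n μ w × tab μ w ≡ T)
  word-of T T∈ = let w , y , sh , l , eq = ∈-SYT⁻ part T∈ in w , standard y sh l , eq

  word : Vertex H → Word
  word T = proj₁ (word-of (lookup (SYT n μ) T) (∈-lookup T))

  word-standard : ∀ T → Standard n μ (word T)
  word-standard T = proj₁ (proj₂ (word-of (lookup (SYT n μ) T) (∈-lookup T)))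

  tab-word : ∀ T → tab μ (word T) ≡ lookup (SYT n μ) T
  tab-word T = proj₂ (proj₂ (word-of (lookup (SYT n μ) T) (∈-lookup T)))

  reading-of : ∀ T → contentWord n (lookup (SYT n μ) T) ≡ contentWord n (tab μ (word T))
  reading-of T = cong (contentWord n) (sym (tab-word T))

  word-injective : ∀ {T S} → word T ≡ word S → T ≡ S
  word-injective {T} {S} eq = lookup-injective (SYT-unique n μ) T S
    (trans (sym (tab-word T)) (trans (cong (tab μ) eq) (tab-word S)))

  vertex : ∀ {w} → Standard n μ w → Vertex H
  vertex st = index (∈-SYT⁺ (Standard.is-yam st) (Standard.is-shape st) (Standard.has-size st))

  word-vertex : ∀ {w} (st : Standard n μ w) → word (vertex st) ≡ w
  word-vertex {w} st = tab-injective (word-standard (vertex st)) st (trans (tab-word (vertex st)) (sym (Any.lookup-index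
    (∈-SYT⁺ (Standard.is-yam st) (Standard.is-shape st) (Standard.has-size st)))))

  word-sig : ∀ T pre {r q s} → word T ≡ pre ++ r ∷ q ∷ s → sgn H T (suc (length s)) ≡ sg r q
  word-sig T pre {r} {q} {s} eq = trans
    (wordSignature-sgn H T (contentWord n (tab μ (word T))) (cong (wordSignature n) (reading-of T)) proper-position)
    (Reading.signature-at (word-standard T) pre eq)
    where
    proper-position : suc (length s) < n
    proper-position = subst (2 + length s ≤_) (Standard.has-size (word-standard T))
      (subst (2 + length s ≤_) (trans (sym (length-++ pre)) (cong length (sym eq))) (m≤n+m _ (length pre)))

  step-of : ∀ {i T S} → 1 < i → i < n → elementary i (contentWord n (lookup (SYT n μ) T)) ≡ just (contentWord n (lookup (SYT n μ) S)) →
            word T ⟶[ i ] word S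
  step-of {suc (suc m)} {T} {S} _ i<n eq =
    let w′ , st , eq′ = elementary-step⁻ (word-standard T) i<n
          (trans (cong (elementary (2 + m)) (sym (reading-of T))) (trans eq (cong just (reading-of S))))
    in subst (word T ⟶[ 2 + m ]_) (sym (reading-injective (word-standard S) (⟶-Standard (word-standard T) st) eq′)) st
  step-of {suc zero} (s≤s ()) _ _

  edge⁻ : ∀ {i T S} → E H i T S → word T ⟶[ i ] word S
  edge⁻ (l , u , _ , inj₁ eq) = step-of l u eq
  edge⁻ (l , u , _ , inj₂ eq) = ⟶-sym (step-of l u eq)

  edge⁺ : ∀ {i T S} → word T ⟶[ i ] word S → E H i T S
  edge⁺ {i} {T} {S} st = proj₁ (⟶-colour st) ,
    subst (i <_) (Standard.has-size (word-standard T)) (proj₂ (⟶-colour st)) ,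
    (λ { refl → ⟶-irrefl st }) ,
    inj₁ (trans (cong (elementary i) (reading-of T)) (trans (elementary-step (word-standard T) st) (cong just (sym (reading-of S)))))

  -- With this, `Simulation` can compare an arbitrary component with a standard graph.
  labelling : Labelling H n n
  labelling = record
    { L    = word
    ; len  = Standard.has-size ∘ word-standard
    ; yam  = Standard.is-yam ∘ word-standard
    ; sig  = word-sig
    ; edge = λ e _ → edge⁻ e
    }

-- Standardisation

pairsOf : ∀ {A B : Set} → List A → (A → List B) → List (A × B)
pairsOf xs f = concatMap (λ x → map (x ,_) (f x)) xs

∈-pairsOf⁺ : ∀ {A B : Set} {xs : List A} {f : A → List B} {x y} → x ∈ xs → y ∈ f x → (x , y) ∈ pairsOf xs f
∈-pairsOf⁺ {f = f} {x} x∈ y∈ = ∈-concat⁺′ (∈-map⁺ (x ,_) y∈) (∈-map⁺ (λ x → map (x ,_) (f x)) x∈)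

∈-pairsOf⁻ : ∀ {A B : Set} (xs : List A) {f : A → List B} {x y} → (x , y) ∈ pairsOf xs f → x ∈ xs × y ∈ f x
∈-pairsOf⁻ xs {f} p∈ with ∈-concat⁻′ (map (λ x → map (x ,_) (f x)) xs) p∈
... | _ , p∈ps , ps∈ with ∈-map⁻ (λ x → map (x ,_) (f x)) ps∈
... | x , x∈ , refl with ∈-map⁻ (x ,_) p∈ps
... | y , y∈ , refl = x∈ , y∈

pairsOf-unique : ∀ {A B : Set} {xs : List A} {f : A → List B} → Unique xs → (∀ {x} → x ∈ xs → Unique (f x)) → Unique (pairsOf xs f)
pairsOf-unique []      _ = []
pairsOf-unique {xs = x ∷ xs} {f} (p ∷ u) g = Unique.++⁺ (Unique.map⁺ (cong proj₂) (g (here refl))) (pairsOf-unique u (g ∘ there))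
  λ (p∈ , p∈′) → let _ , _ , eq = ∈-map⁻ (x ,_) p∈ in
    All.lookup p (proj₁ (∈-pairsOf⁻ xs p∈′)) (sym (cong proj₁ eq))

length-pairsOf : ∀ {A B : Set} (xs : List A) (f : A → List B) → length (pairsOf xs f) ≡ sum (map (length ∘ f) xs)
length-pairsOf []       f = refl
length-pairsOf (x ∷ xs) f = trans (length-++ (map (x ,_) (f x)))
  (cong₂ _+_ (length-map (x ,_) (f x)) (length-pairsOf xs f))

bij-length : ∀ {A B : Set} {X : List A} {Y : List B} (ρ : A → B → Set) → Unique X → Unique Y →
             (∀ {x} → x ∈ X → ∃[ y ] (y ∈ Y × ρ x y)) → (∀ {y} → y ∈ Y → ∃[ x ] (x ∈ X × ρ x y)) →
             (∀ {x y y′} → ρ x y → ρ x y′ → y ≡ y′) → (∀ {x x′ y} → ρ x y → ρ x′ y → x ≡ x′) → length X ≡ length Y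
bij-length {X = X} {Y} ρ uX uY to from func inj = trans (sym (length-map (λ _ → tt) X))
  (trans (Perm.↭-length (bij-↭ {h = λ _ → tt} {g = λ _ → tt} ρ uX uY to from func inj λ _ _ → refl)) (length-map (λ _ → tt) Y))

count-filter : ∀ k w → length (filter (k ≟_) w) ≡ count k w
count-filter k []      = refl
count-filter k (x ∷ w) with k ≟ x
... | yes refl = trans (cong length (filter-accept (k ≟_) {k} {w} refl)) (trans (cong suc (count-filter k w)) (sym (count-here k w)))
... | no k≢x   = trans (cong length (filter-reject (k ≟_) {x} {w} k≢x)) (trans (count-filter k w) (sym (count-there w k≢x)))

count-↭ : ∀ k {u v} → u ↭ v → count k u ≡ count k v
count-↭ k {u} {v} p = trans (as-sum u) (trans (sum-↭ (Perm.map⁺ (δ k) p)) (sym (as-sum v)))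
  where
  as-sum : ∀ w → count k w ≡ sum (map (δ k) w)
  as-sum []      = refl
  as-sum (x ∷ w) = cong (δ k x +_) (as-sum w)

exponents-↭ : ∀ m {u v} → u ↭ v → exponents m u ≡ exponents m v
exponents-↭ m {u} {v} p = map-cong (λ k → trans (count-filter k u) (trans (count-↭ k p) (sym (count-filter k v)))) [1‥ m ]

signs : Word → List Sign
signs (r ∷ q ∷ s) = sg r q ∷ signs (q ∷ s)
signs _           = []

toList-tabulate : ∀ {A : Set} (g : ℕ → A) m → Vec.toList (Vec.tabulate {n = m} (g ∘ toℕ)) ≡ applyUpTo g m
toList-tabulate g zero    = refl
toList-tabulate g (suc m) = cong (g 0 ∷_) (toList-tabulate (g ∘ suc) m)

signature-list : ∀ {n μ w} → Standard n μ w → Vec.toList (wordSignature n (contentWord n (tab μ w))) ≡ reverse (signs w)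
signature-list {n} {μ} {w} st = trans (toList-tabulate F (n ∸ 1))
  (trans (cong (λ k → applyUpTo F (k ∸ 1)) (sym (Standard.has-size st))) (go [] w refl))
  where
  u = contentWord n (tab μ w)
  F : ℕ → Sign
  F j = if does (position u (suc j) <? position u (2 + j)) then Sign.+ else Sign.-
  go : ∀ pre v → w ≡ pre ++ v → applyUpTo F (length v ∸ 1) ≡ reverse (signs v)
  go pre []          _  = refl
  go pre (r ∷ [])    _  = refl
  go pre (r ∷ q ∷ s) eq = begin
    applyUpTo F (suc (length s))              ≡⟨ applyUpTo-∷ʳ F (length s) ⟨
    applyUpTo F (length s) ∷ʳ F (length s)    ≡⟨ cong₂ _∷ʳ_ (go (pre ++ r ∷ []) (q ∷ s) (trans eq (sym (++-assoc pre (r ∷ []) _))))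
                                                            (Reading.signature-at st pre eq) ⟩
    reverse (signs (q ∷ s)) ∷ʳ sg r q         ≡⟨ unfold-reverse (sg r q) (signs (q ∷ s)) ⟨
    reverse (signs (r ∷ q ∷ s))               ∎
    where open ≡-Reasoning

Joint : Sign → ℕ → ℕ → Set
Joint s x y = x ≤ y × (x ≡ y → s ≡ Sign.+)

Compatible-∷ʳ⁺ : ∀ σ v {s x y} → length σ ≡ length v → Compatible σ (v ∷ʳ x) → Joint s x y → Compatible (σ ∷ʳ s) ((v ∷ʳ x) ∷ʳ y)
Compatible-∷ʳ⁺ []      []          _ _       (l , f) = l , f , tt
Compatible-∷ʳ⁺ (t ∷ σ) (a ∷ [])    eq (l , f , c) j = l , f , Compatible-∷ʳ⁺ σ [] (suc-injective eq) c j
Compatible-∷ʳ⁺ (t ∷ σ) (a ∷ b ∷ v) eq (l , f , c) j = l , f , Compatible-∷ʳ⁺ σ (b ∷ v) (suc-injective eq) c j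

Compatible-∷ʳ⁻ : ∀ σ v {s x y} → length σ ≡ length v → Compatible (σ ∷ʳ s) ((v ∷ʳ x) ∷ʳ y) → Compatible σ (v ∷ʳ x) × Joint s x y
Compatible-∷ʳ⁻ []      []          _ (l , f , _) = tt , l , f
Compatible-∷ʳ⁻ (t ∷ σ) (a ∷ [])    eq (l , f , c) = let d , j = Compatible-∷ʳ⁻ σ [] (suc-injective eq) c in (l , f , d) , j
Compatible-∷ʳ⁻ (t ∷ σ) (a ∷ b ∷ v) eq (l , f , c) = let d , j = Compatible-∷ʳ⁻ σ (b ∷ v) (suc-injective eq) c in (l , f , d) , j

length-signs : ∀ q s → length (signs (q ∷ s)) ≡ length s
length-signs q []      = refl
length-signs q (p ∷ s) = cong suc (length-signs p s)

reverse-lengths : ∀ q (β : Biword) → length (reverse (signs (q ∷ rows β))) ≡ length (reverse (map proj₂ β))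
reverse-lengths q β = trans (length-reverse (signs (q ∷ rows β))) (trans (length-signs q (rows β))
  (trans (length-map proj₁ β) (trans (sym (length-map proj₂ β)) (sym (length-reverse (map proj₂ β))))))

reverse-two : ∀ {A : Set} (y x : A) v → reverse (y ∷ x ∷ v) ≡ (reverse v ∷ʳ x) ∷ʳ y
reverse-two y x v = trans (unfold-reverse y (x ∷ v)) (cong (_∷ʳ y) (unfold-reverse x v))

-- A repeated value demands the sign +, that is, a weakly lower row for the next letter; this is the
-- tie rule of `After`. Reversal is needed because biwords start with the largest letter.
Linked⇒Compatible : ∀ β → Linked (After _≤_) β → Compatible (reverse (signs (rows β))) (reverse (map proj₂ β))
Linked⇒Compatible []                      _       = tt
Linked⇒Compatible ((r , y) ∷ [])          _       = tt
Linked⇒Compatible ((r , y) ∷ (q , x) ∷ β) (a ∷ l) =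
  subst₂ Compatible (sym (unfold-reverse (sg r q) (signs (q ∷ rows β)))) (sym (reverse-two y x (map proj₂ β)))
    (Compatible-∷ʳ⁺ (reverse (signs (q ∷ rows β))) (reverse (map proj₂ β)) (reverse-lengths q β)
      (subst (Compatible _) (unfold-reverse x (map proj₂ β)) (Linked⇒Compatible ((q , x) ∷ β) l)) (joint (After.order a)))
  where
  joint : x < y ⊎ (x ≡ y × r ≤ q) → Joint (sg r q) x y
  joint (inj₁ x<y)         = <⇒≤ x<y , λ { refl → contradiction x<y (<-irrefl refl) }
  joint (inj₂ (refl , r≤q)) = ≤-refl , λ _ → sg-≤ r≤q

Compatible⇒Linked : ∀ β → Compatible (reverse (signs (rows β))) (reverse (map proj₂ β)) → Linked (After _≤_) β
Compatible⇒Linked []             _ = []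
Compatible⇒Linked ((r , y) ∷ []) _ = [-]
Compatible⇒Linked ((r , y) ∷ (q , x) ∷ β) c =
  let d , (x≤y , f) = Compatible-∷ʳ⁻ (reverse (signs (q ∷ rows β))) (reverse (map proj₂ β)) (reverse-lengths q β)
        (subst₂ Compatible (unfold-reverse (sg r q) (signs (q ∷ rows β))) (reverse-two y x (map proj₂ β)) c)
  in after (order x≤y f) (λ _ → x≤y) ∷
     Compatible⇒Linked ((q , x) ∷ β) (subst (Compatible (reverse (signs (q ∷ rows β)))) (sym (unfold-reverse x (map proj₂ β))) d)
  where
  order : x ≤ y → (x ≡ y → sg r q ≡ Sign.+) → x < y ⊎ (x ≡ y × r ≤ q)
  order x≤y f with m≤n⇒m<n∨m≡n x≤y
  ... | inj₁ x<y  = inj₁ x<y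
  ... | inj₂ refl = inj₂ (refl , sg-+ (f refl))

After-trans : ∀ {e f g} → After _≤_ e f → After _≤_ f g → After _≤_ e g
After-trans {e} {f} {g} (after o _) (after o′ _) = after (order o o′) (λ _ → value o o′)
  where
  order : proj₂ f < proj₂ e ⊎ (proj₂ f ≡ proj₂ e × proj₁ e ≤ proj₁ f) →
          proj₂ g < proj₂ f ⊎ (proj₂ g ≡ proj₂ f × proj₁ f ≤ proj₁ g) →
          proj₂ g < proj₂ e ⊎ (proj₂ g ≡ proj₂ e × proj₁ e ≤ proj₁ g)
  order (inj₁ p)          (inj₁ q)          = inj₁ (<-trans q p)
  order (inj₁ p)          (inj₂ (refl , _)) = inj₁ p
  order (inj₂ (refl , _)) (inj₁ q)          = inj₁ q
  order (inj₂ (refl , p)) (inj₂ (refl , q)) = inj₂ (refl , ≤-trans p q)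
  value : proj₂ f < proj₂ e ⊎ (proj₂ f ≡ proj₂ e × proj₁ e ≤ proj₁ f) →
          proj₂ g < proj₂ f ⊎ (proj₂ g ≡ proj₂ f × proj₁ f ≤ proj₁ g) → proj₂ g ≤ proj₂ e
  value o o′ with order o o′
  ... | inj₁ l          = <⇒≤ l
  ... | inj₂ (refl , _) = ≤-refl

biword-ext : ∀ {β γ : Biword} → rows β ≡ rows γ → map proj₂ β ≡ map proj₂ γ → β ≡ γ
biword-ext {[]}    {[]}    _ _ = refl
biword-ext {_ ∷ _} {_ ∷ _} e f = cong₂ _∷_ (cong₂ _,_ (∷-injectiveˡ e) (∷-injectiveˡ f)) (biword-ext (∷-injectiveʳ e) (∷-injectiveʳ f))

biword : Word → List ℕ → Biword
biword (r ∷ w) (x ∷ v) = (r , x) ∷ biword w v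
biword _       _       = []

rows-biword : ∀ w v → length w ≡ length v → rows (biword w v) ≡ w
rows-biword []      []      _ = refl
rows-biword (r ∷ w) (x ∷ v) l = cong (r ∷_) (rows-biword w v (suc-injective l))

values-biword : ∀ w v → length w ≡ length v → map proj₂ (biword w v) ≡ v
values-biword []      []      _ = refl
values-biword (r ∷ w) (x ∷ v) l = cong (x ∷_) (values-biword w v (suc-injective l))

module Expansion {n : ℕ} {μ : List ℕ} (part : IsPartition n μ) (a : Monomial) where

  private
    m = length a

  signature-of : Filling → Vec.Vec Sign (n ∸ 1)
  signature-of T = wordSignature n (contentWord n T)

  exponent? : ∀ v → Dec (exponents m v ≡ a)
  exponent? v = List.≡-dec _≟_ (exponents m v) a

  compatible-words : Filling → List (List ℕ)
  compatible-words T = filter exponent? (filter (compatible? (Vec.toList (signature-of T))) (words [1‥ m ] n))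

  semistandard : List Filling
  semistandard = filter (λ T → exponent? (concat T)) (SSYT m μ)

  -- The biword mediates: its rows give the standard tableau, its values the compatible word, and
  -- both together the semistandard filling.
  record Standardises (p : Filling × List ℕ) (S : Filling) : Set where
    constructor standardises
    field
      β      : Biword
      valid  : Admissible _≤_ (length μ) β
      shaped : Shape μ (rows β)
      sized  : length (rows β) ≡ n
      pair≡  : p ≡ (tab μ (rows β) , reverse (map proj₂ β))
      fill≡  : S ≡ fill (length μ) β

    is-standard : Standard n μ (rows β)
    is-standard = standard (Admissible.lattice valid) shaped sized

  same-pair : ∀ {p S S′} (s : Standardises p S) (s′ : Standardises p S′) → Standardises.β s ≡ Standardises.β s′
  same-pair s s′ = biword-ext
    (tab-injective (is-standard s) (is-standard s′) (cong proj₁ p≡))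
    (reverse-injective (cong proj₂ p≡))
    where
    open Standardises
    p≡ = trans (sym (pair≡ s)) (pair≡ s′)

  functional : ∀ {p S S′} → Standardises p S → Standardises p S′ → S ≡ S′
  functional s s′ = trans (Standardises.fill≡ s) (trans (cong (fill (length μ)) (same-pair s s′)) (sym (Standardises.fill≡ s′)))

  injective : ∀ {p p′ S} → Standardises p S → Standardises p′ S → p ≡ p′
  injective s s′ = trans (Standardises.pair≡ s) (trans (cong (λ β → tab μ (rows β) , reverse (map proj₂ β))
    (fill-injective (Standardises.valid s) (Standardises.valid s′) (trans (sym (Standardises.fill≡ s)) (Standardises.fill≡ s′))))
    (sym (Standardises.pair≡ s′)))

  sorted⇒compatible : ∀ {β} → Standard n μ (rows β) → AllPairs (After _≤_) β →
                      Compatible (Vec.toList (signature-of (tab μ (rows β)))) (reverse (map proj₂ β))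
  sorted⇒compatible {β} st s = subst (λ σ → Compatible σ (reverse (map proj₂ β))) (sym (signature-list st))
    (Linked⇒Compatible β (AllPairs⇒Linked s))

  exponents-fill : ∀ {β} → Shape μ (rows β) → exponents m (concat (fill (length μ) β)) ≡ exponents m (reverse (map proj₂ β))
  exponents-fill {β} sh = exponents-↭ m (↭-trans (concat-fill β (Shape-bounded β sh)) (↭-sym (Perm.↭-reverse (map proj₂ β))))

  from : ∀ {S} → S ∈ semistandard → ∃[ p ] (p ∈ pairsOf (SYT n μ) compatible-words × Standardises p S)
  from {S} S∈ =
    let S∈′ , exp = ∈-filter⁻ (λ T → exponent? (concat T)) {xs = SSYT m μ} S∈
        d = ∈-SSYT⁻ part S∈′
        open Decomposition d
        sized = trans (length-map proj₁ word) size≡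
        st = standard (Admissible.lattice valid) shaped sized
        v = reverse (map proj₂ word)
    in (tab μ (rows word) , v) ,
       ∈-pairsOf⁺ (∈-SYT⁺ (Admissible.lattice valid) shaped sized)
         (∈-filter⁺ exponent? (∈-filter⁺ (compatible? _)
           (∈-words⁺ (trans (length-reverse (map proj₂ word)) (trans (length-map proj₂ word) size≡))
             (Perm.All-resp-↭ (↭-sym (Perm.↭-reverse (map proj₂ word))) values))
           (sorted⇒compatible {word} st (Admissible.sorted valid)))
           (trans (sym (exponents-fill {word} shaped)) (trans (cong (exponents m ∘ concat) filled) exp))) ,
       standardises word valid shaped sized refl (sym filled)

  to : ∀ {p} → p ∈ pairsOf (SYT n μ) compatible-words → ∃[ S ] (S ∈ semistandard × Standardises p S)
  to {T , v} p∈ =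
    let T∈ , v∈ = ∈-pairsOf⁻ (SYT n μ) p∈
        v∈₁ , exp = ∈-filter⁻ exponent? {xs = filter (compatible? _) (words [1‥ m ] n)} v∈
        v∈₂ , comp = ∈-filter⁻ (compatible? _) {xs = words [1‥ m ] n} v∈₁
        len , letters = ∈-words⁻ n v∈₂
        w , y , sh , sized , tab≡ = ∈-SYT⁻ part T∈
    in build w (standard y sh sized) tab≡ len letters comp exp
    where
    build : ∀ w → Standard n μ w → tab μ w ≡ T → length v ≡ n → All (_∈ [1‥ m ]) v →
            Compatible (Vec.toList (signature-of T)) v → exponents m v ≡ a →
            ∃[ S ] (S ∈ semistandard × Standardises (T , v) S)
    build w st@(standard y sh sized) refl len letters comp exp = fill (length μ) β ,
      ∈-filter⁺ (λ T → exponent? (concat T)) (∈-SSYT⁺ β valid shaped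
        (subst (All (_∈ [1‥ m ])) (sym values≡) (Perm.All-resp-↭ (↭-sym (Perm.↭-reverse v)) letters)))
        (trans (exponents-fill {β} shaped) (trans (cong (exponents m) v≡) exp)) ,
      standardises β valid shaped (trans (cong length rows≡) sized) (cong₂ _,_ (cong (tab μ) (sym rows≡)) (sym v≡)) refl
      where
      same-lengths : length w ≡ length (reverse v)
      same-lengths = trans sized (trans (sym len) (sym (length-reverse v)))
      β : Biword
      β = biword w (reverse v)
      rows≡ : rows β ≡ w
      rows≡ = rows-biword w (reverse v) same-lengths
      values≡ : map proj₂ β ≡ reverse v
      values≡ = values-biword w (reverse v) same-lengths
      v≡ : reverse (map proj₂ β) ≡ v
      v≡ = trans (cong reverse values≡) (reverse-involutive v)
      shaped : Shape μ (rows β)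
      shaped = subst (Shape μ) (sym rows≡) sh
      valid : Admissible _≤_ (length μ) β
      valid = admissible (Shape-bounded β shaped) (subst Yam (sym rows≡) y)
        (Linked⇒AllPairs After-trans (Compatible⇒Linked β (subst₂ Compatible
          (trans (signature-list st) (cong (reverse ∘ signs) (sym rows≡))) (sym v≡) comp)))

  expansion : sum (map (λ T → Q {n} (signature-of T) a) (SYT n μ)) ≡ schur μ a
  expansion = trans (sym (length-pairsOf (SYT n μ) compatible-words))
    (bij-length Standardises
      (pairsOf-unique (SYT-unique n μ) (λ _ → Unique.filter⁺ exponent? (Unique.filter⁺ (compatible? _) (words-unique n ([1‥]-unique m)))))
      (Unique.filter⁺ (λ T → exponent? (concat T)) (Unique.filter⁺ (increasing? _≤?_ _<?_) (fillings-unique μ ([1‥]-unique m))))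
      to from functional injective)

-- Symmetry of Schur functions

-- The skew shape κ / ν is a horizontal strip; ν is padded by zeros to the length of κ.
data Interlaces : List ℕ → List ℕ → Set where
  []  : Interlaces [] []
  _∷_ : ∀ {k κ v ν} → part κ 0 ≤ v × v ≤ k → Interlaces κ ν → Interlaces (k ∷ κ) (v ∷ ν)

interlaces? : ∀ κ ν → Dec (Interlaces κ ν)
interlaces? []      []      = yes []
interlaces? []      (_ ∷ _) = no λ ()
interlaces? (_ ∷ _) []      = no λ ()
interlaces? (k ∷ κ) (v ∷ ν) = Decidable.map′ (λ (p , q) → p ∷ q) (λ { (p ∷ q) → p , q })
  (((part κ 0 ≤? v) ×-dec (v ≤? k)) ×-dec interlaces? κ ν)

Interlaces-length : ∀ {κ ν} → Interlaces κ ν → length ν ≡ length κ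
Interlaces-length []      = refl
Interlaces-length (_ ∷ p) = cong suc (Interlaces-length p)

Interlaces-part : ∀ {κ ν} → Interlaces κ ν → ∀ j → part κ (suc j) ≤ part ν j × part ν j ≤ part κ j
Interlaces-part []      _       = z≤n , z≤n
Interlaces-part (p ∷ _) zero    = p
Interlaces-part (_ ∷ q) (suc j) = Interlaces-part q j

part-Interlaces : ∀ κ ν → length ν ≡ length κ → (∀ j → part κ (suc j) ≤ part ν j × part ν j ≤ part κ j) → Interlaces κ ν
part-Interlaces []      []      _ _ = []
part-Interlaces (k ∷ κ) (v ∷ ν) l f = f 0 ∷ part-Interlaces κ ν (suc-injective l) (f ∘ suc)

-- The bound `sum κ` on the entries is crude, but makes the search finite.
strips : List ℕ → List (List ℕ)
strips κ = filter (interlaces? κ) (words (upTo (suc (sum κ))) (length κ))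

strips-unique : ∀ κ → Unique (strips κ)
strips-unique κ = Unique.filter⁺ (interlaces? κ) (words-unique (length κ) (Unique.upTo⁺ (suc (sum κ))))

∈-strips⁺ : ∀ {κ ν} → Interlaces κ ν → ν ∈ strips κ
∈-strips⁺ {κ} {ν} i = ∈-filter⁺ (interlaces? κ) (∈-words⁺ (Interlaces-length i) (All.map (λ v≤ → ∈-upTo⁺ (s≤s v≤)) (bounded i))) i
  where
  bounded : ∀ {κ ν} → Interlaces κ ν → All (_≤ sum κ) ν
  bounded []                      = []
  bounded (_∷_ {k} {κ} (_ , v≤k) i) =
    ≤-trans v≤k (m≤m+n k (sum κ)) ∷ All.map (λ l → ≤-trans l (m≤n+m (sum κ) k)) (bounded i)

∈-strips⁻ : ∀ κ {ν} → ν ∈ strips κ → Interlaces κ ν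
∈-strips⁻ κ ν∈ = proj₂ (∈-filter⁻ (interlaces? κ) {xs = words (upTo (suc (sum κ))) (length κ)} ν∈)

strips-of-size : List ℕ → ℕ → List (List ℕ)
strips-of-size κ q = filter (λ ν → sum ν + q ≟ sum κ) (strips κ)

∈-strips-of-size⁺ : ∀ {κ q ν} → Interlaces κ ν → sum ν + q ≡ sum κ → ν ∈ strips-of-size κ q
∈-strips-of-size⁺ i eq = ∈-filter⁺ _ (∈-strips⁺ i) eq

∈-strips-of-size⁻ : ∀ κ {q ν} → ν ∈ strips-of-size κ q → Interlaces κ ν × sum ν + q ≡ sum κ
∈-strips-of-size⁻ κ {q} ν∈ = let p , eq = ∈-filter⁻ (λ ν → sum ν + q ≟ sum κ) {xs = strips κ} ν∈ in ∈-strips⁻ κ p , eq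

strips-of-size-unique : ∀ κ q → Unique (strips-of-size κ q)
strips-of-size-unique κ q = Unique.filter⁺ _ (strips-unique κ)

-- The number of semistandard tableaux of shape κ, by removing the largest
-- letters; the exponents are listed starting with that of the last variable.
kostka : List ℕ → List ℕ → ℕ
kostka κ []      = if does (sum κ ≟ 0) then 1 else 0
kostka κ (q ∷ a) = sum (map (λ ν → kostka ν a) (strips-of-size κ q))

sum-map-cong∈ : ∀ {A : Set} {f g : A → ℕ} (xs : List A) → (∀ {x} → x ∈ xs → f x ≡ g x) → sum (map f xs) ≡ sum (map g xs)
sum-map-cong∈ []       _ = refl
sum-map-cong∈ (x ∷ xs) h = cong₂ _+_ (h (here refl)) (sum-map-cong∈ xs (h ∘ there))

sum-++ : ∀ xs ys → sum (xs ++ ys) ≡ sum xs + sum ys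
sum-++ []       ys = refl
sum-++ (x ∷ xs) ys = trans (cong (x +_) (sum-++ xs ys)) (sym (+-assoc x (sum xs) (sum ys)))

sum-pairsOf : ∀ {A B : Set} (h : A → B → ℕ) (xs : List A) (f : A → List B) →
              sum (map (λ (x , y) → h x y) (pairsOf xs f)) ≡ sum (map (λ x → sum (map (h x) (f x))) xs)
sum-pairsOf h []       f = refl
sum-pairsOf h (x ∷ xs) f = trans (cong sum (map-++ (λ (x , y) → h x y) (map (x ,_) (f x)) (pairsOf xs f)))
  (trans (sum-++ (map (λ (x , y) → h x y) (map (x ,_) (f x))) _)
         (cong₂ _+_ (cong sum (sym (map-∘ (f x)))) (sum-pairsOf h xs f)))

-- For fixed ν and κ the partitions μ with ν ≺ μ ≺ κ form a box, and reflecting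
-- each μ_j in its interval [ν_j ⊔ κ_{j+1} , κ_j ⊓ ν_{j-1}] exchanges the sizes
-- of κ / μ and μ / ν. The first argument plays the role of ν_{j-1}.
reflect : ℕ → List ℕ → List ℕ → List ℕ → List ℕ
reflect p (k ∷ κ) (v ∷ ν) (u ∷ μ) = ((v ⊔ part κ 0) + (k ⊓ p) ∸ u) ∷ reflect v κ ν μ
reflect _ _       _       _       = []

data Boxed : ℕ → List ℕ → List ℕ → List ℕ → Set where
  []  : ∀ {p} → Boxed p [] [] []
  _∷_ : ∀ {p k κ v ν u μ} → (v ⊔ part κ 0) ≤ u × u ≤ k ⊓ p → Boxed v κ ν μ → Boxed p (k ∷ κ) (v ∷ ν) (u ∷ μ)

Boxed⁺ : ∀ {p κ ν μ} → Interlaces κ μ → Interlaces μ ν → part μ 0 ≤ p → Boxed p κ ν μ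
Boxed⁺ []              []                _ = []
Boxed⁺ ((a , b) ∷ i) ((c , d) ∷ i′) e = (⊔-lub d a , ⊓-glb b e) ∷ Boxed⁺ i i′ c

Boxed⁻ : ∀ {p κ ν μ} → Boxed p κ ν μ → Interlaces κ μ × Interlaces μ ν × part μ 0 ≤ p
Boxed⁻ []            = [] , [] , z≤n
Boxed⁻ {p} (_∷_ {k = k} {κ} {v} (l , h) b) with Boxed⁻ b
... | i , i′ , c = (≤-trans (m≤n⊔m v (part κ 0)) l , ≤-trans h (m⊓n≤m k p)) ∷ i ,
                   (c , ≤-trans (m≤m⊔n v (part κ 0)) l) ∷ i′ , ≤-trans h (m⊓n≤n k p)

∸-lower : ∀ {l u h} → l ≤ u → u ≤ h → l ≤ l + h ∸ u
∸-lower {l} {u} {h} _ u≤h = subst (l ≤_) (sym (+-∸-assoc l u≤h)) (m≤m+n l (h ∸ u))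

∸-upper : ∀ {l u h} → l ≤ u → u ≤ h → l + h ∸ u ≤ h
∸-upper {l} {u} {h} l≤u _ = ≤-trans (∸-monoʳ-≤ (l + h) l≤u) (≤-reflexive (m+n∸m≡n l h))

reflect-Boxed : ∀ {p κ ν μ} → Boxed p κ ν μ → Boxed p κ ν (reflect p κ ν μ)
reflect-Boxed []            = []
reflect-Boxed ((l , h) ∷ b) = (∸-lower l h , ∸-upper l h) ∷ reflect-Boxed b

reflect-involutive : ∀ {p κ ν μ} → Boxed p κ ν μ → reflect p κ ν (reflect p κ ν μ) ≡ μ
reflect-involutive []                    = refl
reflect-involutive (_∷_ {p} {k} {κ} {v} (l , h) b) =
  cong₂ _∷_ (m∸[m∸n]≡n (≤-trans h (m≤n+m (k ⊓ p) (v ⊔ part κ 0)))) (reflect-involutive b)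

⊔+⊓ : ∀ v h → (v ⊔ h) + (h ⊓ v) ≡ v + h
⊔+⊓ v h with ≤-total v h
... | inj₁ v≤h = trans (cong₂ _+_ (m≤n⇒m⊔n≡n v≤h) (m≥n⇒m⊓n≡n v≤h)) (+-comm h v)
... | inj₂ h≤v = cong₂ _+_ (m≥n⇒m⊔n≡m h≤v) (m≤n⇒m⊓n≡m h≤v)

-- An entry and its reflection add up to the sum of the ends of their interval. The lower end ν_j ⊔
-- κ_{j+1} pairs with the upper end κ_{j+1} ⊓ ν_j of the next interval to ν_j + κ_{j+1}, so the
-- total telescopes; the extra summands account for the unpaired first upper end.
reflect-sum : ∀ {p κ ν μ} → Boxed p κ ν μ →
              sum (reflect p κ ν μ) + sum μ + part κ 0 ≡ sum κ + sum ν + (part κ 0 ⊓ p)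
reflect-sum []            = refl
reflect-sum {p} (_∷_ {k = k} {κ} {v} {ν} {u} {μ} (l , h) b) = +-cancelʳ-≡ h₁ _ _ (begin
  (x + s + (u + t) + k) + h₁                 ≡⟨ solve 6 (λ x s u t k h → (x :+ s :+ (u :+ t) :+ k) :+ h := (x :+ u) :+ k :+ (s :+ t :+ h)) refl x s u t k h₁ ⟩
  (x + u) + k + (s + t + h₁)                 ≡⟨ cong₂ (λ y z → y + k + z) (m∸n+n≡m (≤-trans h (m≤n+m (k ⊓ p) (v ⊔ h₁)))) (reflect-sum b) ⟩
  ((v ⊔ h₁) + (k ⊓ p)) + k + (sum κ + sum ν + (h₁ ⊓ v))
    ≡⟨ solve 6 (λ m n k a b o → (m :+ n) :+ k :+ (a :+ b :+ o) := (m :+ o) :+ (k :+ a :+ b :+ n)) refl (v ⊔ h₁) (k ⊓ p) k (sum κ) (sum ν) (h₁ ⊓ v) ⟩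
  ((v ⊔ h₁) + (h₁ ⊓ v)) + (k + sum κ + sum ν + (k ⊓ p)) ≡⟨ cong (_+ (k + sum κ + sum ν + (k ⊓ p))) (⊔+⊓ v h₁) ⟩
  (v + h₁) + (k + sum κ + sum ν + (k ⊓ p))
    ≡⟨ solve 6 (λ v h k a b n → (v :+ h) :+ (k :+ a :+ b :+ n) := (k :+ a :+ (v :+ b) :+ n) :+ h) refl v h₁ k (sum κ) (sum ν) (k ⊓ p) ⟩
  (k + sum κ + (v + sum ν) + (k ⊓ p)) + h₁   ∎)
  where
  open ≡-Reasoning
  open +-*-Solver
  h₁ = part κ 0
  x = (v ⊔ h₁) + (k ⊓ p) ∸ u
  s = sum (reflect v κ ν μ)
  t = sum μ

module Reflection (κ : List ℕ) where

  p₀ : ℕ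
  p₀ = part κ 0

  strip-pairs : ℕ → ℕ → List (List ℕ × List ℕ)
  strip-pairs q p = pairsOf (strips-of-size κ q) (λ μ → strips-of-size μ p)

  record Reflected (x y : List ℕ × List ℕ) : Set where
    constructor reflected
    field
      boxed  : Boxed p₀ κ (proj₂ x) (proj₁ x)
      image  : y ≡ (reflect p₀ κ (proj₂ x) (proj₁ x) , proj₂ x)

  Reflected-sym : ∀ {x y} → Reflected x y → Reflected y x
  Reflected-sym (reflected b refl) = reflected (reflect-Boxed b) (cong (_, _) (sym (reflect-involutive b)))

  functional : ∀ {x y y′} → Reflected x y → Reflected x y′ → y ≡ y′
  functional r r′ = trans (Reflected.image r) (sym (Reflected.image r′))

  to : ∀ q p {x} → x ∈ strip-pairs q p → ∃[ y ] (y ∈ strip-pairs p q × Reflected x y)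
  to q p {μ , ν} x∈ =
    let μ∈ , ν∈ = ∈-pairsOf⁻ (strips-of-size κ q) x∈
        i , e = ∈-strips-of-size⁻ κ μ∈
        i′ , e′ = ∈-strips-of-size⁻ μ ν∈
        b = Boxed⁺ i i′ (proj₂ (Interlaces-part i 0))
        μ′ = reflect p₀ κ ν μ
        j , j′ , _ = Boxed⁻ (reflect-Boxed b)
        total : sum μ′ + sum μ ≡ sum κ + sum ν
        total = +-cancelʳ-≡ p₀ _ _ (trans (reflect-sum b) (cong (sum κ + sum ν +_) (⊓-idem p₀)))
    in (μ′ , ν) , ∈-pairsOf⁺ (∈-strips-of-size⁺ j (outer (sum μ′) (sum μ) (sum κ) (sum ν) p total e′))
                             (∈-strips-of-size⁺ j′ (inner (sum μ′) (sum μ) (sum κ) (sum ν) q total e)) ,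
       reflected b refl
    where
    outer : ∀ μ′ μ κ ν p → μ′ + μ ≡ κ + ν → ν + p ≡ μ → μ′ + p ≡ κ
    outer μ′ _ κ ν p t refl = +-cancelʳ-≡ ν _ _ (trans (trans (+-assoc μ′ p ν) (cong (μ′ +_) (+-comm p ν))) t)
    inner : ∀ μ′ μ κ ν q → μ′ + μ ≡ κ + ν → μ + q ≡ κ → ν + q ≡ μ′
    inner μ′ μ _ ν q t refl = +-cancelʳ-≡ μ _ _ (trans (+-comm (ν + q) μ)
      (trans (trans (cong (μ +_) (+-comm ν q)) (sym (+-assoc μ q ν))) (sym t)))

  from : ∀ q p {y} → y ∈ strip-pairs p q → ∃[ x ] (x ∈ strip-pairs q p × Reflected x y)
  from q p y∈ = let x , x∈ , r = to p q y∈ in x , x∈ , Reflected-sym r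

  strip-pairs-unique : ∀ q p → Unique (strip-pairs q p)
  strip-pairs-unique q p = pairsOf-unique (strips-of-size-unique κ q) (λ {μ} _ → strips-of-size-unique μ p)

  exchange-last : ∀ q p a → kostka κ (q ∷ p ∷ a) ≡ kostka κ (p ∷ q ∷ a)
  exchange-last q p a = trans (sym (sum-pairsOf (λ _ ν → kostka ν a) (strips-of-size κ q) (λ μ → strips-of-size μ p)))
    (trans (sum-↭ (bij-↭ Reflected (strip-pairs-unique q p) (strip-pairs-unique p q) (to q p) (from q p) functional
             (λ r r′ → functional (Reflected-sym r) (Reflected-sym r′))
             (λ { _ (reflected _ refl) → refl })))
           (sum-pairsOf (λ _ ν → kostka ν a) (strips-of-size κ p) (λ μ → strips-of-size μ q)))

kostka-↭ : ∀ κ {a b} → a ↭ b → kostka κ a ≡ kostka κ b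
kostka-↭ κ Perm.refl           = refl
kostka-↭ κ (Perm.prep q p)     = cong sum (map-cong (λ ν → kostka-↭ ν p) (strips-of-size κ q))
kostka-↭ κ {_ ∷ _ ∷ a} (Perm.swap x y p) = trans (Reflection.exchange-last κ x y a)
  (cong sum (map-cong (λ ν → cong sum (map-cong (λ ν′ → kostka-↭ ν′ p) (strips-of-size ν x))) (strips-of-size κ y)))
kostka-↭ κ (Perm.trans p q)    = trans (kostka-↭ κ p) (kostka-↭ κ q)

-- Removing strips creates trailing zeros, so this condition replaces `IsPartition` in the
-- recursion.
Antitone : List ℕ → Set
Antitone κ = ∀ j → part κ (suc j) ≤ part κ j

Interlaces-antitone : ∀ {κ ν} → Interlaces κ ν → Antitone ν
Interlaces-antitone i j = ≤-trans (proj₂ (Interlaces-part i (suc j))) (proj₁ (Interlaces-part i j))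

record Tableau (m : ℕ) (κ : List ℕ) (T : Filling) : Set where
  constructor tableau
  field
    lengths : map length T ≡ κ
    letters : All (_∈ [1‥ m ]) (concat T)
    semistd : Semistandard _≤_ T

∈-SSYT⇒Tableau : ∀ {m κ T} → Antitone κ → T ∈ SSYT m κ → Tableau m κ T
∈-SSYT⇒Tableau {m} {κ} {T} anti T∈ =
  let T∈f , inc = ∈-filter⁻ (increasing? _≤?_ _<?_) {xs = fillings [1‥ m ] κ} T∈
      eq , ps = ∈-fillings⁻ κ T∈f
  in tableau eq ps (Increasing⇒Semistandard T (λ j → subst₂ _≤_
       (trans (cong (λ μ → part μ (suc j)) (sym eq)) (sym (length-rowAt T (suc j))))
       (trans (cong (λ μ → part μ j) (sym eq)) (sym (length-rowAt T j))) (anti j)) inc)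

Tableau⇒∈-SSYT : ∀ {m κ T} → Tableau m κ T → T ∈ SSYT m κ
Tableau⇒∈-SSYT {m} {κ} {T} (tableau eq ps sst) = ∈-filter⁺ (increasing? _≤?_ _<?_)
  (subst (λ μ → T ∈ fillings [1‥ m ] μ) eq (∈-fillings⁺ T ps)) (Semistandard⇒Increasing T sst)

All-rowAt : ∀ {P : Pred ℕ 0ℓ} T → All P (concat T) → ∀ j → All P (rowAt T j)
All-rowAt []      _ j       = []
All-rowAt (r ∷ T) p zero    = All.++⁻ˡ r p
All-rowAt (r ∷ T) p (suc j) = All-rowAt T (All.++⁻ʳ r p) j

count-++ : ∀ k u v → count k (u ++ v) ≡ count k u + count k v
count-++ k []      v = refl
count-++ k (x ∷ u) v = trans (cong (δ k x +_) (count-++ k u v)) (sym (+-assoc (δ k x) _ _))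

count-none : ∀ {k u} → All (k ≢_) u → count k u ≡ 0
count-none []       = refl
count-none {k} {_ ∷ u} (p ∷ ps) = trans (count-there u p) (count-none ps)

count-replicate : ∀ k t → count k (replicate t k) ≡ t
count-replicate k zero    = refl
count-replicate k (suc t) = trans (count-here k (replicate t k)) (cong suc (count-replicate k t))

exponents-suc : ∀ m u → exponents (suc m) u ≡ exponents m u ∷ʳ count (suc m) u
exponents-suc m u = begin
  map f [1‥ suc m ]                ≡⟨ cong (map f) (applyUpTo-∷ʳ suc m) ⟨
  map f ([1‥ m ] ∷ʳ suc m)         ≡⟨ map-++ f [1‥ m ] (suc m ∷ []) ⟩
  exponents m u ∷ʳ f (suc m)       ≡⟨ cong (exponents m u ∷ʳ_) (count-filter (suc m) u) ⟩
  exponents m u ∷ʳ count (suc m) u ∎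
  where
  open ≡-Reasoning
  f = λ k → length (filter (k ≟_) u)

exponents-cong : ∀ m {u v} → (∀ {k} → k ≤ m → count k u ≡ count k v) → exponents m u ≡ exponents m v
exponents-cong m {u} {v} eq = go [1‥ m ] (All.tabulate λ k∈ → proj₂ (∈-[1‥]⁻ k∈))
  where
  go : ∀ ks → All (_≤ m) ks → map (λ k → length (filter (k ≟_) u)) ks ≡ map (λ k → length (filter (k ≟_) v)) ks
  go []       []       = refl
  go (k ∷ ks) (p ∷ ps) = cong₂ _∷_ (trans (count-filter k u) (trans (eq p) (sym (count-filter k v)))) (go ks ps)

-- Tableaux with entries at most m + 1 are obtained from those with entries at
-- most m by filling a horizontal strip with the letter m + 1.
module Strip (m : ℕ) where

  M : ℕ
  M = suc m

  extend : List ℕ → Filling → Filling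
  extend (k ∷ κ) (r ∷ T) = (r ++ replicate (k ∸ length r) M) ∷ extend κ T
  extend _       _       = []

  small : List ℕ → List ℕ
  small = filter (_≤? m)

  restrict : Filling → Filling
  restrict = map small

  rowAt-extend : ∀ κ T j → length T ≡ length κ →
                 rowAt (extend κ T) j ≡ rowAt T j ++ replicate (part κ j ∸ length (rowAt T j)) M
  rowAt-extend []      []      j       _ = refl
  rowAt-extend (k ∷ κ) (r ∷ T) zero    _ = refl
  rowAt-extend (k ∷ κ) (r ∷ T) (suc j) l = rowAt-extend κ T j (suc-injective l)

  rowAt-restrict : ∀ T j → rowAt (restrict T) j ≡ small (rowAt T j)
  rowAt-restrict []      j       = refl
  rowAt-restrict (r ∷ T) zero    = refl
  rowAt-restrict (r ∷ T) (suc j) = rowAt-restrict T j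

  length-extended : ∀ r {k} → length r ≤ k → length (r ++ replicate (k ∸ length r) M) ≡ k
  length-extended r {k} l = trans (length-++ r) (trans (cong (length r +_) (length-replicate (k ∸ length r))) (m+[n∸m]≡n l))

  extend-lengths : ∀ {κ} T → Interlaces κ (map length T) → map length (extend κ T) ≡ κ
  extend-lengths {[]}    []      []            = refl
  extend-lengths {k ∷ κ} (r ∷ T) ((_ , l) ∷ i) = cong₂ _∷_ (length-extended r l) (extend-lengths T i)

  small-replicate : ∀ t → small (replicate t M) ≡ []
  small-replicate zero    = refl
  small-replicate (suc t) = trans (filter-reject (_≤? m) {xs = replicate t M} 1+n≰n) (small-replicate t)

  restrict-extend : ∀ {κ} T → Interlaces κ (map length T) → All (_≤ m) (concat T) → restrict (extend κ T) ≡ T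
  restrict-extend {[]}    []      []      _ = refl
  restrict-extend {k ∷ κ} (r ∷ T) (_ ∷ i) p = cong₂ _∷_
    (trans (filter-++ (_≤? m) r (replicate (k ∸ length r) M))
      (trans (cong₂ _++_ (filter-all (_≤? m) (All.++⁻ˡ r p)) (small-replicate (k ∸ length r))) (++-identityʳ r)))
    (restrict-extend T i (All.++⁻ʳ r p))

  small-none : ∀ {x xs} → m < x → All (x ≤_) xs → small (x ∷ xs) ≡ []
  small-none m<x ps = filter-none (_≤? m) (<⇒≱ m<x ∷ All.map (λ x≤y → <⇒≱ (<-≤-trans m<x x≤y)) ps)

  sorted-row : ∀ {r} → AllPairs _≤_ r → All (_≤ M) r → r ≡ small r ++ replicate (length r ∸ length (small r)) M
  sorted-row {[]}    []       []       = refl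
  sorted-row {x ∷ r} (p ∷ ps) (q ∷ qs) with x ≤? m
  ... | yes x≤m = subst (λ u → x ∷ r ≡ u ++ replicate (suc (length r) ∸ length u) M)
                    (sym (filter-accept (_≤? m) {x} {r} x≤m)) (cong (x ∷_) (sorted-row ps qs))
  ... | no x≰m = subst (λ u → x ∷ r ≡ u ++ replicate (suc (length r) ∸ length u) M)
                    (sym (small-none (≰⇒> x≰m) p)) (all-M (x≡M ∷ All.zipWith (λ (x≤y , y≤M) → ≤-antisym y≤M (≤-trans (≰⇒> x≰m) x≤y)) (p , qs)))
    where
    x≡M : x ≡ M
    x≡M = ≤-antisym q (≰⇒> x≰m)
    all-M : ∀ {u} → All (_≡ M) u → u ≡ replicate (length u) M
    all-M []          = refl
    all-M (refl ∷ es) = cong (M ∷_) (all-M es)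

  small-≤ : ∀ r → length (small r) ≤ length r
  small-≤ = List.length-filter (_≤? m)

  Above-small : ∀ {xs ys} → Above xs ys → AllPairs _≤_ ys → Above (small xs) (small ys)
  Above-small []      _       = []
  Above-small {x ∷ xs} {y ∷ ys} (x<y ∷ a) (p ∷ ps) with y ≤? m
  ... | yes y≤m = subst₂ Above (sym (filter-accept (_≤? m) {x} {xs} (≤-trans (<⇒≤ x<y) y≤m)))
                               (sym (filter-accept (_≤? m) {y} {ys} y≤m)) (x<y ∷ Above-small a ps)
  ... | no y≰m  = subst (Above (small (x ∷ xs))) (sym (small-none (≰⇒> y≰m) p)) []

  -- Below an entry that is at most `M` there is one that is at most `m`; this is the lower
  -- interlacing bound.
  Above-small-length : ∀ {xs ys} → Above xs ys → All (_≤ M) ys → length ys ≤ length (small xs)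
  Above-small-length []        _        = z≤n
  Above-small-length {x ∷ xs} (x<y ∷ a) (q ∷ qs) = subst (λ u → _ ≤ length u)
    (sym (filter-accept (_≤? m) {x} {xs} (s≤s⁻¹ (<-≤-trans x<y q)))) (s≤s (Above-small-length a qs))

  -- The added letters `M` stand on old entries, never on other letters `M`, by the bound on the
  -- length.
  Above-++ : ∀ {xs ys} zs t → Above xs ys → All (_≤ m) xs → length ys + t ≤ length xs → Above (xs ++ zs) (ys ++ replicate t M)
  Above-++ {xs}     zs zero    [] _        _       = []
  Above-++ {x ∷ xs} zs (suc t) [] (p ∷ ps) (s≤s l) = s≤s p ∷ Above-++ zs t [] ps l
  Above-++ zs t (p ∷ a) (_ ∷ ps) (s≤s l) = p ∷ Above-++ zs t a ps l

  AllPairs-replicate : ∀ {r} t → AllPairs _≤_ r → All (_≤ m) r → AllPairs _≤_ (r ++ replicate t M)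
  AllPairs-replicate t ps qs = AllPairs.++⁺ ps (constant t)
    (All.map (λ x≤m → All.replicate⁺ t (m≤n⇒m≤1+n x≤m)) qs)
    where
    constant : ∀ t → AllPairs _≤_ (replicate t M)
    constant zero    = []
    constant (suc t) = All.replicate⁺ t ≤-refl ∷ constant t

  widen : ∀ {a} → a ∈ [1‥ m ] → a ∈ [1‥ M ]
  widen a∈ = let l , u = ∈-[1‥]⁻ a∈ in ∈-[1‥]⁺ l (m≤n⇒m≤1+n u)

  extend-letters : ∀ κ T → All (_∈ [1‥ m ]) (concat T) → All (_∈ [1‥ M ]) (concat (extend κ T))
  extend-letters []      []      _ = []
  extend-letters []      (_ ∷ _) _ = []
  extend-letters (_ ∷ _) []      _ = []
  extend-letters (k ∷ κ) (r ∷ T) p = All.++⁺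
    (All.++⁺ (All.map widen (All.++⁻ˡ r p)) (All.replicate⁺ (k ∸ length r) (∈-[1‥]⁺ (s≤s z≤n) ≤-refl)))
    (extend-letters κ T (All.++⁻ʳ r p))

  extend-tableau : ∀ {κ ν T} → Interlaces κ ν → Tableau m ν T → Tableau M κ (extend κ T)
  extend-tableau {κ} {_} {T} i (tableau refl ps sst) = tableau (extend-lengths T i) (extend-letters κ T ps) (record
    { row-pairs = λ j → subst (AllPairs _≤_) (sym (at j)) (AllPairs-replicate _ (row-pairs j) (bound j))
    ; columns   = λ j → subst₂ Above (sym (at j)) (sym (at (suc j)))
        (Above-++ _ _ (columns j) (bound j) (fits j)) })
    where
    open Semistandard sst
    lengths : length T ≡ length κ
    lengths = trans (sym (length-map length T)) (Interlaces-length i)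
    at = λ j → rowAt-extend κ T j lengths
    bound : ∀ j → All (_≤ m) (rowAt T j)
    bound = All-rowAt T (All.map (proj₂ ∘ ∈-[1‥]⁻) ps)
    fits : ∀ j → length (rowAt T (suc j)) + (part κ (suc j) ∸ length (rowAt T (suc j))) ≤ length (rowAt T j)
    fits j = ≤-trans (≤-reflexive (m+[n∸m]≡n (≤-trans (≤-reflexive (length-rowAt T (suc j))) (proj₂ (Interlaces-part i (suc j))))))
      (≤-trans (proj₁ (Interlaces-part i j)) (≤-reflexive (sym (length-rowAt T j))))

  restrict-letters : ∀ T → All (_∈ [1‥ M ]) (concat T) → All (_∈ [1‥ m ]) (concat (restrict T))
  restrict-letters []      _ = []
  restrict-letters (r ∷ T) p = All.++⁺
    (All.tabulate λ a∈ → let a∈r , a≤m = ∈-filter⁻ (_≤? m) {xs = r} a∈ in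
      ∈-[1‥]⁺ (proj₁ (∈-[1‥]⁻ (All.lookup p (∈-++⁺ˡ a∈r)))) a≤m)
    (restrict-letters T (All.++⁻ʳ r p))

  module _ {κ T} (t : Tableau M κ T) where

    open Tableau t
    open Semistandard semistd

    bounded : ∀ j → All (_≤ M) (rowAt T j)
    bounded = All-rowAt T (All.map (proj₂ ∘ ∈-[1‥]⁻) letters)

    restrict-tableau : Tableau m (map length (restrict T)) (restrict T)
    restrict-tableau = tableau refl (restrict-letters T letters) (record
      { row-pairs = λ j → subst (AllPairs _≤_) (sym (rowAt-restrict T j)) (AllPairs.filter⁺ (_≤? m) (row-pairs j))
      ; columns   = λ j → subst₂ Above (sym (rowAt-restrict T j)) (sym (rowAt-restrict T (suc j)))
          (Above-small (columns j) (row-pairs (suc j))) })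

    part-κ : ∀ j → length (rowAt T j) ≡ part κ j
    part-κ j = trans (length-rowAt T j) (cong (λ μ → part μ j) lengths)

    part-restrict : ∀ j → length (small (rowAt T j)) ≡ part (map length (restrict T)) j
    part-restrict j = trans (cong length (sym (rowAt-restrict T j))) (length-rowAt (restrict T) j)

    length-T : length T ≡ length κ
    length-T = trans (sym (length-map length T)) (cong length lengths)

    restrict-interlaces : Interlaces κ (map length (restrict T))
    restrict-interlaces = part-Interlaces κ (map length (restrict T))
      (trans (length-map length (restrict T)) (trans (length-map small T) length-T))
      λ j → subst₂ _≤_ (part-κ (suc j)) (part-restrict j) (Above-small-length (columns j) (bounded (suc j))) ,
            subst₂ _≤_ (part-restrict j) (part-κ j) (small-≤ (rowAt T j))

    extend-restrict : T ≡ extend κ (restrict T)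
    extend-restrict = rowAt-ext
      (trans length-T (trans (sym (cong length (extend-lengths (restrict T) restrict-interlaces))) (length-map length (extend κ (restrict T)))))
      λ j → trans (sorted-row (row-pairs j) (bounded j)) (sym (trans
        (rowAt-extend κ (restrict T) j (trans (length-map small T) length-T))
        (cong₂ (λ r k → r ++ replicate (k ∸ length r) M) (rowAt-restrict T j) (sym (part-κ j)))))

  count-extend : ∀ κ T {k} → k ≤ m → length T ≡ length κ → count k (concat (extend κ T)) ≡ count k (concat T)
  count-extend []      []      _ _ = refl
  count-extend (k₁ ∷ κ) (r ∷ T) {k} k≤m l = begin
    count k ((r ++ replicate t M) ++ concat (extend κ T))    ≡⟨ count-++ k (r ++ replicate t M) _ ⟩
    count k (r ++ replicate t M) + count k (concat (extend κ T)) ≡⟨ cong₂ _+_ (count-++ k r _) (count-extend κ T k≤m (suc-injective l)) ⟩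
    count k r + count k (replicate t M) + count k (concat T) ≡⟨ cong (λ c → count k r + c + count k (concat T))
                                                                  (count-none (All.replicate⁺ t (<⇒≢ (s≤s k≤m)))) ⟩
    count k r + 0 + count k (concat T)                       ≡⟨ cong (_+ count k (concat T)) (+-identityʳ (count k r)) ⟩
    count k r + count k (concat T)                           ≡⟨ count-++ k r (concat T) ⟨
    count k (r ++ concat T)                                  ∎
    where
    open ≡-Reasoning
    t = k₁ ∸ length r

  count-largest : ∀ {κ} T → Interlaces κ (map length T) → All (_≤ m) (concat T) →
                  sum (map length T) + count M (concat (extend κ T)) ≡ sum κ
  count-largest {[]}    []      []            _ = refl
  count-largest {k ∷ κ} (r ∷ T) ((_ , l) ∷ i) p = begin
    length r + s + count M ((r ++ replicate t M) ++ concat (extend κ T))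
      ≡⟨ cong (length r + s +_) (trans (count-++ M (r ++ replicate t M) _) (cong (_+ c) (trans (count-++ M r _)
           (cong₂ _+_ (count-none (All.map (λ x≤m → <⇒≢ (s≤s x≤m) ∘ sym) (All.++⁻ˡ r p))) (count-replicate M t))))) ⟩
    length r + s + (t + c)   ≡⟨ solve 4 (λ l s t c → l :+ s :+ (t :+ c) := (l :+ t) :+ (s :+ c)) refl (length r) s t c ⟩
    (length r + t) + (s + c) ≡⟨ cong₂ _+_ (m+[n∸m]≡n l) (count-largest T i (All.++⁻ʳ r p)) ⟩
    k + sum κ                ∎
    where
    open ≡-Reasoning
    open +-*-Solver
    t = k ∸ length r
    s = sum (map length T)
    c = count M (concat (extend κ T))

tableaux : ∀ m → List ℕ → Monomial → List Filling
tableaux m κ a = filter (λ T → List.≡-dec _≟_ (exponents m (concat T)) a) (SSYT m κ)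

tableaux-unique : ∀ m κ a → Unique (tableaux m κ a)
tableaux-unique m κ a = Unique.filter⁺ _ (Unique.filter⁺ (increasing? _≤?_ _<?_) (fillings-unique κ ([1‥]-unique m)))

∈-tableaux⁺ : ∀ {m κ a T} → Tableau m κ T → exponents m (concat T) ≡ a → T ∈ tableaux m κ a
∈-tableaux⁺ t eq = ∈-filter⁺ _ (Tableau⇒∈-SSYT t) eq

∈-tableaux⁻ : ∀ {m κ a T} → Antitone κ → T ∈ tableaux m κ a → Tableau m κ T × exponents m (concat T) ≡ a
∈-tableaux⁻ {m} {κ} {a} anti T∈ =
  let T∈′ , eq = ∈-filter⁻ (λ T → List.≡-dec _≟_ (exponents m (concat T)) a) {xs = SSYT m κ} T∈
  in ∈-SSYT⇒Tableau {κ = κ} anti T∈′ , eq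

module LastLetter (m : ℕ) (κ : List ℕ) (anti : Antitone κ) (q : ℕ) (b : Monomial) where

  open Strip m

  smaller : List (List ℕ × Filling)
  smaller = pairsOf (strips-of-size κ q) (λ ν → tableaux m ν b)

  record Extends (p : List ℕ × Filling) (S : Filling) : Set where
    constructor extends
    field
      extended   : S ≡ extend κ (proj₂ p)
      restricted : proj₂ p ≡ restrict S
      lengths    : proj₁ p ≡ map length (proj₂ p)

  injective : ∀ {p p′ S} → Extends p S → Extends p′ S → p ≡ p′
  injective (extends _ refl refl) (extends _ refl refl) = refl

  exponents-extend : ∀ {T} → Interlaces κ (map length T) → All (_≤ m) (concat T) →
                     exponents M (concat (extend κ T)) ≡ exponents m (concat T) ∷ʳ count M (concat (extend κ T))
  exponents-extend {T} i p = trans (exponents-suc m (concat (extend κ T)))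
    (cong (_∷ʳ count M (concat (extend κ T))) (exponents-cong m {concat (extend κ T)} {concat T} λ k≤m →
      count-extend κ T k≤m (trans (sym (length-map length T)) (Interlaces-length i))))

  to : ∀ {p} → p ∈ smaller → ∃[ S ] (S ∈ tableaux M κ (b ∷ʳ q) × Extends p S)
  to {ν , T} p∈ =
    let ν∈ , T∈ = ∈-pairsOf⁻ (strips-of-size κ q) p∈
        i , size = ∈-strips-of-size⁻ κ ν∈
        t , exp = ∈-tableaux⁻ {κ = ν} (Interlaces-antitone i) T∈
    in build i size t exp
    where
    build : Interlaces κ ν → sum ν + q ≡ sum κ → Tableau m ν T → exponents m (concat T) ≡ b →
            ∃[ S ] (S ∈ tableaux M κ (b ∷ʳ q) × Extends (ν , T) S)
    build i size t@(tableau refl ps _) refl = extend κ T ,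
      ∈-tableaux⁺ (extend-tableau i t) (trans (exponents-extend i small-letters) (cong (b ∷ʳ_)
        (+-cancelˡ-≡ (sum ν) _ _ (trans (count-largest T i small-letters) (sym size))))) ,
      extends refl (sym (restrict-extend T i small-letters)) refl
      where
      small-letters : All (_≤ m) (concat T)
      small-letters = All.map (proj₂ ∘ ∈-[1‥]⁻) ps

  from : ∀ {S} → S ∈ tableaux M κ (b ∷ʳ q) → ∃[ p ] (p ∈ smaller × Extends p S)
  from {S} S∈ =
    let t , exp = ∈-tableaux⁻ {κ = κ} anti S∈
        T = restrict S
        i = restrict-interlaces t
        t′ = restrict-tableau t
        small-letters = All.map (proj₂ ∘ ∈-[1‥]⁻) (Tableau.letters t′)
        exp′ = trans (sym (exponents-extend i small-letters)) (trans (cong (exponents M ∘ concat) (sym (extend-restrict t))) exp)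
        eq₁ , eq₂ = ∷ʳ-injective (exponents m (concat T)) b exp′
    in (map length T , T) ,
       ∈-pairsOf⁺ (∈-strips-of-size⁺ i (trans (cong (sum (map length T) +_) (sym eq₂)) (count-largest T i small-letters)))
                  (∈-tableaux⁺ t′ eq₁) ,
       extends (extend-restrict t) refl refl

  length-tableaux : length (tableaux M κ (b ∷ʳ q)) ≡ sum (map (λ ν → length (tableaux m ν b)) (strips-of-size κ q))
  length-tableaux = trans (sym (bij-length Extends
      (pairsOf-unique (strips-of-size-unique κ q) (λ {ν} _ → tableaux-unique m ν b)) (tableaux-unique M κ (b ∷ʳ q)) to from
      (λ e e′ → trans (Extends.extended e) (sym (Extends.extended e′))) injective))
    (length-pairsOf (strips-of-size κ q) (λ ν → tableaux m ν b))

no-letters : ∀ {T} → All (_∈ []) (concat T) → sum (map length T) ≡ 0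
no-letters {T} p = trans (sym (length-concat T)) (none p)
  where
  none : ∀ {xs : List ℕ} → All (_∈ []) xs → length xs ≡ 0
  none []       = refl
  none (() ∷ _)

zero-parts : ∀ κ → sum κ ≡ 0 → κ ≡ map length (replicate (length κ) ([] {A = ℕ}))
zero-parts []         _  = refl
zero-parts (zero ∷ κ) eq = cong (0 ∷_) (zero-parts κ eq)

empty-filling : ∀ (T : Filling) → sum (map length T) ≡ 0 → T ≡ replicate (length T) []
empty-filling []       _  = refl
empty-filling ([] ∷ T) eq = cong ([] ∷_) (empty-filling T eq)

no-tableau : ∀ {κ T} → T ∈ tableaux 0 κ [] → map length T ≡ κ × sum κ ≡ 0
no-tableau {κ} {T} T∈ =
  let T∈₁ , _ = ∈-filter⁻ (λ T → List.≡-dec _≟_ (exponents 0 (concat T)) []) {xs = SSYT 0 κ} T∈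
      T∈₂ , _ = ∈-filter⁻ (increasing? _≤?_ _<?_) {xs = fillings [] κ} T∈₁
      eq , ps = ∈-fillings⁻ κ T∈₂
  in eq , trans (cong sum (sym eq)) (no-letters {T} ps)

empty-tableaux : ∀ κ → length (tableaux 0 κ []) ≡ kostka κ []
empty-tableaux κ with sum κ ≟ 0
... | no ne = trans (cong length (empty {tableaux 0 κ []} (λ T∈ → ne (proj₂ (no-tableau {κ} T∈))))) (sym (if-no (sum κ ≟ 0) ne))
  where
  empty : ∀ {xs : List Filling} → (∀ {T} → ¬ T ∈ xs) → xs ≡ []
  empty {[]}    _ = refl
  empty {x ∷ _} f = contradiction (here refl) f
... | yes eq = trans (bij-length {X = tableaux 0 κ []} {Y = T₀ ∷ []} _≡_ (tableaux-unique 0 κ []) ([] ∷ [])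
    (λ {T} T∈ → T₀ , here refl , unique (no-tableau {κ} T∈)) (λ { (here refl) → T₀ , T₀∈ , refl })
    (λ p q → trans (sym p) q) (λ p q → trans p (sym q))) (sym (if-yes (sum κ ≟ 0) eq))
  where
  T₀ : Filling
  T₀ = replicate (length κ) []
  unique : ∀ {T} → map length T ≡ κ × sum κ ≡ 0 → T ≡ T₀
  unique {T} (refl , z) = trans (empty-filling T z) (cong (λ k → replicate k []) (sym (length-map length T)))
  T₀∈ : T₀ ∈ tableaux 0 κ []
  T₀∈ = ∈-tableaux⁺ (tableau (sym (zero-parts κ eq))
    (subst (All (_∈ [])) (sym (concat-empty (length κ))) [])
    (record { row-pairs = λ j → subst (AllPairs _≤_) (sym (rowAt-empty (length κ) j)) []
            ; columns = λ j → subst (Above _) (sym (rowAt-empty (length κ) (suc j))) [] })) refl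
    where
    concat-empty : ∀ ℓ → concat (replicate ℓ ([] {A = ℕ})) ≡ []
    concat-empty zero    = refl
    concat-empty (suc ℓ) = concat-empty ℓ

-- The recursion of `kostka` removes the last variable first, hence the reversed exponents.
length-tableaux-kostka : ∀ r {κ} → Antitone κ → length (tableaux (length r) κ (reverse r)) ≡ kostka κ r
length-tableaux-kostka []      {κ} _    = empty-tableaux κ
length-tableaux-kostka (q ∷ r) {κ} anti = trans
  (cong (λ b → length (tableaux (suc (length r)) κ b)) (unfold-reverse q r))
  (trans (LastLetter.length-tableaux (length r) κ anti q (reverse r))
    (sum-map-cong∈ (strips-of-size κ q) λ {ν} ν∈ →
      length-tableaux-kostka r {ν} (Interlaces-antitone (proj₁ (∈-strips-of-size⁻ κ ν∈)))))

schur-kostka : ∀ {κ} → Antitone κ → ∀ a → schur κ a ≡ kostka κ (reverse a)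
schur-kostka {κ} anti a = trans
  (cong₂ (λ m b → length (tableaux m κ b)) (sym (length-reverse a)) (sym (reverse-involutive a)))
  (length-tableaux-kostka (reverse a) {κ} anti)

schur-↭ : ∀ {κ} → Antitone κ → ∀ {a b} → a ↭ b → schur κ a ≡ schur κ b
schur-↭ {κ} anti {a} {b} p = trans (schur-kostka {κ} anti a) (trans
  (kostka-↭ κ (↭-trans (Perm.↭-reverse a) (↭-trans p (↭-sym (Perm.↭-reverse b))))) (sym (schur-kostka {κ} anti b)))

-- Partitions and sums

increment : ℕ → List ℕ → List ℕ
increment zero    []      = 1 ∷ []
increment zero    (m ∷ μ) = suc m ∷ μ
-- A default value: for addable rows `addable-bound` gives `r ≤ length μ`, so it does not arise.
increment (suc r) []      = []
increment (suc r) (m ∷ μ) = m ∷ increment r μ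

δ-suc : ∀ j r → δ (suc j) (suc r) ≡ δ j r
δ-suc j r with j ≟ r
... | yes refl = trans (δ-refl (suc j)) (sym (δ-refl j))
... | no j≢r   = trans (δ-≢ (j≢r ∘ suc-injective)) (sym (δ-≢ j≢r))

part-increment : ∀ r μ → r ≤ length μ → ∀ j → part (increment r μ) j ≡ δ j r + part μ j
part-increment zero    []      _       zero    = refl
part-increment zero    []      _       (suc j) = refl
part-increment zero    (m ∷ μ) _       zero    = refl
part-increment zero    (m ∷ μ) _       (suc j) = refl
part-increment (suc r) (m ∷ μ) (s≤s l) zero    = refl
part-increment (suc r) (m ∷ μ) (s≤s l) (suc j) =
  trans (part-increment r μ l j) (cong (_+ part μ j) (sym (δ-suc j r)))

sum-increment : ∀ r μ → r ≤ length μ → sum (increment r μ) ≡ suc (sum μ)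
sum-increment zero    []      _       = refl
sum-increment zero    (m ∷ μ) _       = refl
sum-increment (suc r) (m ∷ μ) (s≤s l) = trans (cong (m +_) (sum-increment r μ l)) (+-suc m (sum μ))

increment-positive : ∀ r {μ} → All (1 ≤_) μ → All (1 ≤_) (increment r μ)
increment-positive zero    []       = s≤s z≤n ∷ []
increment-positive zero    (p ∷ ps) = s≤s z≤n ∷ ps
increment-positive (suc r) []       = []
increment-positive (suc r) (p ∷ ps) = p ∷ increment-positive r ps

shape-of : Word → List ℕ
shape-of []      = []
shape-of (r ∷ w) = increment r (shape-of w)

addable-bound : ∀ {r w μ} → Addable r w → Shape μ w → r ≤ length μ
addable-bound zero                        _          = z≤n
addable-bound {μ = μ} (suc (removable p)) (shape eq) = part-bound μ (subst (0 <_) (eq _) (≤-<-trans z≤n p))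

shape-of-Shape : ∀ {w} → Yam w → Shape (shape-of w) w
shape-of-Shape []                = shape λ _ → refl
shape-of-Shape (_∷_ {r} {w} a y) = shape λ j →
  trans (cong (δ j r +_) (row-lengths (shape-of-Shape y) j))
        (sym (part-increment r (shape-of w) (addable-bound a (shape-of-Shape y)) j))

sum-shape-of : ∀ {w} → Yam w → sum (shape-of w) ≡ length w
sum-shape-of []                = refl
sum-shape-of (_∷_ {r} {w} a y) =
  trans (sum-increment r (shape-of w) (addable-bound a (shape-of-Shape y))) (cong suc (sum-shape-of y))

shape-of-positive : ∀ w → All (1 ≤_) (shape-of w)
shape-of-positive []      = []
shape-of-positive (r ∷ w) = increment-positive r (shape-of-positive w)

antitone-linked : ∀ μ → Antitone μ → Linked _≥_ μ
antitone-linked []          _    = []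
antitone-linked (m ∷ [])    _    = [-]
antitone-linked (m ∷ k ∷ μ) anti = anti 0 ∷ antitone-linked (k ∷ μ) (anti ∘ suc)

shape-of-partition : ∀ {w n} → Yam w → length w ≡ n → IsPartition n (shape-of w)
shape-of-partition {w} y l =
  antitone-linked (shape-of w) (λ j → subst₂ _≤_ (row-lengths sh (suc j)) (row-lengths sh j) (count-suc y j)) ,
  shape-of-positive w , trans (sum-shape-of y) l
  where sh = shape-of-Shape y

positive-part-ext : ∀ {μ ν} → All (1 ≤_) μ → All (1 ≤_) ν → (∀ j → part μ j ≡ part ν j) → μ ≡ ν
positive-part-ext []       []       _  = refl
positive-part-ext []       (q ∷ _)  eq = contradiction q (subst (¬_ ∘ (1 ≤_)) (eq 0) λ ())
positive-part-ext (p ∷ _)  []       eq = contradiction p (subst (¬_ ∘ (1 ≤_)) (sym (eq 0)) λ ())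
positive-part-ext (_ ∷ ps) (_ ∷ qs) eq = cong₂ _∷_ (eq 0) (positive-part-ext ps qs (eq ∘ suc))

-- The row lengths determine the parts up to trailing zeros, which positivity excludes.
Shape-unique : ∀ {n μ ν w} → IsPartition n μ → IsPartition n ν → Shape μ w → Shape ν w → μ ≡ ν
Shape-unique (_ , p , _) (_ , q , _) (shape e) (shape f) = positive-part-ext p q λ j → trans (sym (e j)) (f j)

partition-antitone : ∀ {n μ} → IsPartition n μ → Antitone μ
partition-antitone (l , _) = part-antitone l

length≤sum : ∀ {μ} → All (1 ≤_) μ → length μ ≤ sum μ
length≤sum []       = z≤n
length≤sum (p ∷ ps) = +-mono-≤ p (length≤sum ps)

parts≤sum : ∀ μ → All (_≤ sum μ) μ
parts≤sum []      = []
parts≤sum (m ∷ μ) = m≤m+n m (sum μ) ∷ All.map (λ l → ≤-trans l (m≤n+m (sum μ) m)) (parts≤sum μ)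

∈-partitions⁺ : ∀ {n μ} → IsPartition n μ → μ ∈ partitions n
∈-partitions⁺ {n} {μ} p@(_ , pos , refl) = ∈-filter⁺ (isPartition? n)
  (∈-concat⁺′ (∈-words⁺ refl (All.zipWith (λ (l , u) → ∈-[1‥]⁺ l u) (pos , parts≤sum μ)))
    (∈-map⁺ (words [1‥ n ]) (∈-upTo⁺ (s≤s (length≤sum pos))))) p

∈-partitions⁻ : ∀ {n μ} → μ ∈ partitions n → IsPartition n μ
∈-partitions⁻ {n} μ∈ = proj₂ (∈-filter⁻ (isPartition? n) {xs = concatMap (words [1‥ n ]) (upTo (suc n))} μ∈)

all-words-unique : ∀ {A : Set} {as : List A} {ks} → Unique as → Unique ks → Unique (concatMap (words as) ks)
all-words-unique {as = as} {ks} u uks = Unique.concat⁺ {xss = map (words as) ks}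
  (All.map⁺ (All.tabulate λ {k} _ → words-unique k u))
  (AllPairs.map⁺ (AllPairs.map (λ {k} {l} k≢l {v} (u∈ , v∈) →
    k≢l (trans (sym (proj₁ (∈-words⁻ k u∈))) (proj₁ (∈-words⁻ l v∈)))) uks))

partitions-unique : ∀ n → Unique (partitions n)
partitions-unique n = Unique.filter⁺ (isPartition? n) {xs = concatMap (words [1‥ n ]) (upTo (suc n))}
  (all-words-unique ([1‥]-unique n) (Unique.upTo⁺ (suc n)))

sumℤ : List ℤ → ℤ
sumℤ []       = 0ℤ
sumℤ (x ∷ xs) = x ℤ.+ sumℤ xs

sumℤ-++ : ∀ xs ys → sumℤ (xs ++ ys) ≡ sumℤ xs ℤ.+ sumℤ ys
sumℤ-++ []       ys = sym (ℤ.+-identityˡ (sumℤ ys))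
sumℤ-++ (x ∷ xs) ys = trans (cong (ℤ._+_ x) (sumℤ-++ xs ys)) (sym (ℤ.+-assoc x (sumℤ xs) (sumℤ ys)))

sumℤ-↭ : ∀ {xs ys} → xs ↭ ys → sumℤ xs ≡ sumℤ ys
sumℤ-↭ Perm.refl         = refl
sumℤ-↭ (Perm.prep x p)   = cong (ℤ._+_ x) (sumℤ-↭ p)
sumℤ-↭ {_ ∷ _ ∷ xs} (Perm.swap x y p) = trans (sym (ℤ.+-assoc x y (sumℤ xs)))
  (trans (cong₂ ℤ._+_ (ℤ.+-comm x y) (sumℤ-↭ p)) (ℤ.+-assoc y x _))
sumℤ-↭ (Perm.trans p q)  = trans (sumℤ-↭ p) (sumℤ-↭ q)

sumℤ-cong∈ : ∀ {A : Set} {f g : A → ℤ} (xs : List A) → (∀ {x} → x ∈ xs → f x ≡ g x) → sumℤ (map f xs) ≡ sumℤ (map g xs)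
sumℤ-cong∈ []       _ = refl
sumℤ-cong∈ (x ∷ xs) h = cong₂ ℤ._+_ (h (here refl)) (sumℤ-cong∈ xs (h ∘ there))

sumℤ-pairsOf : ∀ {A B : Set} (h : A → B → ℤ) (xs : List A) (f : A → List B) →
               sumℤ (map (λ (x , y) → h x y) (pairsOf xs f)) ≡ sumℤ (map (λ x → sumℤ (map (h x) (f x))) xs)
sumℤ-pairsOf h []       f = refl
sumℤ-pairsOf h (x ∷ xs) f = trans (cong sumℤ (map-++ (λ (x , y) → h x y) (map (x ,_) (f x)) (pairsOf xs f)))
  (trans (sumℤ-++ (map (λ (x , y) → h x y) (map (x ,_) (f x))) _)
         (cong₂ ℤ._+_ (cong sumℤ (sym (map-∘ (f x)))) (sumℤ-pairsOf h xs f)))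

coefficient-++ : ∀ p r k → coefficient (p ++ r) k ≡ coefficient p k ℤ.+ coefficient r k
coefficient-++ []            r k = sym (ℤ.+-identityˡ (coefficient r k))
coefficient-++ ((j , c) ∷ p) r k = trans (cong (ℤ._+_ t) (coefficient-++ p r k))
  (sym (ℤ.+-assoc t (coefficient p k) (coefficient r k)))
  where t = if does (j ℤ.≟ k) then c else 0ℤ

coefficient-∑ : ∀ {A : Set} (xs : List A) (F : A → Series) a k →
                coefficient (∑ xs F a) k ≡ sumℤ (map (λ x → coefficient (F x a) k) xs)
coefficient-∑ []       F a k = refl
coefficient-∑ (x ∷ xs) F a k = trans (coefficient-++ (F x a) (∑ xs F a) k) (cong (ℤ._+_ (coefficient (F x a) k)) (coefficient-∑ xs F a k))

-- The coefficient of q^k in c q^j, written in the form in which `_·_` produces it.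
monomial : ℤ → ℤ → ℕ → ℤ
monomial k j c = coefficient ((j , 1ℤ ℤ.* ℤ.+ c) ∷ []) k

monomial-+ : ∀ k j c d → monomial k j (c + d) ≡ monomial k j c ℤ.+ monomial k j d
monomial-+ k j c d with does (j ℤ.≟ k)
... | false = refl
... | true  = begin
  1ℤ ℤ.* ℤ.+ (c + d) ℤ.+ 0ℤ                          ≡⟨ simplify (c + d) ⟩
  ℤ.+ (c + d)                                        ≡⟨ ℤ.pos-+ c d ⟩
  ℤ.+ c ℤ.+ ℤ.+ d                                    ≡⟨ cong₂ ℤ._+_ (simplify c) (simplify d) ⟨
  1ℤ ℤ.* ℤ.+ c ℤ.+ 0ℤ ℤ.+ (1ℤ ℤ.* ℤ.+ d ℤ.+ 0ℤ)      ∎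
  where
  open ≡-Reasoning
  simplify : ∀ c → 1ℤ ℤ.* ℤ.+ c ℤ.+ 0ℤ ≡ ℤ.+ c
  simplify c = trans (ℤ.+-identityʳ (1ℤ ℤ.* ℤ.+ c)) (ℤ.*-identityˡ (ℤ.+ c))

monomial-0 : ∀ k j → monomial k j 0 ≡ 0ℤ
monomial-0 k j with does (j ℤ.≟ k)
... | false = refl
... | true  = refl

monomial-sum : ∀ {A : Set} k j (c : A → ℕ) xs → sumℤ (map (λ x → monomial k j (c x)) xs) ≡ monomial k j (sum (map c xs))
monomial-sum k j c []       = sym (monomial-0 k j)
monomial-sum k j c (x ∷ xs) = trans (cong (ℤ._+_ (monomial k j (c x))) (monomial-sum k j c xs)) (sym (monomial-+ k j (c x) _))

word-split₂ : ∀ m (w : Word) → 2 + m ≤ length w → ∃[ pre ] ∃[ r ] ∃[ q ] ∃[ s ] (w ≡ pre ++ r ∷ q ∷ s × length s ≡ m)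
word-split₂ m (x ∷ w) l with m≤n⇒m<n∨m≡n l
... | inj₁ (s≤s l′) with word-split₂ m w l′
... | pre , _ , _ , _ , refl , eq = x ∷ pre , _ , _ , _ , refl , eq
word-split₂ m (r ∷ q ∷ s) l | inj₂ eq = [] , r , q , s , refl , suc-injective (suc-injective (sym eq))
word-split₂ m (r ∷ [])    l | inj₂ ()

signature-ext : ∀ {m} {σ τ : Vec.Vec Sign m} → (∀ h → Vec.lookup σ h ≡ Vec.lookup τ h) → σ ≡ τ
signature-ext {σ = σ} {τ} eq = trans (sym (Vec.tabulate∘lookup σ)) (trans (Vec.tabulate-cong eq) (Vec.tabulate∘lookup τ))

sgn-cong : ∀ {n m N} (G : SignedColoredGraph n N) (H : SignedColoredGraph m N) {v w} →
           signature G v ≡ signature H w → ∀ j → sgn G v j ≡ sgn H w j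
sgn-cong         G H eq zero    = refl
sgn-cong {N = N} G H eq (suc h) with h <? N ∸ 1
... | yes h<m = cong (λ σ → Vec.lookup σ (fromℕ< h<m)) eq
... | no _    = refl

-- Classification of the components

-- Descent bounded by `b`: a vertex that is not least is connected to a smaller one.
least-below : ∀ {n N} (G : SignedColoredGraph n N) b v → toℕ v < b → ∃[ u ] (IsLeast G u × Connected G v u)
least-below G (suc b) v (s≤s v≤b) with isLeast? G v
... | yes least = v , least , ε
... | no ¬least with Fin.¬∀⟶∃¬ (size G) _ (λ w → connected? G v w →-dec (v Fin.≤? w)) ¬least
... | w , ¬w with connected? G v w
... | no ¬vw = contradiction (λ vw → contradiction vw ¬vw) ¬w
... | yes vw with v Fin.≤? w
... | yes v≤w = contradiction (λ _ → v≤w) ¬w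
... | no v≰w with least-below G b w (<-≤-trans (≰⇒> v≰w) v≤b)
... | u , least , wu = u , least , vw ◅◅ wu

component : ∀ {n N} (G : SignedColoredGraph n N) → Vertex G → List (Vertex G)
component G v = filter (connected? G v) (allFin (size G))

∈-component⁺ : ∀ {n N} (G : SignedColoredGraph n N) {v w} → Connected G v w → w ∈ component G v
∈-component⁺ G {v} {w} p = ∈-filter⁺ (connected? G v) (∈-allFin w) p

∈-component⁻ : ∀ {n N} (G : SignedColoredGraph n N) {v w} → w ∈ component G v → Connected G v w
∈-component⁻ G {v} w∈ = proj₂ (∈-filter⁻ (connected? G v) {xs = allFin (size G)} w∈)

component-unique : ∀ {n N} (G : SignedColoredGraph n N) v → Unique (component G v)
component-unique G v = Unique.filter⁺ (connected? G v) (Unique.allFin⁺ (size G))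

Connected-sym : ∀ {n N} (G : SignedColoredGraph n N) {v w} → Connected G v w → Connected G w v
Connected-sym G = Star.reverse λ (i , t , e) → i , t , E-sym G e

components-unique : ∀ {n N} (G : SignedColoredGraph n N) → Unique (components G)
components-unique G = Unique.filter⁺ (isLeast? G) (Unique.allFin⁺ (size G))

record InComponent {n N} (G : SignedColoredGraph n N) (v : Vertex G) (p : Vertex G × Vertex G) : Set where
  constructor in-component
  field
    v≡        : v ≡ proj₂ p
    least     : IsLeast G (proj₁ p)
    connected : Connected G (proj₁ p) (proj₂ p)

InComponent-functional : ∀ {n N} (G : SignedColoredGraph n N) {v p p′} → InComponent G v p → InComponent G v p′ → p ≡ p′
InComponent-functional G {v} {C , _} {C′ , _} (in-component refl l c) (in-component refl l′ c′) = cong (_, v)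
  (Fin.≤-antisym (l C′ (c ◅◅ Connected-sym G c′)) (l′ C (c′ ◅◅ Connected-sym G c)))

by-components : ∀ {n N} (G : SignedColoredGraph n N) (f : Vertex G → ℤ) →
                sumℤ (map f (allFin (size G))) ≡ sumℤ (map (λ C → sumℤ (map f (component G C))) (components G))
by-components G f = trans (sumℤ-↭ (bij-↭ (InComponent G) (Unique.allFin⁺ (size G))
    (pairsOf-unique (components-unique G) (λ {C} _ → component-unique G C))
    (λ {v} _ → let u , least , vu = least-below G (suc (toℕ v)) v ≤-refl in
      (u , v) , ∈-pairsOf⁺ (∈-filter⁺ (isLeast? G) (∈-allFin u) least) (∈-component⁺ G (Connected-sym G vu)) ,
      in-component refl least (Connected-sym G vu))
    (λ { {C , v} p∈ → let C∈ , v∈ = ∈-pairsOf⁻ (components G) p∈ in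
      v , ∈-allFin v , in-component refl (proj₂ (∈-filter⁻ (isLeast? G) {xs = allFin (size G)} C∈)) (∈-component⁻ G v∈) })
    (InComponent-functional G)
    (λ e e′ → trans (InComponent.v≡ e) (sym (InComponent.v≡ e′)))
    (λ _ e → cong f (InComponent.v≡ e))))
  (sumℤ-pairsOf (λ _ → f) (components G) (component G))

module Classification {n} (G : SignedColoredGraph n n) (deg : IsDualEquivalenceGraph G) where

  open Paths G

  Λ : Labelling G n n
  Λ = proj₁ (Labels.labelled G deg n ≤-refl)

  open Labelling Λ
  open Lifting G deg Λ ≤-refl

  L-injective : ∀ {v w} → Path G (_< n) v w → L v ≡ L w → v ≡ w
  L-injective = proj₂ (Labels.labelled G deg n ≤-refl)

  coloured : ∀ {v w} → Connected G v w → Path G (_< n) v w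
  coloured = Star.map λ (i , _ , e) → i , proj₂ (E-colour G e) , e

  connected : ∀ {v w} → Path G (_< n) v w → Connected G v w
  connected = Star.map λ (i , _ , e) → i , tt , e

  L-∼ : ∀ {v w} → Connected G v w → L v ∼ L w
  L-∼ {v} {w} p = let u , eq , v∼u , _ = path-word Λ [] (coloured p) refl (len v) ≤-refl
                  in subst (L v ∼_) (sym eq) v∼u

  shape-at : Vertex G → List ℕ
  shape-at v = shape-of (L v)

  shape-at-partition : ∀ v → IsPartition n (shape-at v)
  shape-at-partition v = shape-of-partition (yam v) (len v)

  standard-at : ∀ {v u} → Connected G v u → Standard n (shape-at v) (L u)
  standard-at {v} {u} p = standard (yam u)
    (shape λ j → trans (sym (counts (L-∼ p) j)) (row-lengths (shape-of-Shape (yam v)) j)) (len u)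

  signature-tab : ∀ {μ u w} → L u ≡ w → Standard n μ w → signature G u ≡ wordSignature n (contentWord n (tab μ w))
  signature-tab {μ} {u} refl st = signature-ext λ h →
    let pre , r , q , s , eq , l = word-split₂ (toℕ h) (L u) (subst (2 + toℕ h ≤_) (sym (len u)) (inside-bound (Fin.toℕ<n h)))
        reading = contentWord n (tab μ (L u))
    in trans (sym (sgn-σ G u h)) (trans (cong (sgn G u ∘ suc) (sym l)) (trans (sig u pre eq) (trans
         (sym (Reading.signature-at st pre eq))
         (trans (cong (λ k → if does (position reading (suc k) <? position reading (2 + k)) then Sign.+ else Sign.-) l)
           (sym (Vec.lookup∘tabulate _ h))))))
    where
    inside-bound : ∀ {h n} → h < n ∸ 1 → 2 + h ≤ n
    inside-bound {n = suc n} l = s≤s l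

  -- By `reach` and `L-injective` the labels of a component run exactly once through the tableaux of
  -- its shape, and signatures are determined by labels.
  expand-component : ∀ v a → sum (map (λ u → Q {n} (signature G u) a) (component G v)) ≡ schur (shape-at v) a
  expand-component v a = trans (sum-↭ (bij-↭ Labelled (component-unique G v) (SYT-unique n (shape-at v)) to from
      (λ l l′ → trans (Labelled.tab≡ l) (sym (Labelled.tab≡ l′))) injective
      (λ _ l → cong (λ σ → Q {n} σ a) (trans (signature-tab refl (standard-at (Labelled.joined l)))
        (cong (wordSignature n ∘ contentWord n) (sym (Labelled.tab≡ l)))))))
    (Expansion.expansion (shape-at-partition v) a)
    where
    record Labelled (u : Vertex G) (T : Filling) : Set where
      pattern
      constructor labelled
      field
        joined : Connected G v u
        tab≡   : T ≡ tab (shape-at v) (L u)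
    injective : ∀ {u u′ T} → Labelled u T → Labelled u′ T → u ≡ u′
    injective (labelled p e) (labelled p′ e′) = L-injective (coloured (Connected-sym G p ◅◅ p′))
      (tab-injective (standard-at p) (standard-at p′) (trans (sym e) e′))
    to : ∀ {u} → u ∈ component G v → ∃[ T ] (T ∈ SYT n (shape-at v) × Labelled u T)
    to {u} u∈ = let p = ∈-component⁻ G u∈ ; st = standard-at p in tab (shape-at v) (L u) ,
      ∈-SYT⁺ (Standard.is-yam st) (Standard.is-shape st) (Standard.has-size st) , labelled p refl
    from : ∀ {T} → T ∈ SYT n (shape-at v) → ∃[ u ] (u ∈ component G v × Labelled u T)
    from T∈ =
      let w , y , sh , l , eq = ∈-SYT⁻ (shape-at-partition v) T∈
          u , p , Lu = reach [] refl y (same λ j → trans (row-lengths sh j) (sym (row-lengths (shape-of-Shape (yam v)) j)))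
                         (trans l (sym (len v))) (≤-reflexive (len v))
          c = connected (weaken (≤-reflexive (len v)) p)
      in u , ∈-component⁺ G c , labelled c (trans (sym eq) (cong (tab (shape-at v)) (sym Lu)))

  -- A vertex is sent to the tableau of its label. Edges are reflected because a move lifts to an
  -- edge whose end is determined by its label.
  isomorphic : ∀ v → componentOf G v ≅ standardGraph n (shape-at v)
  isomorphic v = f , record
    { bijective = injective , λ T → let i , eq = surjective T in i , λ { refl → eq }
    ; signature-preserving = λ i → sym (trans (signature-tab (sym (word-f i)) (word-standard (f i)))
        (cong (wordSignature n ∘ contentWord n) (tab-word (f i))))
    ; edge-preserving = λ j a b → mk⇔ (preserves a b) (reflects a b)
    }
    where
    open StandardGraph n (shape-at v) (shape-at-partition v)
    vs = component G v
    joined : ∀ i → Connected G v (lookup vs i)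
    joined i = ∈-component⁻ G (∈-lookup i)
    f : Fin (length vs) → Vertex H
    f i = vertex (standard-at (joined i))
    word-f : ∀ i → word (f i) ≡ L (lookup vs i)
    word-f i = word-vertex (standard-at (joined i))
    vertices≡ : ∀ i {u} → Connected G v u → L (lookup vs i) ≡ L u → lookup vs i ≡ u
    vertices≡ i p = L-injective (coloured (Connected-sym G (joined i) ◅◅ p))
    injective : ∀ {i j} → f i ≡ f j → i ≡ j
    injective {i} {j} eq = lookup-injective (component-unique G v) i j
      (vertices≡ i (joined j) (trans (sym (word-f i)) (trans (cong word eq) (word-f j))))
    surjective : ∀ T → ∃[ i ] f i ≡ T
    surjective T =
      let st = word-standard T
          u , p , Lu = reach [] refl (Standard.is-yam st)
            (same λ j → trans (row-lengths (Standard.is-shape st) j) (sym (row-lengths (shape-of-Shape (yam v)) j)))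
            (trans (Standard.has-size st) (sym (len v))) (≤-reflexive (len v))
          u∈ = ∈-component⁺ G (connected (weaken (≤-reflexive (len v)) p))
          i = index u∈
      in i , word-injective (trans (word-f i) (trans (cong L (sym (Any.lookup-index u∈))) Lu))
    preserves : ∀ a b {j} → E G j (lookup vs a) (lookup vs b) → E H j (f a) (f b)
    preserves a b e = edge⁺ (⟶-between (sym (word-f a)) (sym (word-f b)) (edge e (proj₂ (E-colour G e))))
    reflects : ∀ a b {j} → E H j (f a) (f b) → E G j (lookup vs a) (lookup vs b)
    reflects a b e =
      let x , ex , Lx = lift (proj₂ (E-colour H e)) (⟶-between (word-f a) (word-f b) (edge⁻ e))
      in subst (E G _ (lookup vs a)) (sym (vertices≡ b (joined a ◅◅ (_ , tt , ex) ◅ ε) (sym Lx))) ex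

  -- An isomorphism is a simulation preserving signs, so it preserves labels, and the label of one
  -- vertex already determines the shape.
  shape-determined : ∀ {v μ} → IsPartition n μ → componentOf G v ≅ standardGraph n μ → μ ≡ shape-at v
  shape-determined {v} {μ} part (f , iso) = Shape-unique part (shape-at-partition v)
    (subst (Shape μ) (sym same-word) (Standard.is-shape (word-standard (f i₀)))) (shape-of-Shape (yam v))
    where
    open StandardGraph n μ part
    open IsIsomorphism iso
    vs = component G v
    record Corresponds (u : Vertex G) (T : Vertex H) : Set where
      pattern
      constructor corresponds
      field
        i  : Fin (length vs)
        u≡ : lookup vs i ≡ u
        T≡ : f i ≡ T
    closed : ∀ {j u T w} → Corresponds u T → E G j u w → ∃[ S ] (E H j T S × Corresponds w S)
    closed {j} {_} {_} {w} (corresponds i refl refl) e =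
      let w∈ = ∈-component⁺ G (∈-component⁻ G (∈-lookup i) ◅◅ (_ , tt , e) ◅ ε)
          k = index w∈
          eq = sym (Any.lookup-index w∈)
      in f k , Equivalence.to (edge-preserving j i k) (subst (E G j (lookup vs i)) (sym eq) e) , corresponds k eq refl
    signs≡ : ∀ {j u T} → Corresponds u T → sgn G u j ≡ sgn H T j
    signs≡ {j} (corresponds i refl refl) = sgn-cong G H (sym (signature-preserving i)) j
    v∈ = ∈-component⁺ G {v} {v} ε
    i₀ = index v∈
    open Simulation G deg Λ ≤-refl labelling Corresponds n (n≤1+n n) (n≤1+n n) (λ c _ → closed c) (λ {j} c _ → signs≡ {j} c)
    same-word : L v ≡ word (f i₀)
    same-word = same-label n ≤-refl [] [] (corresponds i₀ (sym (Any.lookup-index v∈)) refl) refl refl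
      (len v) (Standard.has-size (word-standard (f i₀)))

-- The Schur expansion

coefficient-∑∑ : ∀ {A B : Set} (xs : List A) (ys : A → List B) (α : B → ℤ) (f : A → Monomial → ℕ) a k →
  coefficient ((∑[ x ∈ xs ] ∑[ y ∈ ys x ] (q^ α y) · f x) a) k ≡
  sumℤ (map (λ x → sumℤ (map (λ y → monomial k (α y) (f x a)) (ys x))) xs)
coefficient-∑∑ xs ys α f a k = trans
  (coefficient-∑ xs (λ x → ∑[ y ∈ ys x ] (q^ α y) · f x) a k)
  (sumℤ-cong∈ xs λ {x} _ → coefficient-∑ (ys x) (λ y → (q^ α y) · f x) a k)

-- ps and cs stand for `partitions n` and `componentsIsoTo G`; only their
-- members matter, and computing them would be prohibitive.
module SchurExpansion {n} (G : SignedColoredGraph n n) (deg : IsDualEquivalenceGraph G)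
  (α : Vertex G → ℤ) (constant : ConstantOnComponents G α)
  (ps : List (List ℕ)) (ps! : Unique ps)
  (∈ps⁺ : ∀ {μ} → IsPartition n μ → μ ∈ ps) (∈ps⁻ : ∀ {μ} → μ ∈ ps → IsPartition n μ)
  (cs : List ℕ → List (Vertex G)) (cs! : ∀ μ → Unique (cs μ))
  (∈cs⁺ : ∀ {μ C} → C ∈ components G → componentOf G C ≅ standardGraph n μ → C ∈ cs μ)
  (∈cs⁻ : ∀ {μ C} → C ∈ cs μ → C ∈ components G × componentOf G C ≅ standardGraph n μ) where

  open Classification G deg

  schurExpansion : Series
  schurExpansion = ∑[ μ ∈ ps ] ∑[ C ∈ cs μ ] (q^ α C) · schur μ

  -- Each component occurs under exactly one partition, its shape; this turns the sum over
  -- components into the double sum over partitions.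
  record Classified (C : Vertex G) (p : List ℕ × Vertex G) : Set where
    constructor classified
    field
      shape≡  : proj₁ p ≡ shape-at C
      vertex≡ : proj₂ p ≡ C

  by-shapes : ∀ (f : List ℕ → Vertex G → ℤ) → sumℤ (map (λ C → f (shape-at C) C) (components G)) ≡
              sumℤ (map (λ μ → sumℤ (map (f μ) (cs μ))) ps)
  by-shapes f = trans (sumℤ-↭ (bij-↭ Classified (components-unique G)
      (pairsOf-unique ps! (λ {μ} _ → cs! μ))
      (λ {C} C∈ → (shape-at C , C) ,
        ∈-pairsOf⁺ (∈ps⁺ (shape-at-partition C)) (∈cs⁺ C∈ (isomorphic C)) , classified refl refl)
      (λ { {μ , C} p∈ → let μ∈ , C∈ = ∈-pairsOf⁻ ps p∈ ; C∈′ , iso = ∈cs⁻ C∈ in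
        C , C∈′ , classified (shape-determined {C} (∈ps⁻ μ∈) iso) refl })
      (λ { (classified refl refl) (classified refl refl) → refl })
      (λ { (classified _ refl) (classified _ refl) → refl })
      (λ { _ (classified refl refl) → refl })))
    (sumℤ-pairsOf f ps (cs))

  coefficient-schurExpansion : ∀ a k → coefficient (schurExpansion a) k ≡
    sumℤ (map (λ μ → sumℤ (map (λ C → monomial k (α C) (schur μ a)) (cs μ))) ps)
  coefficient-schurExpansion = coefficient-∑∑ ps (cs) α schur

  component-contribution : ∀ a k C → sumℤ (map (λ v → monomial k (α v) (Q {n} (signature G v) a)) (component G C)) ≡
                           monomial k (α C) (schur (shape-at C) a)
  component-contribution a k C = trans
    (sumℤ-cong∈ (component G C) λ {v} v∈ → cong (λ j → monomial k j (Q {n} (signature G v) a)) (sym (constant C v (∈-component⁻ G v∈))))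
    (trans (monomial-sum k (α C) (λ v → Q {n} (signature G v) a) (component G C))
           (cong (monomial k (α C)) (expand-component C a)))

  expands : generatingFunction G α ≈ schurExpansion
  expands a k = begin
    coefficient (generatingFunction G α a) k
      ≡⟨ coefficient-∑ (allFin (size G)) (λ v → (q^ α v) · Q {n} (signature G v)) a k ⟩
    sumℤ (map (λ v → monomial k (α v) (Q {n} (signature G v) a)) (allFin (size G)))
      ≡⟨ by-components G (λ v → monomial k (α v) (Q {n} (signature G v) a)) ⟩
    sumℤ (map (λ C → sumℤ (map (λ v → monomial k (α v) (Q {n} (signature G v) a)) (component G C))) (components G))
      ≡⟨ sumℤ-cong∈ (components G) (λ {C} _ → component-contribution a k C) ⟩
    sumℤ (map (λ C → monomial k (α C) (schur (shape-at C) a)) (components G))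
      ≡⟨ by-shapes (λ μ C → monomial k (α C) (schur μ a)) ⟩
    sumℤ (map (λ μ → sumℤ (map (λ C → monomial k (α C) (schur μ a)) (cs μ))) ps)
      ≡⟨ coefficient-schurExpansion a k ⟨
    coefficient (schurExpansion a) k ∎
    where open ≡-Reasoning

  symmetric : Symmetric (generatingFunction G α)
  symmetric {a} {b} a↭b k = begin
    coefficient (generatingFunction G α a) k ≡⟨ expands a k ⟩
    coefficient (schurExpansion a) k         ≡⟨ coefficient-schurExpansion a k ⟩
    sumℤ (map (λ μ → sumℤ (map (λ C → monomial k (α C) (schur μ a)) (cs μ))) ps)
      ≡⟨ sumℤ-cong∈ ps (λ {μ} μ∈ → cong (λ c → sumℤ (map (λ C → monomial k (α C) c) (cs μ)))
           (schur-↭ {μ} (partition-antitone (∈ps⁻ μ∈)) a↭b)) ⟩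
    sumℤ (map (λ μ → sumℤ (map (λ C → monomial k (α C) (schur μ b)) (cs μ))) ps)
      ≡⟨ coefficient-schurExpansion b k ⟨
    coefficient (schurExpansion b) k         ≡⟨ expands b k ⟨
    coefficient (generatingFunction G α b) k ∎
    where open ≡-Reasoning

  schurCoefficient : List ℕ → Laurent
  schurCoefficient μ = concatMap (λ C → q^ α C) (cs μ)

  nonNegative : ∀ Cs → NonNegative (concatMap (λ C → q^ α C) Cs)
  nonNegative []       k = ℤ.+≤+ z≤n
  nonNegative (C ∷ Cs) k = ℤ.+-mono-≤ {0ℤ} (one (does (α C ℤ.≟ k))) (nonNegative Cs k)
    where
    one : ∀ b → 0ℤ ℤ.≤ (if b then 1ℤ else 0ℤ)
    one true  = ℤ.+≤+ z≤n
    one false = ℤ.+≤+ z≤n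

  ·-concat : ∀ Cs (f : Monomial → ℕ) a → (concatMap (λ C → q^ α C) Cs · f) a ≡ concatMap (λ C → ((q^ α C) · f) a) Cs
  ·-concat []       f a = refl
  ·-concat (C ∷ Cs) f a = cong (_ ∷_) (·-concat Cs f a)

  positive : generatingFunction G α ≈ (∑[ μ ∈ ps ] schurCoefficient μ · schur μ)
  positive a k = trans (expands a k)
    (cong (λ p → coefficient p k) (cong concat (map-cong (λ μ → sym (·-concat (cs μ) (schur μ) a)) ps)))

corollary3p10 : ∀ (n : ℕ) (G : SignedColoredGraph n n) → IsDualEquivalenceGraph G →
    (α : SignedColoredGraph.Vertex G → ℤ) → ConstantOnComponents G α →
    (generatingFunction G α ≈
    (∑[ μ ∈ partitions n ] ∑[ C ∈ componentsIsoTo G μ ] (q^ α C) · schur μ))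
    × Symmetric (generatingFunction G α)
    × SchurPositive n (generatingFunction G α)
corollary3p10 n G deg α constant =
  S.expands , (λ {a} {b} → S.symmetric {a} {b}) , S.schurCoefficient , (λ μ → S.nonNegative (componentsIsoTo G μ)) , S.positive
  where
  isoTo? : ∀ μ v → Dec (componentOf G v ≅ standardGraph n μ)
  isoTo? μ v = componentOf G v ≅? standardGraph n μ
  module S = SchurExpansion G deg α constant
    (partitions n) (partitions-unique n) ∈-partitions⁺ ∈-partitions⁻
    (componentsIsoTo G) (λ μ → Unique.filter⁺ (isoTo? μ) (components-unique G))
    (λ {μ} → ∈-filter⁺ (isoTo? μ)) (λ {μ} → ∈-filter⁻ (isoTo? μ) {xs = components G})
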